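{- Let $\mathbb{K}$ be a field of characteristic zero and let $G_1$, $G_2$ be two graphs (loopless, multiple edges allowed) without isolated vertices. Then $\mathcal{K}_{G_1}$ and $\mathcal{K}_{G_2}$ are isomorphic as filtered algebras if and only if $G_1$ and $G_2$ are isomorphic graphs.
   Context: For a graph $G$ on vertex set $\{0,\dots,n\}$: $\Phi_G$ is the commutative $\mathbb{K}$-algebra generated by $\phi_e$ ($e$ an edge of $G$) with relations $\phi_e^2=0$. For a vertex $i$ and edge $e$: $c_{i,e}=1$ if $e$ joins $i$ to $j$ with $i<j$, $c_{i,e}=-1$ if $e$ joins $i$ to $j$ with $i>j$, $c_{i,e}=0$ otherwise. $X_i=\sum_e c_{i,e}\phi_e$, $Y_i=\exp(X_i)=\prod_e(1+c_{i,e}\phi_e)$. $\mathcal{K}_G$ is the subalgebra of $\Phi_G$ generated by $1,Y_0,\dots,Y_n$, filtered by letting the $k$-th piece be the span of all products of at most $k$ of the $Y_i$ (empty product $1$). A filtered isomorphism is an algebra isomorphism mapping the $k$-th piece onto the $k$-th piece for every $k$. An isolated vertex is one incident to no edge. Graph isomorphism means a vertex bijection preserving the number of edges between each pair of vertices. -}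

module Defs where

open import Level using (Level; _⊔_)
open import Data.Sum using (_⊎_)
open import Algebra.Bundles using (CommutativeRing)
open import Data.Nat as ℕ using (ℕ; zero; suc)
open import Data.Fin as Fin using (Fin; zero; suc; _<_; _≟_)
open import Data.Product using (Σ; ∃; ∃-syntax; _×_; _,_; proj₁; proj₂)
open import Data.List using (List; []; _∷_; length; map; foldr; allFin)
open import Data.List.Relation.Unary.All using (All)
open import Relation.Nullary using (¬_; yes; no)
open import Relation.Binary.PropositionalEquality using (_≡_)
open import Function.Bundles using (Inverse; _↔_)

record Field (c ℓ : Level) : Set (Level.suc (c ⊔ ℓ)) where
  field
    commutativeRing : CommutativeRing c ℓ
  open CommutativeRing commutativeRing public
  field
    1≉0     : ¬ (1# ≈ 0#)
    inverse : ∀ x → ¬ (x ≈ 0#) → ∃[ y ] (x * y ≈ 1#)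

module _ {c ℓ : Level} (K : Field c ℓ) where
  open Field K

  natK : ℕ → Carrier
  natK zero    = 0#
  natK (suc n) = 1# + natK n

  CharZero : Set ℓ
  CharZero = ∀ n → ¬ (natK (suc n) ≈ 0#)

-- Graphs on the vertex set {0,…,n} = Fin (suc n) with m edges
-- (edges labelled by Fin m; multiple edges allowed, no loops).
-- Each edge is recorded by its endpoints (a , b) with a < b.

Edge : ℕ → Set
Edge n = Σ (Fin (suc n) × Fin (suc n)) λ p → proj₁ p < proj₂ p

Graph : ℕ → ℕ → Set
Graph n m = Fin m → Edge n

lo hi : ∀ {n} → Edge n → Fin (suc n)
lo e = proj₁ (proj₁ e)
hi e = proj₂ (proj₁ e)

Incident : ∀ {n} → Fin (suc n) → Edge n → Set
Incident v e = (v ≡ lo e) ⊎ (v ≡ hi e)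

NoIsolatedVertex : ∀ {n m} → Graph n m → Set
NoIsolatedVertex {n} {m} G = ∀ (v : Fin (suc n)) → ∃[ e ] Incident v (G e)

joins : ∀ {n} → Edge n → Fin (suc n) → Fin (suc n) → ℕ
joins e u v with lo e ≟ u | hi e ≟ v | lo e ≟ v | hi e ≟ u
... | yes _ | yes _ | _     | _     = 1
... | _     | _     | yes _ | yes _ = 1
... | _     | _     | _     | _     = 0

sumFin : ∀ {m} → (Fin m → ℕ) → ℕ
sumFin {zero}  f = 0
sumFin {suc m} f = f zero ℕ.+ sumFin (λ i → f (suc i))

mult : ∀ {n m} → Graph n m → Fin (suc n) → Fin (suc n) → ℕ
mult G u v = sumFin (λ e → joins (G e) u v)

record GraphIso {n₁ m₁ n₂ m₂} (G₁ : Graph n₁ m₁) (G₂ : Graph n₂ m₂) : Set where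
  field
    σ        : Fin (suc n₁) ↔ Fin (suc n₂)
  open Inverse σ using (to)
  field
    preserve : ∀ u v → mult G₂ (to u) (to v) ≡ mult G₁ u v

-- The algebra Φ_G for a graph with m edges: the commutative K-algebra
-- generated by φ_0,…,φ_{m-1} with φ_e² = 0.  An element is represented
-- recursively: Φ 0 = K, and an element of Φ (suc m) is a pair [ f₀ , f₁ ]
-- standing for f₀ + φ_0 · f₁ with f₀ , f₁ ∈ Φ m (in φ_1,…,φ_m).
-- (Thus Φ m has the squarefree monomials in φ_0,…,φ_{m-1} as a basis.)

module Algebra {c ℓ : Level} (K : Field c ℓ) where
  open Field K using (0#; 1#; -_) renaming (Carrier to 𝕂; _+_ to _+K_; _*_ to _*K_; _≈_ to _≈K_)

  data Φ : ℕ → Set c where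
    const : 𝕂 → Φ zero
    -- [ x₀ , x₁ ] stands for x₀ + φ_0 · x₁
    [_,_] : ∀ {m} → Φ m → Φ m → Φ (suc m)

  infix  4 _≈_
  infixl 6 _+_
  infixl 7 _*_ _·_

  _≈_ : ∀ {m} → Φ m → Φ m → Set ℓ
  const x ≈ const y = x ≈K y
  [ x₀ , x₁ ] ≈ [ y₀ , y₁ ] = (x₀ ≈ y₀) × (x₁ ≈ y₁)

  zeroΦ : ∀ {m} → Φ m
  zeroΦ {zero}  = const 0#
  zeroΦ {suc m} = [ zeroΦ , zeroΦ ]

  oneΦ : ∀ {m} → Φ m
  oneΦ {zero}  = const 1#
  oneΦ {suc m} = [ oneΦ , zeroΦ ]

  _+_ : ∀ {m} → Φ m → Φ m → Φ m
  const x + const y = const (x +K y)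
  [ x₀ , x₁ ] + [ y₀ , y₁ ] = [ x₀ + y₀ , x₁ + y₁ ]

  _·_ : ∀ {m} → 𝕂 → Φ m → Φ m
  a · const x = const (a *K x)
  a · [ x₀ , x₁ ] = [ a · x₀ , a · x₁ ]

  -- (x₀ + φ x₁)(y₀ + φ y₁) = x₀y₀ + φ (x₀y₁ + x₁y₀), using φ² = 0
  _*_ : ∀ {m} → Φ m → Φ m → Φ m
  const x * const y = const (x *K y)
  [ x₀ , x₁ ] * [ y₀ , y₁ ] = [ x₀ * y₀ , x₀ * y₁ + x₁ * y₀ ]

  φ : ∀ {m} → Fin m → Φ m
  φ {suc m} zero    = [ zeroΦ , oneΦ ]
  φ {suc m} (suc e) = [ φ e , zeroΦ ]

  prodΦ : ∀ {m} → List (Φ m) → Φ m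
  prodΦ = foldr _*_ oneΦ

  sumΦ : ∀ {m} → List (Φ m) → Φ m
  sumΦ = foldr _+_ zeroΦ

  coeff : ∀ {n} → Fin (suc n) → Edge n → 𝕂
  coeff i e with i ≟ lo e | i ≟ hi e
  ... | yes _ | _     = 1#
  ... | no _  | yes _ = - 1#
  ... | no _  | no _  = 0#

  -- Y_i = exp(X_i) = ∏_e (1 + c_{i,e} φ_e)
  Y : ∀ {n m} → Graph n m → Fin (suc n) → Φ m
  Y {n} {m} G i = prodΦ (map (λ e → oneΦ + coeff i (G e) · φ e) (allFin m))

  Filt : ∀ {n m} → Graph n m → ℕ → Φ m → Set (c ⊔ ℓ)
  Filt {n} G k x =
    Σ (List (𝕂 × List (Fin (suc n)))) λ terms → (All (λ t → length (proj₂ t) ℕ.≤ k) terms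
               × x ≈ sumΦ (map (λ t → proj₁ t · prodΦ (map (Y G) (proj₂ t))) terms))

  -- membership in the subalgebra 𝒦_G generated by 1, Y_0, …, Y_n
  In𝒦 : ∀ {n m} → Graph n m → Φ m → Set (c ⊔ ℓ)
  In𝒦 G x = ∃[ k ] Filt G k x

  record FilteredIso {n₁ m₁ n₂ m₂} (G₁ : Graph n₁ m₁) (G₂ : Graph n₂ m₂)
         : Set (c ⊔ ℓ) where
    field
      ψ        : (x : Φ m₁) → In𝒦 G₁ x → Φ m₂
      ψ-cong   : ∀ x y p q → x ≈ y → ψ x p ≈ ψ y q
      ψ-into   : ∀ x p → In𝒦 G₂ (ψ x p)
      ψ-+      : ∀ x y p q r → ψ (x + y) r ≈ ψ x p + ψ y q
      ψ-·      : ∀ a x p q → ψ (a · x) q ≈ a · ψ x p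
      ψ-*      : ∀ x y p q r → ψ (x * y) r ≈ ψ x p * ψ y q
      ψ-1      : ∀ p → ψ oneΦ p ≈ oneΦ
      ψ-inj    : ∀ x y p q → ψ x p ≈ ψ y q → x ≈ y
      ψ-surj   : ∀ z → In𝒦 G₂ z → ∃[ x ] Σ (In𝒦 G₁ x) λ p → ψ x p ≈ z
      ψ-filt   : ∀ k x p → Filt G₁ k x → Filt G₂ k (ψ x p)
      ψ-filt⁻¹ : ∀ k z → Filt G₂ k z →
                 ∃[ x ] Σ (In𝒦 G₁ x) λ p → Filt G₁ k x × ψ x p ≈ z

{-# OPTIONS --safe #-}

-- Put y_i = Y_i − 1 and z b = ∑ b_i y_i.  The coefficient of φ_e in z b is
-- b (lo e) − b (hi e), and the first filtration piece is spanned by 1 and the z b.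
-- An isomorphism therefore matches the vectors b of both graphs, and it
-- preserves the vanishing of products of the z b.  Such a product of full degree
-- only sees the linear parts, so the hyperplanes b (lo e) = b (hi e) of the two
-- graphs correspond, with multiplicities; this gives a map of edges that
-- preserves parallelism and the linear dependence of triples, hence distinguishes
-- triangles from stars.  The element z 1 has no linear part, and its
-- quadratic part consists of the pairs of edges with a common vertex; multiplied
-- by suitable powers of the z b it shows that adjacency of edges is preserved too.
-- Such an edge map is induced by a vertex bijection.  Since K need not have decidable
-- equality, all of this is done under a double negation, which is removed at
-- the end because isomorphism of finite graphs is decidable.
-- Conversely a graph isomorphism induces φ_e ↦ ± φ_{π e}.

module Submission where

open import Defs
open import Level using (Level; _⊔_)
open import Data.Nat using (ℕ)
open import Data.Product using (_×_)
open import Algebra.Bundles using (CommutativeMonoid; CommutativeRing)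
import Algebra.Properties.CommutativeMonoid.Sum as Sum
import Algebra.Properties.CommutativeSemigroup as CommutativeSemigroupProperties
import Algebra.Properties.Group as GroupProperties
import Algebra.Properties.Ring as RingProperties
open import Data.Bool using (Bool; true; false)
open import Data.Empty using (⊥; ⊥-elim)
open import Data.Fin as Fin using (Fin; zero; suc; _≟_; toℕ; punchIn)
open import Data.Fin.Permutation as Perm using (Permutation; _⟨$⟩ʳ_; _⟨$⟩ˡ_)
import Data.Fin.Properties as Fin
open import Data.List as List using (List; []; _∷_; _++_; length; map)
import Data.List.Properties as List
open import Data.List.Relation.Unary.All as All using (All; []; _∷_)
import Data.List.Relation.Unary.All.Properties as All
open import Data.Nat as ℕ using (zero; suc; z≤n; s≤s; _≤_; _<_)
import Data.Nat.Properties as ℕ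
open import Data.Nat.Solver using (module +-*-Solver)
open import Data.Product using (Σ; ∃; ∃-syntax; _,_; proj₁; proj₂)
open import Data.Sum using (_⊎_; inj₁; inj₂; [_,_]′)
open import Data.Vec using (Vec; []; _∷_; lookup; tabulate)
import Data.Vec.Properties as Vec
open import Function using (_∘_; flip; Inverse; _↔_; mk↔ₛ′)
open import Relation.Binary.PropositionalEquality using (_≡_; _≢_; refl; sym; trans; cong; cong₂; subst)
open import Relation.Nullary using (¬_; Dec; yes; no)
open import Relation.Nullary.Decidable using (_×-dec_; _⊎-dec_; ¬?; decidable-stable)

-- A form `z b` that kills an edge `e` is not free of `φ e`, which may survive in its quadratic and
-- higher terms. Weights on the edges cope with this: a class absent from the linear part is made
-- lighter than the other edges, but two light edges never weigh less than one heavy edge, so the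
-- higher terms do not lower the order of vanishing. A product whose order reaches the weight of the
-- whole edge set depends on leading terms alone. Characteristic zero enters through the factorials
-- in the top coefficient of a product of powers, and it provides enough scalars to avoid finitely
-- many hyperplanes. Adjacency needs two arguments. For edges uv and uw the test product contains a
-- form that kills these two classes and no other; there is none if v and w are joined, because a
-- form constant on u, v, w kills the edge vw too. In that case the dependence of the sides of a
-- triangle decides, for a class is never dependent on two disjoint other ones. The matching of
-- edges is canonical only between parallel classes; inside a class the edge map may be arbitrary,
-- which suffices because class sizes agree.

-- The commutative algebra structure of `Φ m`

module ΦRing {c ℓ : Level} (K : Field c ℓ) where
  open Algebra K
  private module F = Field K

  -- _≈_ computes by recursion and so hides its arguments from unification;
  -- the wrapper keeps them visible.
  infix 4 _≋_
  record _≋_ {m : ℕ} (x y : Φ m) : Set ℓ where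
    constructor ⟪_⟫
    field unwrap : x ≈ y
  open _≋_ public

  pair-cong : ∀ {m} {x y x′ y′ : Φ m} → x ≋ x′ → y ≋ y′ → [ x , y ] ≋ [ x′ , y′ ]
  pair-cong ⟪ p ⟫ ⟪ q ⟫ = ⟪ p , q ⟫

  ≋-refl : ∀ {m} {x : Φ m} → x ≋ x
  ≋-refl {x = const _}   = ⟪ F.refl ⟫
  ≋-refl {x = [ _ , _ ]} = pair-cong ≋-refl ≋-refl

  ≋-sym : ∀ {m} {x y : Φ m} → x ≋ y → y ≋ x
  ≋-sym {x = const _}   {const _}   ⟪ p ⟫     = ⟪ F.sym p ⟫
  ≋-sym {x = [ _ , _ ]} {[ _ , _ ]} ⟪ p , q ⟫ = pair-cong (≋-sym ⟪ p ⟫) (≋-sym ⟪ q ⟫)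

  ≋-trans : ∀ {m} {x y z : Φ m} → x ≋ y → y ≋ z → x ≋ z
  ≋-trans {x = const _} {const _} {const _} ⟪ p ⟫ ⟪ q ⟫ = ⟪ F.trans p q ⟫
  ≋-trans {x = [ _ , _ ]} {[ _ , _ ]} {[ _ , _ ]} ⟪ p , q ⟫ ⟪ r , s ⟫ =
    pair-cong (≋-trans ⟪ p ⟫ ⟪ r ⟫) (≋-trans ⟪ q ⟫ ⟪ s ⟫)

  +-cong : ∀ {m} {x y x′ y′ : Φ m} → x ≋ x′ → y ≋ y′ → x + y ≋ x′ + y′
  +-cong {x = const _} {const _} {const _} {const _} ⟪ p ⟫ ⟪ q ⟫ = ⟪ F.+-cong p q ⟫
  +-cong {x = [ _ , _ ]} {[ _ , _ ]} {[ _ , _ ]} {[ _ , _ ]} ⟪ p , q ⟫ ⟪ r , s ⟫ =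
    pair-cong (+-cong ⟪ p ⟫ ⟪ r ⟫) (+-cong ⟪ q ⟫ ⟪ s ⟫)

  +-assoc : ∀ {m} (x y z : Φ m) → (x + y) + z ≋ x + (y + z)
  +-assoc (const _) (const _) (const _) = ⟪ F.+-assoc _ _ _ ⟫
  +-assoc [ x , x′ ] [ y , y′ ] [ z , z′ ] = pair-cong (+-assoc x y z) (+-assoc x′ y′ z′)

  +-comm : ∀ {m} (x y : Φ m) → x + y ≋ y + x
  +-comm (const _) (const _) = ⟪ F.+-comm _ _ ⟫
  +-comm [ x , x′ ] [ y , y′ ] = pair-cong (+-comm x y) (+-comm x′ y′)

  +-identityˡ : ∀ {m} (x : Φ m) → zeroΦ + x ≋ x
  +-identityˡ (const _) = ⟪ F.+-identityˡ _ ⟫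
  +-identityˡ [ x , x′ ] = pair-cong (+-identityˡ x) (+-identityˡ x′)

  +-identityʳ : ∀ {m} (x : Φ m) → x + zeroΦ ≋ x
  +-identityʳ x = ≋-trans (+-comm x zeroΦ) (+-identityˡ x)

  +-commutativeMonoid : ℕ → CommutativeMonoid c ℓ
  +-commutativeMonoid m = record
    { Carrier = Φ m ; _≈_ = _≋_ ; _∙_ = _+_ ; ε = zeroΦ
    ; isCommutativeMonoid = record
      { isMonoid = record
        { isSemigroup = record
          { isMagma = record
            { isEquivalence = record { refl = ≋-refl ; sym = ≋-sym ; trans = ≋-trans }
            ; ∙-cong = +-cong }
          ; assoc = +-assoc }
        ; identity = +-identityˡ , +-identityʳ }
      ; comm = +-comm } }

  private module M {m} = CommutativeSemigroupProperties
                           (CommutativeMonoid.commutativeSemigroup (+-commutativeMonoid m))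

  ·-cong : ∀ {m} {a b} {x y : Φ m} → a F.≈ b → x ≋ y → a · x ≋ b · y
  ·-cong {x = const _} {const _} p ⟪ q ⟫ = ⟪ F.*-cong p q ⟫
  ·-cong {x = [ _ , _ ]} {[ _ , _ ]} p ⟪ q , r ⟫ = pair-cong (·-cong p ⟪ q ⟫) (·-cong p ⟪ r ⟫)

  ·-congˡ : ∀ {m} {a} {x y : Φ m} → x ≋ y → a · x ≋ a · y
  ·-congˡ = ·-cong F.refl

  ·-distribˡ : ∀ {m} a (x y : Φ m) → a · (x + y) ≋ a · x + a · y
  ·-distribˡ a (const _) (const _) = ⟪ F.distribˡ _ _ _ ⟫
  ·-distribˡ a [ x , x′ ] [ y , y′ ] = pair-cong (·-distribˡ a x y) (·-distribˡ a x′ y′)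

  ·-distribʳ : ∀ {m} a b (x : Φ m) → (a F.+ b) · x ≋ a · x + b · x
  ·-distribʳ a b (const _) = ⟪ F.distribʳ _ _ _ ⟫
  ·-distribʳ a b [ x , x′ ] = pair-cong (·-distribʳ a b x) (·-distribʳ a b x′)

  ·-assoc : ∀ {m} a b (x : Φ m) → (a F.* b) · x ≋ a · (b · x)
  ·-assoc a b (const _) = ⟪ F.*-assoc _ _ _ ⟫
  ·-assoc a b [ x , x′ ] = pair-cong (·-assoc a b x) (·-assoc a b x′)

  ·-identity : ∀ {m} (x : Φ m) → F.1# · x ≋ x
  ·-identity (const _) = ⟪ F.*-identityˡ _ ⟫
  ·-identity [ x , x′ ] = pair-cong (·-identity x) (·-identity x′)

  ·-zeroˡ : ∀ {m} (x : Φ m) → F.0# · x ≋ zeroΦ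
  ·-zeroˡ (const _) = ⟪ F.zeroˡ _ ⟫
  ·-zeroˡ [ x , x′ ] = pair-cong (·-zeroˡ x) (·-zeroˡ x′)

  ·-zeroʳ : ∀ {m} a → a · zeroΦ {m} ≋ zeroΦ
  ·-zeroʳ {zero}  a = ⟪ F.zeroʳ _ ⟫
  ·-zeroʳ {suc m} a = pair-cong (·-zeroʳ a) (·-zeroʳ a)

  *-cong : ∀ {m} {x y x′ y′ : Φ m} → x ≋ x′ → y ≋ y′ → x * y ≋ x′ * y′
  *-cong {x = const _} {const _} {const _} {const _} ⟪ p ⟫ ⟪ q ⟫ = ⟪ F.*-cong p q ⟫
  *-cong {x = [ _ , _ ]} {[ _ , _ ]} {[ _ , _ ]} {[ _ , _ ]} ⟪ p , q ⟫ ⟪ r , s ⟫ =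
    pair-cong (*-cong ⟪ p ⟫ ⟪ r ⟫)
              (+-cong (*-cong ⟪ p ⟫ ⟪ s ⟫) (*-cong ⟪ q ⟫ ⟪ r ⟫))

  *-comm : ∀ {m} (x y : Φ m) → x * y ≋ y * x
  *-comm (const _) (const _) = ⟪ F.*-comm _ _ ⟫
  *-comm [ x , x′ ] [ y , y′ ] =
    pair-cong (*-comm x y) (≋-trans (+-cong (*-comm x y′) (*-comm x′ y)) (+-comm _ _))

  *-distribˡ : ∀ {m} (x y z : Φ m) → x * (y + z) ≋ x * y + x * z
  *-distribˡ (const _) (const _) (const _) = ⟪ F.distribˡ _ _ _ ⟫
  *-distribˡ [ x , x′ ] [ y , y′ ] [ z , z′ ] =
    pair-cong (*-distribˡ x y z)
      (≋-trans (+-cong (*-distribˡ x y′ z′) (*-distribˡ x′ y z)) (M.interchange _ _ _ _))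

  *-distribʳ : ∀ {m} (x y z : Φ m) → (y + z) * x ≋ y * x + z * x
  *-distribʳ x y z = ≋-trans (*-comm _ _)
    (≋-trans (*-distribˡ x y z) (+-cong (*-comm _ _) (*-comm _ _)))

  *-zeroˡ : ∀ {m} (x : Φ m) → zeroΦ * x ≋ zeroΦ
  *-zeroˡ (const _) = ⟪ F.zeroˡ _ ⟫
  *-zeroˡ [ x , x′ ] =
    pair-cong (*-zeroˡ x) (≋-trans (+-cong (*-zeroˡ x′) (*-zeroˡ x)) (+-identityˡ _))

  *-zeroʳ : ∀ {m} (x : Φ m) → x * zeroΦ ≋ zeroΦ
  *-zeroʳ x = ≋-trans (*-comm _ _) (*-zeroˡ x)

  *-identityˡ : ∀ {m} (x : Φ m) → oneΦ * x ≋ x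
  *-identityˡ (const _) = ⟪ F.*-identityˡ _ ⟫
  *-identityˡ [ x , x′ ] =
    pair-cong (*-identityˡ x) (≋-trans (+-cong (*-identityˡ x′) (*-zeroˡ x)) (+-identityʳ _))

  *-identityʳ : ∀ {m} (x : Φ m) → x * oneΦ ≋ x
  *-identityʳ x = ≋-trans (*-comm _ _) (*-identityˡ x)

  *-assoc : ∀ {m} (x y z : Φ m) → (x * y) * z ≋ x * (y * z)
  *-assoc (const _) (const _) (const _) = ⟪ F.*-assoc _ _ _ ⟫
  *-assoc [ x , x′ ] [ y , y′ ] [ z , z′ ] = pair-cong (*-assoc x y z)
    (≋-trans (+-cong (*-assoc x y z′)
                     (≋-trans (*-distribʳ z _ _) (+-cong (*-assoc x y′ z) (*-assoc x′ y z))))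
    (≋-trans (≋-sym (+-assoc _ _ _))
             (+-cong (≋-sym (*-distribˡ x _ _)) ≋-refl)))

  ·-*ˡ : ∀ {m} a (x y : Φ m) → (a · x) * y ≋ a · (x * y)
  ·-*ˡ a (const _) (const _) = ⟪ F.*-assoc _ _ _ ⟫
  ·-*ˡ a [ x , x′ ] [ y , y′ ] = pair-cong (·-*ˡ a x y)
    (≋-trans (+-cong (·-*ˡ a x y′) (·-*ˡ a x′ y)) (≋-sym (·-distribˡ a _ _)))

  ·-*ʳ : ∀ {m} a (x y : Φ m) → x * (a · y) ≋ a · (x * y)
  ·-*ʳ a x y = ≋-trans (*-comm _ _) (≋-trans (·-*ˡ a y x) (·-congˡ (*-comm y x)))

  neg : ∀ {m} → Φ m → Φ m
  neg x = (F.- F.1#) · x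

  +-inverseʳ : ∀ {m} (x : Φ m) → x + neg x ≋ zeroΦ
  +-inverseʳ (const a) = ⟪ F.trans (F.+-congˡ (RingProperties.-1*x≈-x F.ring a)) (F.-‿inverseʳ a) ⟫
  +-inverseʳ [ x , x′ ] = pair-cong (+-inverseʳ x) (+-inverseʳ x′)

  Φ-ring : ℕ → CommutativeRing c ℓ
  Φ-ring m = record
    { Carrier = Φ m ; _≈_ = _≋_ ; _+_ = _+_ ; _*_ = _*_ ; -_ = neg ; 0# = zeroΦ ; 1# = oneΦ
    ; isCommutativeRing = record
      { isRing = record
        { +-isAbelianGroup = record
          { isGroup = record
            { isMonoid = CommutativeMonoid.isMonoid (+-commutativeMonoid m)
            ; inverse = (λ x → ≋-trans (+-comm _ _) (+-inverseʳ x)) , +-inverseʳ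
            ; ⁻¹-cong = ·-congˡ }
          ; comm = +-comm }
        ; *-cong = *-cong
        ; *-assoc = *-assoc
        ; *-identity = *-identityˡ , *-identityʳ
        ; distrib = *-distribˡ , *-distribʳ }
      ; *-comm = *-comm } }

-- Squarefree monomials, written as characteristic vectors of edge sets

Sub : ℕ → Set
Sub = Vec Bool

∅ : ∀ {m} → Sub m
∅ {zero}  = []
∅ {suc m} = false ∷ ∅

single : ∀ {m} → Fin m → Sub m
single zero    = true ∷ ∅
single (suc e) = false ∷ single e

wt : ∀ {m} → (Fin m → ℕ) → Sub m → ℕ
wt w []          = 0
wt w (true ∷ A)  = w zero ℕ.+ wt (w ∘ suc) A
wt w (false ∷ A) = wt (w ∘ suc) A

wt-∅ : ∀ {m} (w : Fin m → ℕ) → wt w ∅ ≡ 0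
wt-∅ {zero}  w = refl
wt-∅ {suc m} w = wt-∅ (w ∘ suc)

wt-single : ∀ {m} (w : Fin m → ℕ) e → wt w (single e) ≡ w e
wt-single w zero    = trans (cong (w zero ℕ.+_) (wt-∅ (w ∘ suc))) (ℕ.+-identityʳ _)
wt-single w (suc e) = wt-single (w ∘ suc) e

wt≤sumFin : ∀ {m} (w : Fin m → ℕ) A → wt w A ≤ sumFin w
wt≤sumFin w []          = z≤n
wt≤sumFin w (true ∷ A)  = ℕ.+-monoʳ-≤ (w zero) (wt≤sumFin (w ∘ suc) A)
wt≤sumFin w (false ∷ A) = ℕ.≤-trans (wt≤sumFin (w ∘ suc) A) (ℕ.m≤n+m _ (w zero))

-- These are the factorizations of the monomial `A` that contribute to a product: since φ_e² = 0,
-- every edge of `A` goes to exactly one factor.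
data Split : ∀ {m} → Sub m → Sub m → Sub m → Set where
  []    : Split [] [] []
  none  : ∀ {m} {A B C : Sub m} → Split A B C → Split (false ∷ A) (false ∷ B) (false ∷ C)
  left  : ∀ {m} {A B C : Sub m} → Split A B C → Split (true ∷ A) (true ∷ B) (false ∷ C)
  right : ∀ {m} {A B C : Sub m} → Split A B C → Split (true ∷ A) (false ∷ B) (true ∷ C)

wt-split : ∀ {m} (w : Fin m → ℕ) {A B C} → Split A B C → wt w A ≡ wt w B ℕ.+ wt w C
wt-split w []        = refl
wt-split w (none s)  = wt-split (w ∘ suc) s
wt-split w (left s)  = trans (cong (w zero ℕ.+_) (wt-split (w ∘ suc) s)) (sym (ℕ.+-assoc (w zero) _ _))
wt-split w (right {B = B} {C} s) = trans (cong (w zero ℕ.+_) (wt-split (w ∘ suc) s))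
  (solve 3 (λ a b c → a :+ (b :+ c) := b :+ (a :+ c)) refl (w zero) (wt (w ∘ suc) B) (wt (w ∘ suc) C))
  where open +-*-Solver

-- Edge colourings: up to two distinguished classes `c1`, `c2`, and `c0` for all other edges

data Colour : Set where
  c0 c1 c2 : Colour

δ : Colour → Colour → ℕ
δ c0 c0 = 1
δ c1 c1 = 1
δ c2 c2 = 1
δ _  _  = 0

_≟C_ : (c d : Colour) → Dec (c ≡ d)
c0 ≟C c0 = yes refl
c0 ≟C c1 = no λ ()
c0 ≟C c2 = no λ ()
c1 ≟C c0 = no λ ()
c1 ≟C c1 = yes refl
c1 ≟C c2 = no λ ()
c2 ≟C c0 = no λ ()
c2 ≟C c1 = no λ ()
c2 ≟C c2 = yes refl

δ-≡ : ∀ {c d} → c ≡ d → δ c d ≡ 1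
δ-≡ {c0} refl = refl
δ-≡ {c1} refl = refl
δ-≡ {c2} refl = refl

δ-≢ : ∀ {c d} → c ≢ d → δ c d ≡ 0
δ-≢ {c0} {c0} ne = ⊥-elim (ne refl)
δ-≢ {c0} {c1} ne = refl
δ-≢ {c0} {c2} ne = refl
δ-≢ {c1} {c0} ne = refl
δ-≢ {c1} {c1} ne = ⊥-elim (ne refl)
δ-≢ {c1} {c2} ne = refl
δ-≢ {c2} {c0} ne = refl
δ-≢ {c2} {c1} ne = refl
δ-≢ {c2} {c2} ne = ⊥-elim (ne refl)

count : ∀ {m} → (Fin m → Colour) → Colour → ℕ
count col c = sumFin (λ e → δ (col e) c)

sumFin-colour : ∀ {m} (ω : Colour → ℕ) (col : Fin m → Colour) →
  sumFin (λ e → ω (col e))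
    ≡ count col c0 ℕ.* ω c0 ℕ.+ (count col c1 ℕ.* ω c1 ℕ.+ count col c2 ℕ.* ω c2)
sumFin-colour {zero}  ω col = refl
sumFin-colour {suc m} ω col
  with col zero | sumFin-colour ω (col ∘ suc)
... | c0 | ih = trans (cong (ω c0 ℕ.+_) ih) (sym (ℕ.+-assoc (ω c0) _ _))
... | c1 | ih = trans (cong (ω c1 ℕ.+_) ih)
  (solve 4 (λ o a b c → o :+ (a :+ (b :+ c)) := a :+ ((o :+ b) :+ c)) refl
    (ω c1) (count (col ∘ suc) c0 ℕ.* ω c0) (count (col ∘ suc) c1 ℕ.* ω c1) (count (col ∘ suc) c2 ℕ.* ω c2))
  where open +-*-Solver
... | c2 | ih = trans (cong (ω c2 ℕ.+_) ih)
  (solve 4 (λ o a b c → o :+ (a :+ (b :+ c)) := a :+ (b :+ (o :+ c))) refl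
    (ω c2) (count (col ∘ suc) c0 ℕ.* ω c0) (count (col ∘ suc) c1 ℕ.* ω c1) (count (col ∘ suc) c2 ℕ.* ω c2))
  where open +-*-Solver

-- Coefficients, exponentials and orders of vanishing

module Coefficients {c ℓ : Level} (K : Field c ℓ) where
  open Algebra K
  open ΦRing K
  private module F = Field K
  open F using () renaming (Carrier to 𝕂)
  private module ΦS {m} = CommutativeSemigroupProperties
                            (CommutativeRing.*-commutativeSemigroup (Φ-ring m))
  open ΦS using (x∙yz≈y∙xz; x∙yz≈z∙xy)

  *-nonzero : ∀ {a b} → ¬ (a F.≈ F.0#) → ¬ (b F.≈ F.0#) → ¬ (a F.* b F.≈ F.0#)
  *-nonzero {a} {b} a≉0 b≉0 ab≈0 with F.inverse a a≉0
  ... | a⁻¹ , aa⁻¹≈1 = b≉0 (F.trans (F.sym (F.*-identityˡ b))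
    (F.trans (F.*-congʳ (F.trans (F.sym aa⁻¹≈1) (F.*-comm a a⁻¹)))
    (F.trans (F.*-assoc _ _ _) (F.trans (F.*-congˡ ab≈0) (F.zeroʳ _)))))

  coef : ∀ {m} → Sub m → Φ m → 𝕂
  coef []          (const a)   = a
  coef (false ∷ A) [ x₀ , x₁ ] = coef A x₀
  coef (true ∷ A)  [ x₀ , x₁ ] = coef A x₁

  coef-cong : ∀ {m} (A : Sub m) {x y} → x ≋ y → coef A x F.≈ coef A y
  coef-cong []          {const _}   {const _}   ⟪ p ⟫     = p
  coef-cong (false ∷ A) {[ _ , _ ]} {[ _ , _ ]} ⟪ p , q ⟫ = coef-cong A ⟪ p ⟫
  coef-cong (true ∷ A)  {[ _ , _ ]} {[ _ , _ ]} ⟪ p , q ⟫ = coef-cong A ⟪ q ⟫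

  coef-ext : ∀ {m} (x y : Φ m) → (∀ A → coef A x F.≈ coef A y) → x ≋ y
  coef-ext (const _)   (const _)   h = ⟪ h [] ⟫
  coef-ext [ x , x′ ]  [ y , y′ ]  h =
    pair-cong (coef-ext x y (h ∘ (false ∷_))) (coef-ext x′ y′ (h ∘ (true ∷_)))

  coef-+ : ∀ {m} (A : Sub m) x y → coef A (x + y) F.≈ coef A x F.+ coef A y
  coef-+ []          (const _)   (const _)   = F.refl
  coef-+ (false ∷ A) [ x , _ ]   [ y , _ ]   = coef-+ A x y
  coef-+ (true ∷ A)  [ _ , x ]   [ _ , y ]   = coef-+ A x y

  coef-· : ∀ {m} (A : Sub m) a x → coef A (a · x) F.≈ a F.* coef A x
  coef-· []          a (const _)   = F.refl
  coef-· (false ∷ A) a [ x , _ ]   = coef-· A a x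
  coef-· (true ∷ A)  a [ _ , x ]   = coef-· A a x

  coef-zero : ∀ {m} (A : Sub m) → coef A zeroΦ F.≈ F.0#
  coef-zero []          = F.refl
  coef-zero (false ∷ A) = coef-zero A
  coef-zero (true ∷ A)  = coef-zero A

  -- A coefficient of a product is a sum over splittings of the monomial. Comparing two such sums
  -- term by term avoids ever writing them out.
  coef-*-cong : ∀ {m} (A : Sub m) (x x′ y y′ : Φ m) →
    (∀ {B C} → Split A B C → coef B x F.* coef C x′ F.≈ coef B y F.* coef C y′) →
    coef A (x * x′) F.≈ coef A (y * y′)
  coef-*-cong []          (const _) (const _) (const _) (const _) h = h []
  coef-*-cong (false ∷ A) [ x , _ ] [ x′ , _ ] [ y , _ ] [ y′ , _ ] h =
    coef-*-cong A x x′ y y′ (h ∘ none)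
  coef-*-cong (true ∷ A) [ x₀ , x₁ ] [ x₀′ , x₁′ ] [ y₀ , y₁ ] [ y₀′ , y₁′ ] h =
    F.trans (coef-+ A _ _)
    (F.trans (F.+-cong (coef-*-cong A x₀ x₁′ y₀ y₁′ (h ∘ right)) (coef-*-cong A x₁ x₀′ y₁ y₀′ (h ∘ left)))
             (F.sym (coef-+ A _ _)))

  coef-∅-* : ∀ {m} (x y : Φ m) → coef ∅ (x * y) F.≈ coef ∅ x F.* coef ∅ y
  coef-∅-* (const _)   (const _)   = F.refl
  coef-∅-* [ x , _ ]   [ y , _ ]   = coef-∅-* x y

  prod : ∀ {m} → (Fin m → 𝕂) → Sub m → 𝕂
  prod λs []          = F.1#
  prod λs (true ∷ A)  = λs zero F.* prod (λs ∘ suc) A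
  prod λs (false ∷ A) = prod (λs ∘ suc) A

  prod-∅ : ∀ {m} (λs : Fin m → 𝕂) → prod λs ∅ F.≈ F.1#
  prod-∅ {zero}  λs = F.refl
  prod-∅ {suc m} λs = prod-∅ (λs ∘ suc)

  prod-single : ∀ {m} (λs : Fin m → 𝕂) e → prod λs (single e) F.≈ λs e
  prod-single λs zero    = F.trans (F.*-congˡ (prod-∅ (λs ∘ suc))) (F.*-identityʳ _)
  prod-single λs (suc e) = prod-single (λs ∘ suc) e

  -- Only what weights and exponentials see of a monomial is recorded. For three or more edges a
  -- lower bound on the weight is enough, because such monomials only ever have to be discarded as
  -- too heavy.
  data SizeView {m} : Sub m → Set (c ⊔ ℓ) where
    empty : SizeView ∅
    one   : ∀ e → SizeView (single e)
    two   : ∀ {A} e f → (∀ w → wt w A ≡ w e ℕ.+ w f) →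
            (∀ λs → prod λs A F.≈ λs e F.* λs f) → SizeView A
    more  : ∀ {A} e f g → (∀ w → w e ℕ.+ w f ℕ.+ w g ≤ wt w A) → SizeView A

  sizeView : ∀ {m} (A : Sub m) → SizeView A
  sizeView [] = empty
  sizeView (false ∷ A) with sizeView A
  ... | empty           = empty
  ... | one e           = one (suc e)
  ... | two e f h p     = two (suc e) (suc f) (λ w → h (w ∘ suc)) (λ λs → p (λs ∘ suc))
  ... | more e f g h    = more (suc e) (suc f) (suc g) (λ w → h (w ∘ suc))
  sizeView (true ∷ A) with sizeView A
  ... | empty           = one zero
  ... | one e           = two zero (suc e) (λ w → cong (w zero ℕ.+_) (wt-single (w ∘ suc) e))
                              (λ λs → F.*-congˡ (prod-single (λs ∘ suc) e))
  ... | two e f h p     = more zero (suc e) (suc f) λ w →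
    ℕ.≤-reflexive (trans (ℕ.+-assoc (w zero) _ _) (cong (w zero ℕ.+_) (sym (h (w ∘ suc)))))
  ... | more e f g h    = more zero (suc e) (suc f) λ w →
    ℕ.≤-trans (ℕ.≤-reflexive (ℕ.+-assoc (w zero) _ _))
              (ℕ.+-monoʳ-≤ (w zero) (ℕ.≤-trans (ℕ.m≤m+n _ (w (suc g))) (h (w ∘ suc))))

  lin : ∀ {m} → Fin m → Φ m → 𝕂
  lin e x = coef (single e) x

  -- The exponential of ∑ λ_e φ_e; every `Y G i` is of this form.
  Exp : ∀ {m} → (Fin m → 𝕂) → Φ m
  Exp {zero}  λs = const F.1#
  Exp {suc m} λs = [ Exp (λs ∘ suc) , λs zero · Exp (λs ∘ suc) ]

  coef-Exp : ∀ {m} (A : Sub m) λs → coef A (Exp λs) F.≈ prod λs A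
  coef-Exp []          λs = F.refl
  coef-Exp (false ∷ A) λs = coef-Exp A (λs ∘ suc)
  coef-Exp (true ∷ A)  λs = F.trans (coef-· A _ _) (F.*-congˡ (coef-Exp A (λs ∘ suc)))

  coef-one : ∀ {m} (A : Sub m) → coef A oneΦ F.≈ prod (λ _ → F.0#) A
  coef-one []          = F.refl
  coef-one (false ∷ A) = coef-one A
  coef-one (true ∷ A)  = F.trans (coef-zero A) (F.sym (F.zeroˡ _))

  Exp-* : ∀ {m} (λs μs : Fin m → 𝕂) → Exp λs * Exp μs ≋ Exp (λ e → λs e F.+ μs e)
  Exp-* {zero}  λs μs = ⟪ F.*-identityˡ _ ⟫
  Exp-* {suc m} λs μs = pair-cong ih
    (≋-trans (+-cong (≋-trans (·-*ʳ _ _ _) (·-congˡ ih)) (≋-trans (·-*ˡ _ _ _) (·-congˡ ih)))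
    (≋-trans (+-comm _ _) (≋-sym (·-distribʳ _ _ _))))
    where ih = Exp-* (λs ∘ suc) (μs ∘ suc)

  -- The linear form ∑ λ_e φ_e.
  L : ∀ {m} → (Fin m → 𝕂) → Φ m
  L {zero}  λs = const F.0#
  L {suc m} λs = [ L (λs ∘ suc) , λs zero · oneΦ ]

  coef-L-∅ : ∀ {m} (λs : Fin m → 𝕂) → coef ∅ (L λs) F.≈ F.0#
  coef-L-∅ {zero}  λs = F.refl
  coef-L-∅ {suc m} λs = coef-L-∅ (λs ∘ suc)

  lin-L : ∀ {m} (λs : Fin m → 𝕂) e → lin e (L λs) F.≈ λs e
  lin-L {suc m} λs zero    = F.trans (coef-· (∅ {m}) _ (oneΦ {m}))
    (F.trans (F.*-congˡ (F.trans (coef-one (∅ {m})) (prod-∅ {m} (λ _ → F.0#)))) (F.*-identityʳ _))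
  lin-L {suc m} λs (suc e) = lin-L (λs ∘ suc) e

  infixr 8 _^_
  _^_ : ∀ {m} → Φ m → ℕ → Φ m
  x ^ zero  = oneΦ
  x ^ suc k = x * x ^ k

  ^-cong : ∀ {m} {x y : Φ m} k → x ≋ y → x ^ k ≋ y ^ k
  ^-cong zero    p = ≋-refl
  ^-cong (suc k) p = *-cong p (^-cong k p)

  -- Order of vanishing with respect to weights on the edges

  Ord : ∀ {m} → (Fin m → ℕ) → ℕ → Φ m → Set ℓ
  Ord w k x = ∀ A → wt w A < k → coef A x F.≈ F.0#

  Ord-* : ∀ {m} {w : Fin m → ℕ} {k k′ x x′} → Ord w k x → Ord w k′ x′ → Ord w (k ℕ.+ k′) (x * x′)
  Ord-* {w = w} {k} {k′} {x} {x′} p q A lt =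
    F.trans (coef-*-cong A x x′ zeroΦ zeroΦ h)
            (F.trans (coef-cong A (*-zeroˡ zeroΦ)) (coef-zero A))
    where
    h : ∀ {B C} → Split A B C → coef B x F.* coef C x′ F.≈ coef B zeroΦ F.* coef C zeroΦ
    h {B} {C} s with wt w B ℕ.<? k | wt w C ℕ.<? k′
    ... | yes b | _     = F.trans (F.*-congʳ (p B b)) (F.trans (F.zeroˡ _) (F.sym (F.trans (F.*-congʳ (coef-zero B)) (F.zeroˡ _))))
    ... | no _  | yes d = F.trans (F.*-congˡ (q C d)) (F.trans (F.zeroʳ _) (F.sym (F.trans (F.*-congʳ (coef-zero B)) (F.zeroˡ _))))
    ... | no b  | no d  = ⊥-elim (ℕ.<⇒≱ (subst (_< k ℕ.+ k′) (wt-split w s) lt)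
                                        (ℕ.+-mono-≤ (ℕ.≮⇒≥ b) (ℕ.≮⇒≥ d)))

  Ord-^ : ∀ {m} {w : Fin m → ℕ} {k x} j → Ord w k x → Ord w (j ℕ.* k) (x ^ j)
  Ord-^ zero    p A ()
  Ord-^ (suc j) p = Ord-* p (Ord-^ j p)

  -- No monomial outweighs the full edge set.
  Ord-vanish : ∀ {m} {w : Fin m → ℕ} {k x} → Ord w k x → sumFin w < k → x ≋ zeroΦ
  Ord-vanish {w = w} {x = x} p lt = coef-ext x zeroΦ λ A →
    F.trans (p A (ℕ.≤-<-trans (wt≤sumFin w A) lt)) (F.sym (coef-zero A))

  -- The last hypothesis makes every monomial of two or more edges heavy enough, so nothing has to
  -- be known about the nonlinear terms.
  Ord-intro : ∀ {m} {w : Fin m → ℕ} {k x} → coef ∅ x F.≈ F.0# →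
    (∀ e → w e < k → lin e x F.≈ F.0#) → (∀ e f → k ≤ w e ℕ.+ w f) → Ord w k x
  Ord-intro {w = w} {k} {x} h₀ h₁ h₂ A lt with sizeView A
  ... | empty        = h₀
  ... | one e        = h₁ e (subst (_< k) (wt-single w e) lt)
  ... | two e f h _  = ⊥-elim (ℕ.<⇒≱ lt (subst (k ≤_) (sym (h w)) (h₂ e f)))
  ... | more e f g h = ⊥-elim (ℕ.<⇒≱ lt (ℕ.≤-trans (h₂ e f) (ℕ.≤-trans (ℕ.m≤m+n _ _) (h w))))

  -- Equality of leading forms in weight `k`. As `agree` also covers the weights below `k`, the
  -- element `y` has order `k` as well.
  record Lead {m} (w : Fin m → ℕ) (k : ℕ) (x y : Φ m) : Set ℓ where
    constructor lead
    field
      ord   : Ord w k x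
      agree : ∀ A → wt w A ≤ k → coef A x F.≈ coef A y

  Lead-refl : ∀ {m} {w : Fin m → ℕ} {k x} → Ord w k x → Lead w k x x
  Lead-refl p = lead p (λ _ _ → F.refl)

  Lead-* : ∀ {m} {w : Fin m → ℕ} {k k′ x x′ y y′} →
    Lead w k x y → Lead w k′ x′ y′ → Lead w (k ℕ.+ k′) (x * x′) (y * y′)
  Lead-* {w = w} {k} {k′} {x} {x′} {y} {y′} (lead p a) (lead q b) =
    lead (Ord-* p q) λ A le → coef-*-cong A x x′ y y′ (h A le)
    where
    h : ∀ A → wt w A ≤ k ℕ.+ k′ → ∀ {B C} → Split A B C →
        coef B x F.* coef C x′ F.≈ coef B y F.* coef C y′
    h A le {B} {C} s with wt w B ℕ.<? k | wt w C ℕ.<? k′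
    ... | yes u | _ = F.trans (F.trans (F.*-congʳ (p B u)) (F.zeroˡ _))
      (F.sym (F.trans (F.*-congʳ (F.trans (F.sym (a B (ℕ.<⇒≤ u))) (p B u))) (F.zeroˡ _)))
    ... | no _ | yes v = F.trans (F.trans (F.*-congˡ (q C v)) (F.zeroʳ _))
      (F.sym (F.trans (F.*-congˡ (F.trans (F.sym (b C (ℕ.<⇒≤ v))) (q C v))) (F.zeroʳ _)))
    -- Both parts have at least their minimal weights `k` and `k′`, and together at most `k + k′`;
    -- hence each is exactly minimal, where the leading forms agree.
    ... | no u | no v = F.*-cong
      (a B (ℕ.+-cancelʳ-≤ k′ _ _ (ℕ.≤-trans (ℕ.+-monoʳ-≤ (wt w B) (ℕ.≮⇒≥ v)) le′)))
      (b C (ℕ.+-cancelˡ-≤ k _ _ (ℕ.≤-trans (ℕ.+-monoˡ-≤ (wt w C) (ℕ.≮⇒≥ u)) le′)))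
      where
      le′ : wt w B ℕ.+ wt w C ≤ k ℕ.+ k′
      le′ = subst (_≤ k ℕ.+ k′) (wt-split w s) le

  Lead-^ : ∀ {m} {w : Fin m → ℕ} {k x y} j → Lead w k x y → Lead w (j ℕ.* k) (x ^ j) (y ^ j)
  Lead-^ zero    p = Lead-refl (λ A ())
  Lead-^ (suc j) p = Lead-* p (Lead-^ j p)

  -- The full-degree principle: once the order reaches the total weight, no monomial lies beyond the
  -- leading form.
  Lead-≋ : ∀ {m} {w : Fin m → ℕ} {k x y} → Lead w k x y → sumFin w ≤ k → x ≋ y
  Lead-≋ {w = w} {x = x} {y} (lead _ a) le = coef-ext x y λ A → a A (ℕ.≤-trans (wt≤sumFin w A) le)

  -- A factor P of nearly full order in two weightings only sees those terms
  -- of x that are light in both of them.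
  two-weights : ∀ {m} (w w′ : Fin m → ℕ) {k k′ d x y} {P : Φ m} → Ord w k P → Ord w′ k′ P →
    sumFin w ≤ k ℕ.+ d → sumFin w′ ≤ k′ ℕ.+ d →
    (∀ A → wt w A ≤ d → wt w′ A ≤ d → coef A x F.≈ coef A y) → P * x ≋ P * y
  two-weights w w′ {k} {k′} {d} {x} {y} {P} p p′ le le′ h =
    coef-ext (P * x) (P * y) λ A → coef-*-cong A P x P y λ {B} {C} s → go A B C s
    where
    go : ∀ A B C → Split A B C → coef B P F.* coef C x F.≈ coef B P F.* coef C y
    go A B C s with wt w B ℕ.<? k | wt w′ B ℕ.<? k′
    ... | yes u | _     = F.trans (F.*-congʳ (p B u)) (F.trans (F.zeroˡ _) (F.sym (F.trans (F.*-congʳ (p B u)) (F.zeroˡ _))))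
    ... | no _  | yes u = F.trans (F.*-congʳ (p′ B u)) (F.trans (F.zeroˡ _) (F.sym (F.trans (F.*-congʳ (p′ B u)) (F.zeroˡ _))))
    ... | no u  | no u′ = F.*-congˡ (h C (light w u le) (light w′ u′ le′))
      where
      light : ∀ v {j} → ¬ (wt v B < j) → sumFin v ≤ j ℕ.+ d → wt v C ≤ d
      light v {j} u le = ℕ.+-cancelˡ-≤ j _ _ (ℕ.≤-trans (ℕ.+-monoˡ-≤ (wt v C) (ℕ.≮⇒≥ u))
        (ℕ.≤-trans (subst (_≤ sumFin v) (wt-split v s) (wt≤sumFin v A)) le))

  -- Products of linear forms

  triple : ∀ {m} → (Colour → Φ m) → (Colour → ℕ) → Φ m
  triple z n = z c0 ^ n c0 * (z c1 ^ n c1 * z c2 ^ n c2)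

  restrict : ∀ {m} → (Fin m → Colour) → (Fin m → 𝕂) → Colour → Fin m → 𝕂
  restrict col λs d e = natK K (δ (col e) d) F.* λs e

  top : ∀ {m} → Φ m → 𝕂
  top (const a)   = a
  top [ _ , x₁ ]  = top x₁

  top-cong : ∀ {m} {x y : Φ m} → x ≋ y → top x F.≈ top y
  top-cong {x = const _}   {const _}   ⟪ p ⟫     = p
  top-cong {x = [ _ , x ]} {[ _ , y ]} ⟪ p , q ⟫ = top-cong {x = x} {y} ⟪ q ⟫

  top-· : ∀ {m} a (x : Φ m) → top (a · x) F.≈ a F.* top x
  top-· a (const _)   = F.refl
  top-· a [ _ , x ]   = top-· a x

  top-zero : ∀ {m} → top (zeroΦ {m}) F.≈ F.0#
  top-zero {zero}  = F.refl
  top-zero {suc m} = top-zero {m}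

  ^-constant : ∀ {m} (x : Φ m) k → [ x , zeroΦ ] ^ k ≋ [ x ^ k , zeroΦ ]
  ^-constant x zero    = ≋-refl
  ^-constant x (suc k) = ≋-trans (*-cong ≋-refl (^-constant x k))
    (pair-cong ≋-refl (≋-trans (+-cong (*-zeroʳ _) (*-zeroˡ _)) (+-identityˡ _)))

  -- The binomial expansion stops after the linear term because the square of `φ zero` is 0. The
  -- factor `suc k` is what characteristic zero is needed for.
  ^-affine : ∀ {m} (x : Φ m) a k →
    [ x , a · oneΦ ] ^ suc k ≋ [ x ^ suc k , (natK K (suc k) F.* a) · x ^ k ]
  ^-affine x a zero = ≋-trans (*-identityʳ _)
    (pair-cong (≋-sym (*-identityʳ _))
      (·-cong (F.sym (F.trans (F.*-congʳ (F.+-identityʳ _)) (F.*-identityˡ _))) ≋-refl))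
  ^-affine x a (suc k) = ≋-trans (*-cong ≋-refl (^-affine x a k)) (pair-cong ≋-refl
    (≋-trans (+-cong (·-*ʳ _ x _) (≋-trans (·-*ˡ _ oneΦ _) (·-congˡ (*-identityˡ _))))
    (≋-trans (≋-sym (·-distribʳ _ _ _))
      (·-cong (F.trans (F.+-comm _ _) (F.trans (F.+-congʳ (F.sym (F.*-identityˡ a))) (F.sym (F.distribʳ _ _ _)))) ≋-refl))))

  top-affine : ∀ {m} (x y : Φ m) a k →
    top ([ x , a · oneΦ ] ^ suc k * [ y , zeroΦ ]) F.≈ (natK K (suc k) F.* a) F.* top (x ^ k * y)
  top-affine x y a k = F.trans (top-cong (*-cong (^-affine x a k) ≋-refl))
    (F.trans (top-cong {y = (natK K (suc k) F.* a) · (x ^ k * y)} (≋-trans (+-cong (*-zeroʳ (x ^ suc k)) (·-*ˡ _ (x ^ k) y)) (+-identityˡ _)))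
             (top-· _ (x ^ k * y)))

  pure-step : CharZero K → ∀ {m} {X} (x y : Φ m) a k → X ≋ [ x , a · oneΦ ] ^ suc k * [ y , zeroΦ ] →
    ¬ (a F.≈ F.0#) → ¬ (top (x ^ k * y) F.≈ F.0#) → ¬ (top X F.≈ F.0#)
  pure-step char0 x y a k eq a≉0 h p = *-nonzero (*-nonzero (char0 k) a≉0) h
    (F.trans (F.sym (top-affine x y a k)) (F.trans (F.sym (top-cong eq)) p))

  private
    absent : ∀ {m} (x y : Φ m) a j k →
      [ x , (F.0# F.* a) · oneΦ ] ^ j * [ y , (F.0# F.* a) · oneΦ ] ^ k ≋ [ x ^ j * y ^ k , zeroΦ ]
    absent x y a j k = ≋-trans
      (*-cong (≋-trans (^-cong j (pair-cong ≋-refl zero-coef)) (^-constant x j))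
              (≋-trans (^-cong k (pair-cong ≋-refl zero-coef)) (^-constant y k)))
      (pair-cong ≋-refl (≋-trans (+-cong (*-zeroʳ _) (*-zeroˡ _)) (+-identityˡ _)))
      where
      zero-coef : ∀ {m} → (F.0# F.* a) · oneΦ {m} ≋ zeroΦ
      zero-coef = ≋-trans (·-cong (F.zeroˡ a) ≋-refl) (·-zeroˡ oneΦ)

  -- Each edge can only be supplied by the form of its own colour, so the top coefficient is the
  -- product of all λ_e times the factorials of the three colour counts. The induction removes one
  -- edge and splits off one factor of each kind.
  pure-top : CharZero K → ∀ {m} (col : Fin m → Colour) (λs : Fin m → 𝕂) → (∀ e → ¬ (λs e F.≈ F.0#)) →
    ¬ (top (triple (λ d → L (restrict col λs d)) (count col)) F.≈ F.0#)
  pure-top char0 {zero}  col λs h p = F.1≉0 (F.trans (F.sym (F.trans (F.*-identityˡ _) (F.*-identityˡ _))) p)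
  pure-top char0 {suc m} col λs h with col zero | pure-top char0 (col ∘ suc) (λs ∘ suc) (h ∘ suc)
  -- The powers of the two other colours do not contain `φ zero`; `absent` collects them into a
  -- cofactor constant in it.
  ... | c0 | ih = pure-step char0 (W c0) (W c1 ^ n c1 * W c2 ^ n c2) (natK K 1 F.* λs zero) (n c0)
                    (*-cong ≋-refl (absent (W c1) (W c2) (λs zero) (n c1) (n c2)))
                    (*-nonzero (char0 0) (h zero)) ih
    where
    W = λ d → L (restrict (col ∘ suc) (λs ∘ suc) d)
    n = count (col ∘ suc)
  ... | c1 | ih = pure-step char0 (W c1) (W c0 ^ n c0 * W c2 ^ n c2) (natK K 1 F.* λs zero) (n c1)
                    (≋-trans (x∙yz≈y∙xz _ _ _) (*-cong ≋-refl (absent (W c0) (W c2) (λs zero) (n c0) (n c2))))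
                    (*-nonzero (char0 0) (h zero)) (λ q → ih (F.trans (top-cong (x∙yz≈y∙xz (W c0 ^ n c0) (W c1 ^ n c1) (W c2 ^ n c2))) q))
    where
    W = λ d → L (restrict (col ∘ suc) (λs ∘ suc) d)
    n = count (col ∘ suc)
  ... | c2 | ih = pure-step char0 (W c2) (W c0 ^ n c0 * W c1 ^ n c1) (natK K 1 F.* λs zero) (n c2)
                    (≋-trans (x∙yz≈z∙xy _ _ _) (*-cong ≋-refl (absent (W c0) (W c1) (λs zero) (n c0) (n c1))))
                    (*-nonzero (char0 0) (h zero)) (λ q → ih (F.trans (top-cong (x∙yz≈z∙xy (W c0 ^ n c0) (W c1 ^ n c1) (W c2 ^ n c2))) q))
    where
    W = λ d → L (restrict (col ∘ suc) (λs ∘ suc) d)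
    n = count (col ∘ suc)

  -- An edge of colour c0 outweighs an edge of another colour, and is outweighed
  -- by any two edges.
  private
    ω : Colour → ℕ
    ω c0 = 3
    ω c1 = 2
    ω c2 = 2

    ω≤3 : ∀ d → ω d ≤ 3
    ω≤3 c0 = ℕ.≤-refl
    ω≤3 c1 = s≤s (s≤s z≤n)
    ω≤3 c2 = s≤s (s≤s z≤n)

    2≤ω : ∀ d → 2 ≤ ω d
    2≤ω c0 = s≤s (s≤s z≤n)
    2≤ω c1 = s≤s (s≤s z≤n)
    2≤ω c2 = s≤s (s≤s z≤n)

    4≤ω+ω : ∀ d d′ → 4 ≤ ω d ℕ.+ ω d′
    4≤ω+ω d d′ = ℕ.+-mono-≤ (2≤ω d) (2≤ω d′)

    ω-minimal : ∀ d d′ → ω d ≤ ω d′ → d ≢ d′ → d ≢ c0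
    ω-minimal c0 c0 _ ne _ = ne refl
    ω-minimal c0 c1 (s≤s (s≤s ()))
    ω-minimal c0 c2 (s≤s (s≤s ()))
    ω-minimal c1 _  _ _  ()
    ω-minimal c2 _  _ _  ()

  -- A form for the colour `c1` or `c2` may keep linear terms at edges of colour `c0`: these edges
  -- are heavier, so such terms do not reach the leading form. Nothing is assumed of the higher
  -- terms.
  record Adapted {m} (col : Fin m → Colour) (d : Colour) (x : Φ m) : Set ℓ where
    constructor adapted
    field
      constant : coef ∅ x F.≈ F.0#
      foreign  : ∀ e → col e ≢ d → col e ≢ c0 → lin e x F.≈ F.0#
  open Adapted

  Adapted-Lead : ∀ {m} {col : Fin m → Colour} {d x y} → Adapted col d x → Adapted col d y →
    (∀ e → col e ≡ d → lin e x F.≈ lin e y) → Lead (ω ∘ col) (ω d) x y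
  Adapted-Lead {col = col} {d} {x} {y} ax ay h = lead
    (Ord-intro (constant ax)
      (λ e lt → foreign ax e (λ eq → ℕ.<⇒≢ lt (cong ω eq))
                  (ω-minimal (col e) d (ℕ.<⇒≤ lt) (λ eq → ℕ.<⇒≢ lt (cong ω eq))))
      (λ e f → ℕ.≤-trans (ω≤3 d) (ℕ.≤-trans (ℕ.n≤1+n 3) (4≤ω+ω (col e) (col f)))))
    agree
    where
    small : ∀ e f → ω (col e) ℕ.+ ω (col f) ≤ ω d → ⊥
    small e f le = ℕ.<⇒≱ (ℕ.≤-trans (s≤s (ω≤3 d)) (4≤ω+ω (col e) (col f))) le
    agree : ∀ A → wt (ω ∘ col) A ≤ ω d → coef A x F.≈ coef A y
    agree A le with sizeView A
    ... | empty        = F.trans (constant ax) (F.sym (constant ay))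
    ... | two e f p _  = ⊥-elim (small e f (subst (_≤ ω d) (p (ω ∘ col)) le))
    ... | more e f g p = ⊥-elim (small e f (ℕ.≤-trans (ℕ.m≤m+n _ _) (ℕ.≤-trans (p (ω ∘ col)) le)))
    ... | one e with col e ≟C d
    ...   | yes eq = h e eq
    ...   | no ne  = F.trans (foreign ax e ne ne₀) (F.sym (foreign ay e ne ne₀))
      where ne₀ = ω-minimal (col e) d (subst (_≤ ω d) (wt-single (ω ∘ col) e) le) ne

  triple-Lead : ∀ {m} {col : Fin m → Colour} {x y : Colour → Φ m} →
    (∀ d → Lead (ω ∘ col) (ω d) (x d) (y d)) → triple x (count col) ≋ triple y (count col)
  triple-Lead {col = col} h = Lead-≋
    (Lead-* (Lead-^ (n c0) (h c0)) (Lead-* (Lead-^ (n c1) (h c1)) (Lead-^ (n c2) (h c2))))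
    (ℕ.≤-reflexive (sumFin-colour ω col))
    where n = count col

  -- The product has full degree for the weights `ω`, so each factor may be replaced by the linear
  -- form carrying only the edges of its own colour; then `pure-top` applies.
  triple-nonzero : CharZero K → ∀ {m} {col : Fin m → Colour} {z : Colour → Φ m} → (∀ d → Adapted col d (z d)) →
    (∀ e → ¬ (lin e (z (col e)) F.≈ F.0#)) → ¬ (triple z (count col) ≋ zeroΦ)
  triple-nonzero char0 {m} {col = col} {z} az nz eq = pure-top char0 col λs nz
    (F.trans (top-cong (≋-trans (≋-sym (triple-Lead lz)) eq)) (top-zero {m}))
    where
    λs = λ e → lin e (z (col e))
    lz : ∀ d → Lead (ω ∘ col) (ω d) (z d) (L (restrict col λs d))
    lz d = Adapted-Lead (az d)
      (adapted (coef-L-∅ (restrict col λs d)) λ e ne _ → F.trans (lin-L (restrict col λs d) e)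
        (F.trans (F.*-congʳ (F.reflexive (cong (natK K) (δ-≢ ne)))) (F.zeroˡ _)))
      λ e eq → F.sym (F.trans (lin-L (restrict col λs d) e) (F.trans
        (F.*-congʳ (F.trans (F.reflexive (cong (natK K) (δ-≡ eq))) (F.+-identityʳ _)))
        (F.trans (F.*-identityˡ _) (F.reflexive (cong (λ d → lin e (z d)) eq)))))

  -- Two edges weigh at most 5 in both weightings exactly if one has colour c1
  -- and the other has colour c2; three edges always weigh at least 6.
  private
    ωa ωb : Colour → ℕ
    ωa c0 = 4
    ωa c1 = 2
    ωa c2 = 3
    ωb c0 = 4
    ωb c1 = 3
    ωb c2 = 2

    2≤ωa : ∀ d → 2 ≤ ωa d
    2≤ωa c0 = s≤s (s≤s z≤n)
    2≤ωa c1 = s≤s (s≤s z≤n)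
    2≤ωa c2 = s≤s (s≤s z≤n)

    2≤ωb : ∀ d → 2 ≤ ωb d
    2≤ωb c0 = s≤s (s≤s z≤n)
    2≤ωb c1 = s≤s (s≤s z≤n)
    2≤ωb c2 = s≤s (s≤s z≤n)

    light-pair : ∀ d d′ → ωa d ℕ.+ ωa d′ ≤ 5 → ωb d ℕ.+ ωb d′ ≤ 5 →
      (d ≡ c1 × d′ ≡ c2) ⊎ (d ≡ c2 × d′ ≡ c1)
    light-pair c1 c2 _ _ = inj₁ (refl , refl)
    light-pair c2 c1 _ _ = inj₂ (refl , refl)
    light-pair c0 d′ p _ = ⊥-elim (ℕ.<⇒≱ (ℕ.+-monoʳ-≤ 4 (2≤ωa d′)) p)
    light-pair c1 c0 p _ = ⊥-elim (ℕ.<⇒≱ (ℕ.≤-refl {6}) p)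
    light-pair c1 c1 _ p = ⊥-elim (ℕ.<⇒≱ (ℕ.≤-refl {6}) p)
    light-pair c2 c0 p _ = ⊥-elim (ℕ.<⇒≱ (ℕ.n≤1+n 6) p)
    light-pair c2 c2 p _ = ⊥-elim (ℕ.<⇒≱ (ℕ.≤-refl {6}) p)

    Ord-ωa : ∀ {m} {col : Fin m → Colour} {d x} → Adapted col d x → Ord (ωa ∘ col) (ωa d) x
    Ord-ωa {col = col} {d} {x} ax = Ord-intro (constant ax)
      (λ e lt → foreign ax e (λ eq → ℕ.<⇒≢ lt (cong ωa eq)) (λ eq → ℕ.<⇒≱ lt (subst (λ d′ → ωa d ≤ ωa d′) (sym eq) (≤4 d))))
      (λ e f → ℕ.≤-trans (≤4 d) (ℕ.+-mono-≤ (2≤ωa (col e)) (2≤ωa (col f))))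
      where
      ≤4 : ∀ d → ωa d ≤ 4
      ≤4 c0 = ℕ.≤-refl
      ≤4 c1 = s≤s (s≤s z≤n)
      ≤4 c2 = s≤s (s≤s (s≤s z≤n))

    Ord-ωb : ∀ {m} {col : Fin m → Colour} {d x} → Adapted col d x → Ord (ωb ∘ col) (ωb d) x
    Ord-ωb {col = col} {d} {x} ax = Ord-intro (constant ax)
      (λ e lt → foreign ax e (λ eq → ℕ.<⇒≢ lt (cong ωb eq)) (λ eq → ℕ.<⇒≱ lt (subst (λ d′ → ωb d ≤ ωb d′) (sym eq) (≤4 d))))
      (λ e f → ℕ.≤-trans (≤4 d) (ℕ.+-mono-≤ (2≤ωb (col e)) (2≤ωb (col f))))
      where
      ≤4 : ∀ d → ωb d ≤ 4
      ≤4 c0 = ℕ.≤-refl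
      ≤4 c1 = s≤s (s≤s (s≤s z≤n))
      ≤4 c2 = s≤s (s≤s z≤n)

  -- One factor short of full degree in the colours c1 and c2, a product only
  -- sees the mixed quadratic terms of the cofactor.
  light : ∀ {m} {col : Fin m → Colour} {z : Colour → Φ m} → (∀ d → Adapted col d (z d)) →
    ∀ {n p q} → count col c0 ≡ n → count col c1 ≡ suc p → count col c2 ≡ suc q → ∀ x y →
    coef ∅ x F.≈ coef ∅ y → (∀ e → lin e x F.≈ lin e y) →
    (∀ A g h → (∀ λs → prod λs A F.≈ λs g F.* λs h) → col g ≡ c1 → col h ≡ c2 → coef A x F.≈ coef A y) →
    (z c0 ^ n * (z c1 ^ p * z c2 ^ q)) * x ≋ (z c0 ^ n * (z c1 ^ p * z c2 ^ q)) * y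
  light {col = col} {z} az {n} {p} {q} n₀ n₁ n₂ x y h₀ h₁ h₂ =
    -- `d = 5` is the weight of the two missing factors, one of colour `c1` and one of colour `c2`:
    -- 2 + 3 in one weighting, 3 + 2 in the other.
    two-weights (ωa ∘ col) (ωb ∘ col) {d = 5}
      (Ord-* (Ord-^ n (Ord-ωa (az c0))) (Ord-* (Ord-^ p (Ord-ωa (az c1))) (Ord-^ q (Ord-ωa (az c2)))))
      (Ord-* (Ord-^ n (Ord-ωb (az c0))) (Ord-* (Ord-^ p (Ord-ωb (az c1))) (Ord-^ q (Ord-ωb (az c2)))))
      (ℕ.≤-reflexive (trans (total ωa) (solve 3 (λ n p q →
        n :* con 4 :+ ((con 2 :+ p :* con 2) :+ (con 3 :+ q :* con 3)) := (n :* con 4 :+ (p :* con 2 :+ q :* con 3)) :+ con 5) refl n p q)))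
      (ℕ.≤-reflexive (trans (total ωb) (solve 3 (λ n p q →
        n :* con 4 :+ ((con 3 :+ p :* con 3) :+ (con 2 :+ q :* con 2)) := (n :* con 4 :+ (p :* con 3 :+ q :* con 2)) :+ con 5) refl n p q)))
      agree
    where
    open +-*-Solver
    total : ∀ ω → sumFin (λ e → ω (col e)) ≡ n ℕ.* ω c0 ℕ.+ (suc p ℕ.* ω c1 ℕ.+ suc q ℕ.* ω c2)
    total ω = trans (sumFin-colour ω col)
      (cong₂ ℕ._+_ (cong (ℕ._* ω c0) n₀) (cong₂ ℕ._+_ (cong (ℕ._* ω c1) n₁) (cong (ℕ._* ω c2) n₂)))
    agree : ∀ A → wt (ωa ∘ col) A ≤ 5 → wt (ωb ∘ col) A ≤ 5 → coef A x F.≈ coef A y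
    agree A la lb with sizeView A
    ... | empty = h₀
    ... | one e = h₁ e
    ... | two e f w pr with light-pair (col e) (col f) (subst (_≤ 5) (w (ωa ∘ col)) la) (subst (_≤ 5) (w (ωb ∘ col)) lb)
    ...   | inj₁ (ce , cf) = h₂ A e f pr ce cf
    ...   | inj₂ (ce , cf) = h₂ A f e (λ λs → F.trans (pr λs) (F.*-comm _ _)) cf ce
    agree A la lb | more e f g w = ⊥-elim (ℕ.<⇒≱ (ℕ.≤-refl {6}) (ℕ.≤-trans
      (ℕ.+-mono-≤ (ℕ.+-mono-≤ (2≤ωa (col e)) (2≤ωa (col f))) (2≤ωa (col g))) (ℕ.≤-trans (w (ωa ∘ col)) la)))

  -- At full degree the last factors of colours `c1` and `c2` count only through their linear terms
  -- at their own colour. This allows trading forms `z b` for factors whose product has computable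
  -- mixed coefficients.
  top-degree-cong : ∀ {m} {col : Fin m → Colour} {z : Colour → Φ m} → (∀ d → Adapted col d (z d)) →
    ∀ {n p q} → count col c0 ≡ n → count col c1 ≡ suc p → count col c2 ≡ suc q →
    ∀ {x₁ x₂ y₁ y₂} → Adapted col c1 x₁ → Adapted col c2 x₂ → Adapted col c1 y₁ → Adapted col c2 y₂ →
    (∀ e → col e ≡ c1 → lin e x₁ F.≈ lin e y₁) → (∀ e → col e ≡ c2 → lin e x₂ F.≈ lin e y₂) →
    (z c0 ^ n * (z c1 ^ p * z c2 ^ q)) * (x₁ * x₂) ≋ (z c0 ^ n * (z c1 ^ p * z c2 ^ q)) * (y₁ * y₂)
  top-degree-cong {col = col} {z} az {n} {p} {q} n₀ n₁ n₂ ax₁ ax₂ ay₁ ay₂ h₁ h₂ = Lead-≋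
    (Lead-* (Lead-* (same c0 n) (Lead-* (same c1 p) (same c2 q)))
            (Lead-* (Adapted-Lead ax₁ ay₁ h₁) (Adapted-Lead ax₂ ay₂ h₂)))
    (ℕ.≤-reflexive (trans (sumFin-colour ω col) (trans
      (cong₂ ℕ._+_ (cong (ℕ._* 3) n₀) (cong₂ ℕ._+_ (cong (ℕ._* 2) n₁) (cong (ℕ._* 2) n₂)))
      (solve 3 (λ n p q → n :* con 3 :+ ((con 2 :+ p :* con 2) :+ (con 2 :+ q :* con 2))
                          := (n :* con 3 :+ (p :* con 2 :+ q :* con 2)) :+ con 4) refl n p q))))
    where
    open +-*-Solver
    same : ∀ d k → Lead (ω ∘ col) (k ℕ.* ω d) (z d ^ k) (z d ^ k)
    same d k = Lead-^ k (Adapted-Lead (az d) (az d) (λ _ _ → F.refl))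

-- The generators, the forms `z b` and the filtration

lo≢hi : ∀ {n} (e : Edge n) → lo e ≢ hi e
lo≢hi e eq = Fin.<⇒≢ (proj₂ e) eq

module GraphAlgebra {c ℓ : Level} (K : Field c ℓ) where
  open Algebra K
  open ΦRing K
  open Coefficients K
  private
    module F = Field K
    module FS = Sum F.+-commutativeMonoid
    module ΦS {m} = Sum (+-commutativeMonoid m)
    module ΦM {m} = CommutativeSemigroupProperties
                      (CommutativeRing.+-commutativeSemigroup (Φ-ring m))
  open F using () renaming (Carrier to 𝕂)

  ∑ : ∀ {n} → (Fin n → 𝕂) → 𝕂
  ∑ = FS.sum

  ∑-zero : ∀ {n} (f : Fin n → 𝕂) → (∀ i → f i F.≈ F.0#) → ∑ f F.≈ F.0#
  ∑-zero {zero}  f h = F.refl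
  ∑-zero {suc n} f h = F.trans (F.+-cong (h zero) (∑-zero (f ∘ suc) (h ∘ suc))) (F.+-identityˡ _)

  ∑-only : ∀ {n} (f : Fin n → 𝕂) u → (∀ i → i ≢ u → f i F.≈ F.0#) → ∑ f F.≈ f u
  ∑-only {suc n} f zero    h = F.trans (F.+-congˡ (∑-zero (f ∘ suc) λ i → h (suc i) λ ())) (F.+-identityʳ _)
  ∑-only {suc n} f (suc u) h = F.trans
    (F.+-cong (h zero λ ()) (∑-only (f ∘ suc) u λ i ne → h (suc i) (ne ∘ Fin.suc-injective)))
    (F.+-identityˡ _)

  ∑-* : ∀ {n} a (f : Fin n → 𝕂) → ∑ (λ i → a F.* f i) F.≈ a F.* ∑ f
  ∑-* {zero}  a f = F.sym (F.zeroʳ a)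
  ∑-* {suc n} a f = F.trans (F.+-congˡ (∑-* a (f ∘ suc))) (F.sym (F.distribˡ _ _ _))

  ind : ∀ {n} → Fin n → Fin n → 𝕂
  ind u i with i ≟ u
  ... | yes _ = F.1#
  ... | no _  = F.0#

  ind-≡ : ∀ {n} (u : Fin n) → ind u u F.≈ F.1#
  ind-≡ u with u ≟ u
  ... | yes _ = F.refl
  ... | no ne = ⊥-elim (ne refl)

  ind-≢ : ∀ {n} {u i : Fin n} → i ≢ u → ind u i F.≈ F.0#
  ind-≢ {u = u} {i} ne with i ≟ u
  ... | yes eq = ⊥-elim (ne eq)
  ... | no _   = F.refl

  ∑-ind : ∀ {n} (b : Fin n → 𝕂) u → ∑ (λ i → b i F.* ind u i) F.≈ b u
  ∑-ind b u = F.trans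
    (∑-only (λ i → b i F.* ind u i) u λ i ne → F.trans (F.*-congˡ (ind-≢ ne)) (F.zeroʳ _))
    (F.trans (F.*-congˡ (ind-≡ u)) (F.*-identityʳ _))

  coeff-lo : ∀ {n} (e : Edge n) → coeff (lo e) e F.≈ F.1#
  coeff-lo e with lo e ≟ lo e
  ... | yes _ = F.refl
  ... | no ne = ⊥-elim (ne refl)

  coeff-hi : ∀ {n} (e : Edge n) → coeff (hi e) e F.≈ F.- F.1#
  coeff-hi e with hi e ≟ lo e | hi e ≟ hi e
  ... | yes eq | _     = ⊥-elim (lo≢hi e (sym eq))
  ... | no _   | yes _ = F.refl
  ... | no _   | no ne = ⊥-elim (ne refl)

  coeff-apart : ∀ {n} {i} {e : Edge n} → ¬ Incident i e → coeff i e F.≈ F.0#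
  coeff-apart {i = i} {e} h with i ≟ lo e | i ≟ hi e
  ... | yes eq | _      = ⊥-elim (h (inj₁ eq))
  ... | no _   | yes eq = ⊥-elim (h (inj₂ eq))
  ... | no _   | no _   = F.refl

  coeff-ind : ∀ {n} i (e : Edge n) → coeff i e F.≈ ind (lo e) i F.+ F.- F.1# F.* ind (hi e) i
  coeff-ind i e with i ≟ lo e | i ≟ hi e
  ... | yes p | yes q = ⊥-elim (lo≢hi e (trans (sym p) q))
  ... | yes _ | no _  = F.sym (F.trans (F.+-congˡ (F.zeroʳ _)) (F.+-identityʳ _))
  ... | no _  | yes _ = F.sym (F.trans (F.+-identityˡ _) (F.*-identityʳ _))
  ... | no _  | no _  = F.sym (F.trans (F.+-identityˡ _) (F.zeroʳ _))

  diff : ∀ {n} → Edge n → (Fin (suc n) → 𝕂) → 𝕂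
  diff e b = b (lo e) F.+ F.- F.1# F.* b (hi e)

  ∑-coeff : ∀ {n} (b : Fin (suc n) → 𝕂) e → ∑ (λ i → b i F.* coeff i e) F.≈ diff e b
  ∑-coeff b e = begin
    ∑ (λ i → b i F.* coeff i e)
      ≈⟨ FS.sum-cong-≋ expand ⟩
    ∑ (λ i → b i F.* ind (lo e) i F.+ F.- F.1# F.* (b i F.* ind (hi e) i))
      ≈⟨ FS.∑-distrib-+ (λ i → b i F.* ind (lo e) i) (λ i → F.- F.1# F.* (b i F.* ind (hi e) i)) ⟩
    ∑ (λ i → b i F.* ind (lo e) i) F.+ ∑ (λ i → F.- F.1# F.* (b i F.* ind (hi e) i))
      ≈⟨ F.+-cong (∑-ind b (lo e)) (F.trans (∑-* _ (λ i → b i F.* ind (hi e) i)) (F.*-congˡ (∑-ind b (hi e)))) ⟩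
    diff e b ∎
    where
    open import Relation.Binary.Reasoning.Setoid F.setoid
    open CommutativeSemigroupProperties F.*-commutativeSemigroup using (x∙yz≈y∙xz)
    expand : ∀ i → b i F.* coeff i e F.≈ b i F.* ind (lo e) i F.+ F.- F.1# F.* (b i F.* ind (hi e) i)
    expand i = F.trans (F.*-congˡ (coeff-ind i e)) (F.trans (F.distribˡ _ _ _) (F.+-congˡ (x∙yz≈y∙xz _ _ _)))

  -- The generators and their spans

  prodΦ-extend : ∀ {m k} (f : Fin k → Φ (suc m)) (g : Fin k → Φ m) → (∀ i → f i ≋ [ g i , zeroΦ ]) →
    prodΦ (List.tabulate f) ≋ [ prodΦ (List.tabulate g) , zeroΦ ]
  prodΦ-extend {k = zero}  f g h = ≋-refl
  prodΦ-extend {k = suc k} f g h = ≋-trans (*-cong (h zero) (prodΦ-extend (f ∘ suc) (g ∘ suc) (h ∘ suc)))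
    (pair-cong ≋-refl (≋-trans (+-cong (*-zeroʳ _) (*-zeroˡ _)) (+-identityˡ _)))

  prodΦ-Exp : ∀ {m} (λs : Fin m → 𝕂) → prodΦ (List.tabulate (λ e → oneΦ + λs e · φ e)) ≋ Exp λs
  prodΦ-Exp {zero}  λs = ≋-refl
  prodΦ-Exp {suc m} λs = ≋-trans
    (*-cong (pair-cong (≋-trans (+-cong ≋-refl (·-zeroʳ _)) (+-identityʳ _)) (+-identityˡ _))
            (≋-trans (prodΦ-extend (λ e → oneΦ + λs (suc e) · φ (suc e)) (λ e → oneΦ + λs (suc e) · φ e)
                        (λ e → pair-cong ≋-refl (≋-trans (+-identityˡ _) (·-zeroʳ _))))
                     (pair-cong (prodΦ-Exp (λs ∘ suc)) ≋-refl)))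
    (pair-cong (*-identityˡ _)
      (≋-trans (+-cong (*-zeroʳ _) (≋-trans (·-*ˡ _ _ _) (·-congˡ (*-identityˡ _)))) (+-identityˡ _)))

  Y-Exp : ∀ {n m} (G : Graph n m) i → Y G i ≋ Exp (λ e → coeff i (G e))
  Y-Exp {m = m} G i =
    subst (λ ys → prodΦ ys ≋ Exp (λ e → coeff i (G e)))
      (sym (List.map-tabulate (λ e → e) (λ e → oneΦ + coeff i (G e) · φ e)))
      (prodΦ-Exp (λ e → coeff i (G e)))

  y : ∀ {n m} → Graph n m → Fin (suc n) → Φ m
  y G i = Y G i + neg oneΦ

  -- Opaque, so that b can be inferred from z G b.
  opaque
    z : ∀ {n m} → Graph n m → (Fin (suc n) → 𝕂) → Φ m
    z G b = ΦS.sum (λ i → b i · y G i)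

  coef-sum : ∀ {m n} A (f : Fin n → Φ m) → coef A (ΦS.sum f) F.≈ ∑ (λ i → coef A (f i))
  coef-sum {n = zero}  A f = coef-zero A
  coef-sum {n = suc n} A f = F.trans (coef-+ A _ _) (F.+-congˡ (coef-sum A (f ∘ suc)))

  module _ {n m} (G : Graph n m) where

    coef-y : ∀ A i → coef A (y G i) F.≈
      prod (λ e → coeff i (G e)) A F.+ F.- F.1# F.* prod (λ _ → F.0#) A
    coef-y A i = F.trans (coef-+ A (Y G i) (neg oneΦ))
      (F.+-cong (F.trans (coef-cong A (Y-Exp G i)) (coef-Exp A (λ e → coeff i (G e))))
                (F.trans (coef-· A _ oneΦ) (F.*-congˡ (coef-one A))))

    opaque
      unfolding z

      coef-z : ∀ A b (f : Fin (suc n) → 𝕂) → (∀ i → coef A (y G i) F.≈ f i) →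
        coef A (z G b) F.≈ ∑ (λ i → b i F.* f i)
      coef-z A b f h = F.trans (coef-sum A (λ i → b i · y G i)) (FS.sum-cong-≋ step)
        where
        step : ∀ i → coef A (b i · y G i) F.≈ b i F.* f i
        step i = F.trans (coef-· A _ (y G i)) (F.*-congˡ (h i))

    z-constant : ∀ b → coef ∅ (z G b) F.≈ F.0#
    z-constant b = F.trans (coef-z ∅ b (λ _ → F.0#) λ i →
      F.trans (coef-y ∅ i) (F.trans (F.+-cong (prod-∅ (λ e → coeff i (G e)))
          (F.trans (F.*-congˡ (prod-∅ (λ (_ : Fin m) → F.0#))) (F.*-identityʳ _))) (F.-‿inverseʳ _)))
      (∑-zero (λ i → b i F.* F.0#) λ i → F.zeroʳ (b i))

    lin-z : ∀ e b → lin e (z G b) F.≈ diff (G e) b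
    lin-z e b = F.trans (coef-z (single e) b (λ i → coeff i (G e)) λ i →
      F.trans (coef-y (single e) i) (F.trans (F.+-cong (prod-single (λ e → coeff i (G e)) e)
          (F.trans (F.*-congˡ (prod-single (λ _ → F.0#) e)) (F.zeroʳ _))) (F.+-identityʳ _)))
      (∑-coeff b (G e))

    -- At a pair of edges the coefficient of `y G i` is the product of the two signs at `i`, so only
    -- common vertices contribute. The pair enters through `h`, the shape in which `SizeView`
    -- delivers it.
    coef-z-pair : ∀ A e f b → (∀ λs → prod λs A F.≈ λs e F.* λs f) →
      coef A (z G b) F.≈ ∑ (λ i → b i F.* (coeff i (G e) F.* coeff i (G f)))
    coef-z-pair A e f b h = coef-z A b (λ i → coeff i (G e) F.* coeff i (G f)) λ i →
      F.trans (coef-y A i) (F.trans (F.+-cong (h (λ x → coeff i (G x)))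
          (F.trans (F.*-congˡ (F.trans (h (λ _ → F.0#)) (F.zeroˡ _))) (F.zeroʳ _))) (F.+-identityʳ _))

    opaque
      unfolding z

      z-combine : ∀ b t b′ → z G (λ i → b i F.+ t F.* b′ i) ≋ z G b + t · z G b′
      z-combine b t b′ = ≋-trans (ΦS.sum-cong-≋ expand)
        (≋-trans (ΦS.∑-distrib-+ (λ i → b i · y G i) (λ i → t · (b′ i · y G i)))
                 (+-cong ≋-refl (scale (λ i → b′ i · y G i))))
        where
        expand : ∀ i → (b i F.+ t F.* b′ i) · y G i ≋ b i · y G i + t · (b′ i · y G i)
        expand i = ≋-trans (·-distribʳ (b i) _ (y G i)) (+-cong ≋-refl (·-assoc t (b′ i) (y G i)))
        scale : ∀ {k} (f : Fin k → Φ m) → ΦS.sum (λ i → t · f i) ≋ t · ΦS.sum f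
        scale {zero}  f = ≋-sym (·-zeroʳ t)
        scale {suc k} f = ≋-trans (+-cong ≋-refl (scale (f ∘ suc))) (≋-sym (·-distribˡ t _ _))

    private
      sum-zero : ∀ {k} (f : Fin k → Φ m) → (∀ i → f i ≋ zeroΦ) → ΦS.sum f ≋ zeroΦ
      sum-zero {zero}  f h = ≋-refl
      sum-zero {suc k} f h = ≋-trans (+-cong (h zero) (sum-zero (f ∘ suc) (h ∘ suc))) (+-identityˡ _)

      sum-only : ∀ {k} (f : Fin k → Φ m) u {x} → (∀ i → i ≢ u → f i ≋ zeroΦ) → f u ≋ x → ΦS.sum f ≋ x
      sum-only f zero    h p = ≋-trans (+-cong p (sum-zero (f ∘ suc) λ i → h (suc i) λ ())) (+-identityʳ _)
      sum-only f (suc u) h p = ≋-trans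
        (+-cong (h zero λ ()) (sum-only (f ∘ suc) u (λ i ne → h (suc i) (ne ∘ Fin.suc-injective)) p))
        (+-identityˡ _)

    opaque
      unfolding z

      z-zero : z G (λ _ → F.0#) ≋ zeroΦ
      z-zero = sum-zero (λ i → F.0# · y G i) λ i → ·-zeroˡ _

      z-ind : ∀ u → z G (ind u) ≋ y G u
      z-ind u = sum-only (λ i → ind u i · y G i) u
        (λ i ne → ≋-trans (·-cong (ind-≢ ne) ≋-refl) (·-zeroˡ _))
        (≋-trans (·-cong (ind-≡ u) ≋-refl) (·-identity _))

    -- Closure properties of the filtration

    term : 𝕂 × List (Fin (suc n)) → Φ m
    term t = proj₁ t · prodΦ (map (Y G) (proj₂ t))

    value : List (𝕂 × List (Fin (suc n))) → Φ m
    value ts = sumΦ (map term ts)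

    value-++ : ∀ ts us → value (ts ++ us) ≋ value ts + value us
    value-++ []       us = ≋-sym (+-identityˡ _)
    value-++ (t ∷ ts) us = ≋-trans (+-cong ≋-refl (value-++ ts us)) (≋-sym (+-assoc _ _ _))

    prodΦ-++ : ∀ xs ys → prodΦ {m} (xs ++ ys) ≋ prodΦ xs * prodΦ ys
    prodΦ-++ []       ys = ≋-sym (*-identityˡ _)
    prodΦ-++ (x ∷ xs) ys = ≋-trans (*-cong ≋-refl (prodΦ-++ xs ys)) (≋-sym (*-assoc _ _ _))

    -- `Filt G` stated with `_≋_`, which keeps the elements visible to unification.
    Span : ℕ → Φ m → Set (c ⊔ ℓ)
    Span k x = Σ (List (𝕂 × List (Fin (suc n)))) λ ts → All (λ t → length (proj₂ t) ≤ k) ts × x ≋ value ts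

    Filt⇒Span : ∀ {k x} → Filt G k x → Span k x
    Filt⇒Span (ts , le , p) = ts , le , ⟪ p ⟫

    Span⇒Filt : ∀ {k x} → Span k x → Filt G k x
    Span⇒Filt (ts , le , p) = ts , le , unwrap p

    Span-cong : ∀ {k x x′} → x ≋ x′ → Span k x → Span k x′
    Span-cong p (ts , le , q) = ts , le , ≋-trans (≋-sym p) q

    Span-+ : ∀ {k x x′} → Span k x → Span k x′ → Span k (x + x′)
    Span-+ (ts , le , p) (us , le′ , q) =
      ts ++ us , All.++⁺ le le′ , (≋-trans (+-cong p q) (≋-sym (value-++ ts us)))

    Span-· : ∀ {k x} a → Span k x → Span k (a · x)
    Span-· {k} {x} a (ts , le , p) = map scale ts , All.map⁺ le , (≋-trans (·-congˡ p) (go ts))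
      where
      scale : 𝕂 × List (Fin (suc n)) → 𝕂 × List (Fin (suc n))
      scale (b , is) = a F.* b , is
      go : ∀ ts → a · value ts ≋ value (map scale ts)
      go []       = ·-zeroʳ a
      go (t ∷ ts) = ≋-trans (·-distribˡ a _ _) (+-cong (≋-sym (·-assoc _ _ _)) (go ts))

    Span-* : ∀ {j k x x′} → Span j x → Span k x′ → Span (j ℕ.+ k) (x * x′)
    Span-* {j} {k} (ts , le , p) (us , le′ , q) =
      times ts , bound ts le , (≋-trans (*-cong p q) (go ts))
      where
      T = 𝕂 × List (Fin (suc n))
      mul : T → T → T
      mul (a , is) (b , js) = a F.* b , is ++ js
      times : List T → List T
      times []       = []
      times (t ∷ ts) = map (mul t) us ++ times ts
      bound : ∀ ts → All (λ t → length (proj₂ t) ≤ j) ts → All (λ t → length (proj₂ t) ≤ j ℕ.+ k) (times ts)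
      bound []       []       = []
      bound (t ∷ ts) (l ∷ ls) = All.++⁺ (All.map⁺ (All.map
        (λ {u} l′ → ℕ.≤-trans (ℕ.≤-reflexive (List.length-++ (proj₂ t))) (ℕ.+-mono-≤ l l′)) le′)) (bound ts ls)
      term-mul : ∀ t u → term t * term u ≋ term (mul t u)
      term-mul (a , is) (b , js) = ≋-trans (·-*ˡ _ _ _) (≋-trans (·-congˡ (·-*ʳ _ _ _))
        (≋-trans (≋-sym (·-assoc _ _ _)) (·-congˡ (≋-sym (subst (λ l → prodΦ l ≋ prodΦ (map (Y G) is) * prodΦ (map (Y G) js))
          (sym (List.map-++ (Y G) is js)) (prodΦ-++ (map (Y G) is) (map (Y G) js)))))))
      row : ∀ t us → term t * value us ≋ value (map (mul t) us)
      row t []       = *-zeroʳ _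
      row t (u ∷ us) = ≋-trans (*-distribˡ _ _ _) (+-cong (term-mul t u) (row t us))
      go : ∀ ts → value ts * value us ≋ value (times ts)
      go []       = *-zeroˡ _
      go (t ∷ ts) = ≋-trans (*-distribʳ _ _ _)
        (≋-trans (+-cong (row t us) (go ts)) (≋-sym (value-++ (map (mul t) us) (times ts))))

    Span-1 : ∀ {k} → Span k oneΦ
    Span-1 = (F.1# , []) ∷ [] , z≤n ∷ [] , (≋-sym (≋-trans (+-identityʳ _) (·-identity _)))

    Span-Y : ∀ i → Span 1 (Y G i)
    Span-Y i = (F.1# , i ∷ []) ∷ [] , s≤s z≤n ∷ [] ,
      (≋-sym (≋-trans (+-identityʳ _) (≋-trans (·-identity _) (*-identityʳ _))))

    opaque
      unfolding z

      Span-z : ∀ b → Span 1 (z G b)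
      Span-z b = go (λ i → b i · y G i) λ i → Span-· (b i) (Span-+ (Span-Y i) (Span-· _ Span-1))
        where
        go : ∀ {k} (f : Fin k → Φ m) → (∀ i → Span 1 (f i)) → Span 1 (ΦS.sum f)
        go {zero}  f h = [] , [] , ≋-refl
        go {suc k} f h = Span-+ (h zero) (go (f ∘ suc) (h ∘ suc))

    Span-1-decompose : ∀ {x} → Span 1 x → ∃[ a ] ∃[ b ] x ≋ a · oneΦ + z G b
    Span-1-decompose {x} (ts , le , p) with go ts le
      where
      go : ∀ ts → All (λ t → length (proj₂ t) ≤ 1) ts → ∃[ a ] ∃[ b ] value ts ≋ a · oneΦ + z G b
      go [] [] = F.0# , (λ _ → F.0#) , ≋-sym (≋-trans (+-cong (·-zeroˡ _) z-zero) (+-identityʳ _))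
      go ((a , []) ∷ ts) (_ ∷ ls) with go ts ls
      ... | a′ , b , p = a F.+ a′ , b , ≋-trans (+-cong ≋-refl p)
        (≋-trans (≋-sym (+-assoc _ _ _)) (+-cong (≋-sym (·-distribʳ _ _ _)) ≋-refl))
      go ((a , i ∷ []) ∷ ts) (_ ∷ ls) with go ts ls
      ... | a′ , b , p = a F.+ a′ , (λ j → b j F.+ a F.* ind i j) ,
        ≋-trans (+-cong (≋-trans (·-congˡ (≋-trans (*-identityʳ _) Y≋1+y)) (·-distribˡ a _ _)) p)
        (≋-trans (ΦM.interchange _ _ _ _)
        (+-cong (≋-sym (·-distribʳ _ _ _))
          (≋-trans (+-comm _ _) (≋-sym (≋-trans (z-combine b a (ind i)) (+-cong ≋-refl (·-congˡ (z-ind i))))))))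
        where
        Y≋1+y : Y G i ≋ oneΦ + y G i
        Y≋1+y = ≋-sym (≋-trans (+-comm _ _) (≋-trans (+-assoc _ _ _)
          (≋-trans (+-cong ≋-refl (≋-trans (+-comm _ _) (+-inverseʳ _))) (+-identityʳ _))))
      go ((a , i ∷ j ∷ is) ∷ ts) (s≤s () ∷ ls)
    ... | a , b , q = a , b , ≋-trans p q

-- Double negation and sums over finite index sets

¬¬-all : ∀ {a k} {P : Fin k → Set a} → (∀ i → ¬ ¬ P i) → ¬ ¬ (∀ i → P i)
¬¬-all {k = zero}  h no-all = no-all λ ()
¬¬-all {k = suc k} h no-all = h zero λ p → ¬¬-all (h ∘ suc) λ ps →
  no-all λ { zero → p ; (suc i) → ps i }

sumFin-cong : ∀ {k} {f g : Fin k → ℕ} → (∀ i → f i ≡ g i) → sumFin f ≡ sumFin g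
sumFin-cong {zero}  h = refl
sumFin-cong {suc k} h = cong₂ ℕ._+_ (h zero) (sumFin-cong (h ∘ suc))

sumFin-zero : ∀ {k} {f : Fin k → ℕ} → (∀ i → f i ≡ 0) → sumFin f ≡ 0
sumFin-zero {zero}  h = refl
sumFin-zero {suc k} h = cong₂ ℕ._+_ (h zero) (sumFin-zero (h ∘ suc))

sumFin-one : ∀ k → sumFin {k} (λ _ → 1) ≡ k
sumFin-one zero    = refl
sumFin-one (suc k) = cong suc (sumFin-one k)

≤sumFin : ∀ {k} (f : Fin k → ℕ) i → f i ≤ sumFin f
≤sumFin f zero    = ℕ.m≤m+n _ _
≤sumFin f (suc i) = ℕ.≤-trans (≤sumFin (f ∘ suc) i) (ℕ.m≤n+m _ (f zero))

sumFin-positive : ∀ {k} (f : Fin k → ℕ) → sumFin f ≢ 0 → ∃[ i ] f i ≢ 0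
sumFin-positive {zero}  f h = ⊥-elim (h refl)
sumFin-positive {suc k} f h with f zero ℕ.≟ 0
... | no ne  = zero , ne
... | yes eq with sumFin-positive (f ∘ suc) (λ p → h (cong₂ ℕ._+_ eq p))
...   | i , ne = suc i , ne

-- Endpoints of edges

data Ends {n} (e : Edge n) (u v : Fin (suc n)) : Set where
  up   : lo e ≡ u → hi e ≡ v → Ends e u v
  down : lo e ≡ v → hi e ≡ u → Ends e u v

record Parallel {n} (e f : Edge n) : Set where
  constructor par
  field
    lo≡ : lo e ≡ lo f
    hi≡ : hi e ≡ hi f

parallel? : ∀ {n} (e f : Edge n) → Dec (Parallel e f)
parallel? e f with lo e ≟ lo f | hi e ≟ hi f
... | yes p | yes q = yes (par p q)
... | no ¬p | _     = no λ { (par p _) → ¬p p }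
... | yes _ | no ¬q = no λ { (par _ q) → ¬q q }

incident? : ∀ {n} v (e : Edge n) → Dec (Incident v e)
incident? v e = (v ≟ lo e) ⊎-dec (v ≟ hi e)

ends? : ∀ {n} (e : Edge n) u v → Dec (Ends e u v)
ends? e u v with (lo e ≟ u) ×-dec (hi e ≟ v) | (lo e ≟ v) ×-dec (hi e ≟ u)
... | yes (p , q) | _           = yes (up p q)
... | no _        | yes (p , q) = yes (down p q)
... | no ¬p       | no ¬q       = no λ { (up p q) → ¬p (p , q) ; (down p q) → ¬q (p , q) }

module _ {n} {e : Edge n} where

  Ends-sym : ∀ {u v} → Ends e u v → Ends e v u
  Ends-sym (up p q) = down p q
  Ends-sym (down p q) = up p q

  Ends-≢ : ∀ {u v} → Ends e u v → u ≢ v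
  Ends-≢ (up refl refl) eq = lo≢hi e eq
  Ends-≢ (down refl refl) eq = lo≢hi e (sym eq)

  Ends-left : ∀ {u v} → Ends e u v → Incident u e
  Ends-left (up p _) = inj₁ (sym p)
  Ends-left (down _ p) = inj₂ (sym p)

  Ends-right : ∀ {u v} → Ends e u v → Incident v e
  Ends-right = Ends-left ∘ Ends-sym

  Ends-only : ∀ {u v i} → Ends e u v → Incident i e → i ≡ u ⊎ i ≡ v
  Ends-only (up refl refl) p = p
  Ends-only (down refl refl) (inj₁ p) = inj₂ p
  Ends-only (down refl refl) (inj₂ p) = inj₁ p

  other : ∀ {u} → Incident u e → ∃[ v ] Ends e u v
  other (inj₁ refl) = hi e , up refl refl
  other (inj₂ refl) = lo e , down refl refl

  Ends-intro : ∀ {u v} → u ≢ v → Incident u e → Incident v e → Ends e u v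
  Ends-intro ne (inj₁ refl) (inj₁ refl) = ⊥-elim (ne refl)
  Ends-intro ne (inj₁ refl) (inj₂ refl) = up refl refl
  Ends-intro ne (inj₂ refl) (inj₁ refl) = down refl refl
  Ends-intro ne (inj₂ refl) (inj₂ refl) = ⊥-elim (ne refl)

  Parallel-Ends : ∀ {f u v} → Parallel e f → Ends f u v → Ends e u v
  Parallel-Ends (par refl refl) (up p q) = up p q
  Parallel-Ends (par refl refl) (down p q) = down p q

  -- The convention lo < hi fixes the orientation of an edge, so the two mixed cases are
  -- contradictory.
  Ends-Parallel : ∀ {f u v} → Ends e u v → Ends f u v → Parallel e f
  Ends-Parallel (up refl refl) (up p q) = par (sym p) (sym q)
  Ends-Parallel {f} (up refl refl) (down p q) =
    ⊥-elim (Fin.<-asym (proj₂ e) (subst (Fin._< lo e) p (subst (lo f Fin.<_) q (proj₂ f))))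
  Ends-Parallel {f} (down refl refl) (up p q) =
    ⊥-elim (Fin.<-asym (proj₂ e) (subst (Fin._< lo e) p (subst (lo f Fin.<_) q (proj₂ f))))
  Ends-Parallel (down refl refl) (down p q) = par (sym p) (sym q)

  Parallel-sym : ∀ {f} → Parallel e f → Parallel f e
  Parallel-sym (par p q) = par (sym p) (sym q)

  Parallel-trans : ∀ {f g : Edge n} → Parallel e f → Parallel f g → Parallel e g
  Parallel-trans (par p q) (par r s) = par (trans p r) (trans q s)

  Parallel-Incident : ∀ {f i} → Parallel e f → Incident i f → Incident i e
  Parallel-Incident (par refl refl) p = p

joins-Ends : ∀ {n} {e : Edge n} {u v} → Ends e u v → joins e u v ≡ 1
joins-Ends {e = e} {u} {v} h with lo e ≟ u | hi e ≟ v | lo e ≟ v | hi e ≟ u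
... | yes _ | yes _ | _     | _     = refl
... | yes _ | no _  | yes _ | yes _ = refl
... | no _  | _     | yes _ | yes _ = refl
joins-Ends (up p q) | no a  | _    | no _  | _    = ⊥-elim (a p)
joins-Ends (up p q) | no a  | _    | yes _ | no _ = ⊥-elim (a p)
joins-Ends (up p q) | yes _ | no b | no _  | _    = ⊥-elim (b q)
joins-Ends (up p q) | yes _ | no b | yes _ | no _ = ⊥-elim (b q)
joins-Ends (down p q) | no _  | _    | no a  | _    = ⊥-elim (a p)
joins-Ends (down p q) | no _  | _    | yes _ | no b = ⊥-elim (b q)
joins-Ends (down p q) | yes _ | no _ | no a  | _    = ⊥-elim (a p)
joins-Ends (down p q) | yes _ | no _ | yes _ | no b = ⊥-elim (b q)

joins-¬Ends : ∀ {n} {e : Edge n} {u v} → ¬ Ends e u v → joins e u v ≡ 0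
joins-¬Ends {e = e} {u} {v} h with lo e ≟ u | hi e ≟ v | lo e ≟ v | hi e ≟ u
... | yes p | yes q | _     | _     = ⊥-elim (h (up p q))
... | yes _ | no _  | yes p | yes q = ⊥-elim (h (down p q))
... | no _  | _     | yes p | yes q = ⊥-elim (h (down p q))
... | yes _ | no _  | yes _ | no _  = refl
... | yes _ | no _  | no _  | _     = refl
... | no _  | _     | yes _ | no _  = refl
... | no _  | _     | no _  | _     = refl

joins-≢0 : ∀ {n} {e : Edge n} {u v} → joins e u v ≢ 0 → Ends e u v
joins-≢0 {e = e} {u} {v} h with ends? e u v
... | yes p = p
... | no ¬p = ⊥-elim (h (joins-¬Ends ¬p))

-- Edge colourings by parallel classes

colour₁ : ∀ {n} → Edge n → Edge n → Colour
colour₁ e x with parallel? x e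
... | yes _ = c1
... | no _  = c0

colour₂ : ∀ {n} → Edge n → Edge n → Edge n → Colour
colour₂ e f x with parallel? x e | parallel? x f
... | yes _ | _     = c1
... | no _  | yes _ = c2
... | no _  | no _  = c0

colour₁-c1 : ∀ {n} {e x : Edge n} → colour₁ e x ≡ c1 → Parallel x e
colour₁-c1 {e = e} {x} h with parallel? x e
... | yes p = p

colour₁-c2 : ∀ {n} {e x : Edge n} → colour₁ e x ≢ c2
colour₁-c2 {e = e} {x} h with parallel? x e
colour₁-c2 () | yes p
colour₁-c2 () | no p

colour₁-c0 : ∀ {n} {e x : Edge n} → colour₁ e x ≡ c0 → ¬ Parallel x e
colour₁-c0 {e = e} {x} h with parallel? x e
... | no ¬p = ¬p

colour₂-c1 : ∀ {n} {e f x : Edge n} → colour₂ e f x ≡ c1 → Parallel x e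
colour₂-c1 {e = e} {f} {x} h with parallel? x e | parallel? x f
... | yes p | _     = p
colour₂-c1 () | no _ | yes _
colour₂-c1 () | no _ | no _

colour₂-c2 : ∀ {n} {e f x : Edge n} → colour₂ e f x ≡ c2 → Parallel x f
colour₂-c2 {e = e} {f} {x} h with parallel? x e | parallel? x f
... | no _ | yes p = p

colour₂-c0 : ∀ {n} {e f x : Edge n} → colour₂ e f x ≡ c0 → ¬ Parallel x e × ¬ Parallel x f
colour₂-c0 {e = e} {f} {x} h with parallel? x e | parallel? x f
... | no p | no q = p , q

size : ∀ {n m} → Graph n m → Fin m → ℕ
size G e = mult G (lo (G e)) (hi (G e))

self : ∀ {n} (e : Edge n) → Ends e (lo e) (hi e)
self e = up refl refl

joins-parallel : ∀ {n} (x e : Edge n) → Parallel x e → joins x (lo e) (hi e) ≡ 1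
joins-parallel x e p = joins-Ends (Parallel-Ends p (self e))

joins-¬parallel : ∀ {n} (x e : Edge n) → ¬ Parallel x e → joins x (lo e) (hi e) ≡ 0
joins-¬parallel x e ¬p = joins-¬Ends (λ p → ¬p (Ends-Parallel p (self e)))

size-positive : ∀ {n m} (G : Graph n m) e → 1 ≤ size G e
size-positive G e = ℕ.≤-trans (ℕ.≤-reflexive (sym (joins-Ends (self (G e))))) (≤sumFin _ e)

count₁-c1 : ∀ {n m} (G : Graph n m) e → count (colour₁ (G e) ∘ G) c1 ≡ size G e
count₁-c1 G e = sumFin-cong λ x → go x
  where
  go : ∀ x → δ (colour₁ (G e) (G x)) c1 ≡ joins (G x) (lo (G e)) (hi (G e))
  go x with parallel? (G x) (G e)
  ... | yes p = sym (joins-parallel (G x) (G e) p)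
  ... | no ¬p = sym (joins-¬parallel (G x) (G e) ¬p)

count₂-c1 : ∀ {n m} (G : Graph n m) e f → count (colour₂ (G e) (G f) ∘ G) c1 ≡ size G e
count₂-c1 G e f = sumFin-cong λ x → go x
  where
  go : ∀ x → δ (colour₂ (G e) (G f) (G x)) c1 ≡ joins (G x) (lo (G e)) (hi (G e))
  go x with parallel? (G x) (G e) | parallel? (G x) (G f)
  ... | yes p | _     = sym (joins-parallel (G x) (G e) p)
  ... | no ¬p | yes _ = sym (joins-¬parallel (G x) (G e) ¬p)
  ... | no ¬p | no _  = sym (joins-¬parallel (G x) (G e) ¬p)

count₂-c2 : ∀ {n m} (G : Graph n m) e f → ¬ Parallel (G e) (G f) →
  count (colour₂ (G e) (G f) ∘ G) c2 ≡ size G f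
count₂-c2 G e f ne = sumFin-cong λ x → go x
  where
  go : ∀ x → δ (colour₂ (G e) (G f) (G x)) c2 ≡ joins (G x) (lo (G f)) (hi (G f))
  go x with parallel? (G x) (G e) | parallel? (G x) (G f)
  ... | yes p | yes q = ⊥-elim (ne (Parallel-trans (Parallel-sym p) q))
  ... | yes _ | no ¬q = sym (joins-¬parallel (G x) (G f) ¬q)
  ... | no _  | yes q = sym (joins-parallel (G x) (G f) q)
  ... | no _  | no ¬q = sym (joins-¬parallel (G x) (G f) ¬q)

count-total : ∀ {m} (col : Fin m → Colour) → count col c0 ℕ.+ (count col c1 ℕ.+ count col c2) ≡ m
count-total {m} col = trans (sym (cong₂ ℕ._+_ (one c0) (cong₂ ℕ._+_ (one c1) (one c2))))
  (trans (sym (sumFin-colour (λ _ → 1) col)) (sumFin-one m))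
  where
  one : ∀ d → count col d ℕ.* 1 ≡ count col d
  one d = ℕ.*-identityʳ (count col d)

-- Vertex vectors, hyperplanes of edges, and test products

module Recovery {c ℓ : Level} (K : Field c ℓ) (char0 : CharZero K) where
  open Algebra K
  open ΦRing K
  open Coefficients K
  open GraphAlgebra K
  private module F = Field K
  open F using () renaming (Carrier to 𝕂)
  private
    module ΦA {m} = CommutativeSemigroupProperties (CommutativeRing.+-commutativeSemigroup (Φ-ring m))
    module ΦM {m} = CommutativeSemigroupProperties (CommutativeRing.*-commutativeSemigroup (Φ-ring m))
  open ΦA using (x∙yz≈y∙xz)
  open ΦM using (interchange)

  natK-injective : ∀ i j → natK K i F.≈ natK K j → i ≡ j
  natK-injective zero    zero    p = refl
  natK-injective zero    (suc j) p = ⊥-elim (char0 j (F.sym p))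
  natK-injective (suc i) zero    p = ⊥-elim (char0 i p)
  natK-injective (suc i) (suc j) p = cong suc (natK-injective i j
    (GroupProperties.∙-cancelˡ F.+-group F.1# _ _ p))

  natK-+ : ∀ i j → natK K (i ℕ.+ j) F.≈ natK K i F.+ natK K j
  natK-+ zero    j = F.sym (F.+-identityˡ _)
  natK-+ (suc i) j = F.trans (F.+-congˡ (natK-+ i j)) (F.sym (F.+-assoc _ _ _))

  -- The forms b ↦ b (lo e) − b (hi e)

  private
    x-y≈0 : ∀ {x y} → x F.≈ y → x F.+ F.- F.1# F.* y F.≈ F.0#
    x-y≈0 p = F.trans (F.+-cong p (RingProperties.-1*x≈-x F.ring _)) (F.-‿inverseʳ _)

    x-y≈0⁻¹ : ∀ {x y} → x F.+ F.- F.1# F.* y F.≈ F.0# → x F.≈ y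
    x-y≈0⁻¹ p = GroupProperties.x∙y⁻¹≈ε⇒x≈y F.+-group _ _
      (F.trans (F.+-congˡ (F.sym (RingProperties.-1*x≈-x F.ring _))) p)

  module _ {n} {e : Edge n} where

    diff-zero : ∀ {u v} (b : Fin (suc n) → 𝕂) → Ends e u v → b u F.≈ b v → diff e b F.≈ F.0#
    diff-zero b (up refl refl)   p = x-y≈0 p
    diff-zero b (down refl refl) p = x-y≈0 (F.sym p)

    diff-zero⁻¹ : ∀ {u v} (b : Fin (suc n) → 𝕂) → Ends e u v → diff e b F.≈ F.0# → b u F.≈ b v
    diff-zero⁻¹ b (up refl refl)   p = x-y≈0⁻¹ p
    diff-zero⁻¹ b (down refl refl) p = F.sym (x-y≈0⁻¹ p)

    diff-coeff : ∀ {u v} (b : Fin (suc n) → 𝕂) → Ends e u v → b u F.≈ F.1# → b v F.≈ F.0# →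
      diff e b F.≈ coeff u e
    diff-coeff b (up refl refl) p q =
      F.trans (F.+-cong p (F.trans (F.*-congˡ q) (F.zeroʳ _))) (F.trans (F.+-identityʳ _) (F.sym (coeff-lo e)))
    diff-coeff b (down refl refl) p q =
      F.trans (F.+-cong q (F.trans (F.*-congˡ p) (F.*-identityʳ _))) (F.trans (F.+-identityˡ _) (F.sym (coeff-hi e)))

  diff-parallel : ∀ {n} {e f : Edge n} b → Parallel e f → diff f b F.≈ F.0# → diff e b F.≈ F.0#
  diff-parallel {f = f} b p q = diff-zero b (Parallel-Ends p (self f)) (diff-zero⁻¹ b (self f) q)

  diff-combine : ∀ {n} (e : Edge n) b t b′ → diff e (λ i → b i F.+ t F.* b′ i) F.≈ diff e b F.+ t F.* diff e b′
  diff-combine e b t b′ = begin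
    (b (lo e) F.+ t F.* b′ (lo e)) F.+ F.- F.1# F.* (b (hi e) F.+ t F.* b′ (hi e))
      ≈⟨ F.+-congˡ (F.trans (F.distribˡ _ _ _) (F.+-congˡ (M.x∙yz≈y∙xz _ _ _))) ⟩
    (b (lo e) F.+ t F.* b′ (lo e)) F.+ (F.- F.1# F.* b (hi e) F.+ t F.* (F.- F.1# F.* b′ (hi e)))
      ≈⟨ A.interchange _ _ _ _ ⟩
    diff e b F.+ (t F.* b′ (lo e) F.+ t F.* (F.- F.1# F.* b′ (hi e)))
      ≈⟨ F.+-congˡ (F.sym (F.distribˡ _ _ _)) ⟩
    diff e b F.+ t F.* diff e b′ ∎
    where
    open import Relation.Binary.Reasoning.Setoid F.setoid
    module A = CommutativeSemigroupProperties F.+-commutativeSemigroup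
    module M = CommutativeSemigroupProperties F.*-commutativeSemigroup

  -- Zero on `P` and pairwise distinct nonzero values off it, so that this vector kills exactly the
  -- edges with both ends in `P`.
  sep : ∀ {n} {P : Fin n → Set} → (∀ i → Dec (P i)) → Fin n → 𝕂
  sep P? i with P? i
  ... | yes _ = F.0#
  ... | no _  = natK K (suc (toℕ i))

  sep-inside : ∀ {n} {P : Fin n → Set} (P? : ∀ i → Dec (P i)) {i} → P i → sep P? i F.≈ F.0#
  sep-inside P? {i} p with P? i
  ... | yes _ = F.refl
  ... | no ¬p = ⊥-elim (¬p p)

  sep-apart : ∀ {n} {P : Fin n → Set} (P? : ∀ i → Dec (P i)) {i j} → i ≢ j → ¬ (P i × P j) →
    ¬ (sep P? i F.≈ sep P? j)
  sep-apart P? {i} {j} ne h q with P? i | P? j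
  ... | yes p | yes p′ = h (p , p′)
  ... | yes _ | no _   = char0 (toℕ j) (F.sym q)
  ... | no _  | yes _  = char0 (toℕ i) q
  ... | no _  | no _   = ne (Fin.toℕ-injective (ℕ.suc-injective (natK-injective _ _ q)))

  -- The cut vector of `P`: it kills exactly the edges that do not leave `P`.
  co : ∀ {n} {P : Fin n → Set} → (∀ i → Dec (P i)) → Fin n → 𝕂
  co P? i with P? i
  ... | yes _ = F.0#
  ... | no _  = F.1#

  co-inside : ∀ {n} {P : Fin n → Set} (P? : ∀ i → Dec (P i)) {i} → P i → co P? i F.≈ F.0#
  co-inside P? {i} p with P? i
  ... | yes _ = F.refl
  ... | no ¬p = ⊥-elim (¬p p)

  co-outside : ∀ {n} {P : Fin n → Set} (P? : ∀ i → Dec (P i)) {i} → ¬ P i → co P? i F.≈ F.1#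
  co-outside P? {i} ¬p with P? i
  ... | yes p = ⊥-elim (¬p p)
  ... | no _  = F.refl

  co-separates : ∀ {n} {P : Fin (suc n) → Set} (P? : ∀ i → Dec (P i)) {e : Edge n} {v w} →
    Ends e v w → P v → ¬ P w → ¬ (diff e (co P?) F.≈ F.0#)
  co-separates P? ends p ¬q eq = F.1≉0 (F.trans (F.sym (co-outside P? ¬q))
    (F.trans (F.sym (diff-zero⁻¹ (co P?) ends eq)) (co-inside P? p)))

  co-kills-inside : ∀ {n} {P : Fin (suc n) → Set} (P? : ∀ i → Dec (P i)) {e : Edge n} {v w} →
    Ends e v w → P v → P w → diff e (co P?) F.≈ F.0#
  co-kills-inside P? ends p q = diff-zero (co P?) ends (F.trans (co-inside P? p) (F.sym (co-inside P? q)))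

  co-kills-outside : ∀ {n} {P : Fin (suc n) → Set} (P? : ∀ i → Dec (P i)) {e : Edge n} →
    (∀ i → Incident i e → ¬ P i) → diff e (co P?) F.≈ F.0#
  co-kills-outside P? {e} h = diff-zero (co P?) (self e)
    (F.trans (co-outside P? (h _ (inj₁ refl))) (F.sym (co-outside P? (h _ (inj₂ refl)))))

  outside : ∀ {n} {e f : Edge n} → ¬ Parallel f e → ∃[ v ] Incident v f × ¬ Incident v e
  outside {e = e} {f} h with incident? (lo f) e | incident? (hi f) e
  ... | no ¬p | _     = lo f , inj₁ refl , ¬p
  ... | yes _ | no ¬p = hi f , inj₂ refl , ¬p
  ... | yes p | yes q = ⊥-elim (h (Ends-Parallel (self f) (Ends-intro {e = e} (lo≢hi f) p q)))

  -- If `f` has an end `v` off `e`, the cut vector around `v` kills `e` but not `f`. Only finitely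
  -- many vertices are compared, so parallelism is decidable and the double negation in the
  -- hypothesis does no harm.
  parallel-from-kernel : ∀ {n} {e f : Edge n} → (∀ b → diff e b F.≈ F.0# → ¬ ¬ (diff f b F.≈ F.0#)) → Parallel f e
  parallel-from-kernel {e = e} {f} h = decidable-stable (parallel? f e) λ ne →
    let v , p , ¬q = outside ne
        w , ends = other {e = f} p
    in h (co (_≟ v)) (co-kills-outside (_≟ v) {e} λ { i q refl → ¬q q }) (co-separates (_≟ v) ends refl (Ends-≢ ends ∘ sym))

  -- Avoiding finitely many hyperplanes

  avoid : ∀ {k} (α β : Fin k → 𝕂) → (∀ i → ¬ (α i F.≈ F.0# × β i F.≈ F.0#)) →
    ¬ ¬ (∃[ t ] ∀ i → ¬ (α i F.+ natK K t F.* β i F.≈ F.0#))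
  avoid α β h stop = ¬¬-all eventually λ N → stop (sumFin (proj₁ ∘ N) , λ i →
    proj₂ (N i) _ (≤sumFin (proj₁ ∘ N) i))
    where
    eventually : ∀ i → ¬ ¬ (∃[ N ] ∀ t → N ≤ t → ¬ (α i F.+ natK K t F.* β i F.≈ F.0#))
    -- An affine function of t with coefficients not both zero has at most one root. The bound 0 is
    -- claimed; if a root `t` is exhibited against it, the bound is raised to `suc t`, beyond which
    -- there cannot be a second root.
    eventually i k = k (0 , λ t _ bad → k (suc t , λ t′ le bad′ → twice t t′ le bad bad′))
      where
      twice : ∀ t t′ → t < t′ → α i F.+ natK K t F.* β i F.≈ F.0# → α i F.+ natK K t′ F.* β i F.≈ F.0# → ⊥
      twice t t′ lt bad bad′ with ℕ.m≤n⇒∃[o]m+o≡n lt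
      ... | d , refl = *-nonzero (char0 d)
        (λ β≈0 → h i (F.trans (F.sym (F.+-identityʳ _)) (F.trans (F.+-congˡ (F.sym (F.trans (F.*-congˡ β≈0) (F.zeroʳ _)))) bad) , β≈0))
        (F.trans (F.sym (F.+-identityˡ _)) (F.trans (F.+-congʳ (F.sym bad)) (F.trans (F.+-assoc _ _ _)
          (F.trans (F.+-congˡ (F.trans (F.sym (F.distribʳ _ _ _)) (F.*-congʳ (F.sym split)))) bad′))))
        where
        split : natK K (suc t ℕ.+ d) F.≈ natK K t F.+ natK K (suc d)
        split = F.trans (F.reflexive (cong (natK K) (sym (ℕ.+-suc t d)))) (natK-+ t (suc d))

  -- A space is not covered by finitely many proper hyperplanes: a witness for the new function is
  -- added to the point already found, with a scalar avoiding all bad values. Only `combine` is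
  -- required of `M`, because it will be applied to pairs of related vectors bundled with proofs.
  generic : ∀ {a k} {M : Set a} (combine : M → 𝕂 → M → M) (f : Fin k → M → 𝕂) →
    (∀ i x t y → f i (combine x t y) F.≈ f i x F.+ t F.* f i y) → M →
    (∀ i → ∃[ x ] ¬ (f i x F.≈ F.0#)) → ¬ ¬ (∃[ x ] ∀ i → ¬ (f i x F.≈ F.0#))
  generic {k = zero}  combine f linear x₀ h stop = stop (x₀ , λ ())
  generic {k = suc k} combine f linear x₀ h stop =
    generic combine (f ∘ suc) (linear ∘ suc) x₀ (h ∘ suc) λ (x , good) →
    let x′ , new = h zero in
    avoid (λ i → f i x) (λ i → f i x′) (λ { zero (_ , p) → new p ; (suc i) (p , _) → good i p }) λ (t , far) →
    stop (combine x (natK K t) x′ , λ i p → far i (F.trans (F.sym (linear i x _ x′)) p))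

  -- What an isomorphism of filtered algebras gives: a multiplicative linear
  -- relation that matches the elements z b of both algebras.
  record Correspondence {n₁ m₁ n₂ m₂} (G₁ : Graph n₁ m₁) (G₂ : Graph n₂ m₂) : Set (Level.suc (c ⊔ ℓ)) where
    field
      R        : Φ m₁ → Φ m₂ → Set (c ⊔ ℓ)
      R-one    : R oneΦ oneΦ
      R-*      : ∀ {x x′ y y′} → R x y → R x′ y′ → R (x * x′) (y * y′)
      R-z      : ∀ {b b′ d d′} t → R (z G₁ b) (z G₂ b′) → R (z G₁ d) (z G₂ d′) →
                 R (z G₁ (λ i → b i F.+ t F.* d i)) (z G₂ (λ i → b′ i F.+ t F.* d′ i))
      R-zero   : ∀ {x y} → R x y → x ≋ zeroΦ → y ≋ zeroΦ
      R-zero⁻¹ : ∀ {x y} → R x y → y ≋ zeroΦ → x ≋ zeroΦ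
      total    : ∀ b → ¬ ¬ (∃[ b′ ] R (z G₁ b) (z G₂ b′))
      total⁻¹  : ∀ b′ → ¬ ¬ (∃[ b ] R (z G₁ b) (z G₂ b′))

    R-^ : ∀ {x y} k → R x y → R (x ^ k) (y ^ k)
    R-^ zero    r = R-one
    R-^ (suc k) r = R-* r (R-^ k r)

    R-triple : ∀ {x y} n → (∀ d → R (x d) (y d)) → R (triple x n) (triple y n)
    R-triple n r = R-* (R-^ (n c0) (r c0)) (R-* (R-^ (n c1) (r c1)) (R-^ (n c2) (r c2)))

  converse : ∀ {n₁ m₁ n₂ m₂} {G₁ : Graph n₁ m₁} {G₂ : Graph n₂ m₂} → Correspondence G₁ G₂ → Correspondence G₂ G₁
  converse C = record
    { R = flip R ; R-one = R-one ; R-* = R-* ; R-z = R-z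
    ; R-zero = R-zero⁻¹ ; R-zero⁻¹ = R-zero ; total = total⁻¹ ; total⁻¹ = total }
    where open Correspondence C

  z-adapted : ∀ {n m} (G : Graph n m) {col d} b →
    (∀ e → col e ≢ d → col e ≢ c0 → diff (G e) b F.≈ F.0#) → Adapted col d (z G b)
  z-adapted G b h = adapted (z-constant G b) λ e p q → F.trans (lin-z G e b) (h e p q)

  -- With all edges of colour `c0` the triple amounts to the `m`-th power of `z G b`.
  nowhere-zero : ∀ {n m} (G : Graph n m) b → (∀ e → ¬ (diff (G e) b F.≈ F.0#)) →
    ¬ (triple (λ _ → z G b) (count {m} (λ _ → c0)) ≋ zeroΦ)
  nowhere-zero G b h = triple-nonzero char0 {col = λ _ → c0}
    (λ d → z-adapted G b λ e _ q → ⊥-elim (q refl)) λ e p → h e (F.trans (F.sym (lin-z G e b)) p)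

  -- `sep` of the empty set is injective on the vertices.
  everywhere : ∀ {n m} (G : Graph n m) → ∃[ b ] ∀ e → ¬ (diff (G e) b F.≈ F.0#)
  everywhere G = sep (λ _ → no (λ (x : ⊥) → x)) , λ e p →
    sep-apart (λ _ → no (λ (x : ⊥) → x)) (lo≢hi (G e)) proj₁ (diff-zero⁻¹ (sep (λ _ → no (λ (x : ⊥) → x))) (self (G e)) p)

  count-const-c0 : ∀ m → count {m} (λ _ → c0) c0 ≡ m
  count-const-c0 m = sumFin-one m

  count-const : ∀ m d → d ≢ c0 → count {m} (λ _ → c0) d ≡ 0
  count-const m d ne = sumFin-zero {m} λ _ → δ-≢ (ne ∘ sym)

  -- Weigh the class of `e` by 1 and every other edge by 2, which gives total weight 2m - size. A
  -- form killing `e` has order 2, since even two edges of the class weigh 1 + 1; an arbitrary form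
  -- has order 1. The product vanishes as soon as 2i + j + 2k exceeds the total.
  class-vanish : ∀ {n m} (G : Graph n m) e b b₁ → diff (G e) b F.≈ F.0# → ∀ i j k →
    m ℕ.+ m < (i ℕ.+ i ℕ.+ (j ℕ.+ (k ℕ.+ k))) ℕ.+ size G e →
    z G b ^ i * (z G b₁ ^ j * z G b ^ k) ≋ zeroΦ
  class-vanish {m = m} G e b b₁ p i j k lt = Ord-vanish
    (Ord-* (Ord-^ i ord) (Ord-* (Ord-^ j ord₁) (Ord-^ k ord)))
    (ℕ.+-cancelʳ-< (size G e) _ _ (ℕ.≤-trans (ℕ.≤-reflexive (cong suc total)) (ℕ.≤-trans lt (ℕ.≤-reflexive
      (cong (ℕ._+ size G e) (solve 3 (λ i j k → i :+ i :+ (j :+ (k :+ k)) := i :* con 2 :+ (j :* con 1 :+ k :* con 2)) refl i j k))))))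
    where
    open +-*-Solver
    col = colour₁ (G e) ∘ G
    ω : Colour → ℕ
    ω c0 = 2
    ω c1 = 1
    ω c2 = 2
    1≤ω : ∀ d → 1 ≤ ω d
    1≤ω c0 = s≤s z≤n
    1≤ω c1 = s≤s z≤n
    1≤ω c2 = s≤s z≤n
    ω<2 : ∀ d → ω d < 2 → d ≡ c1
    ω<2 c0 (s≤s (s≤s ()))
    ω<2 c1 _ = refl
    ω<2 c2 (s≤s (s≤s ()))
    ord : Ord (ω ∘ col) 2 (z G b)
    ord = Ord-intro (z-constant G b)
      (λ x lt → F.trans (lin-z G x b) (diff-parallel b (colour₁-c1 (ω<2 (col x) lt)) p))
      (λ x y → ℕ.+-mono-≤ (1≤ω (col x)) (1≤ω (col y)))
    ord₁ : Ord (ω ∘ col) 1 (z G b₁)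
    ord₁ = Ord-intro (z-constant G b₁) (λ x lt → ⊥-elim (ℕ.<⇒≱ lt (1≤ω (col x))))
      (λ x y → ℕ.≤-trans (1≤ω (col x)) (ℕ.m≤m+n _ _))
    total : sumFin (ω ∘ col) ℕ.+ size G e ≡ m ℕ.+ m
    total = trans (cong₂ ℕ._+_ (sumFin-colour ω col) (sym (count₁-c1 G e)))
      (trans (solve 3 (λ n₀ n₁ n₂ → (n₀ :* con 2 :+ (n₁ :* con 1 :+ n₂ :* con 2)) :+ n₁
                                     := (n₀ :+ (n₁ :+ n₂)) :+ (n₀ :+ (n₁ :+ n₂))) refl
                (count col c0) (count col c1) (count col c2))
             (cong₂ ℕ._+_ (count-total col) (count-total col)))

  -- Nilpotency degrees compare the edge numbers: the `m₁`-th power of a form nonzero at all edges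
  -- of `G₁` survives, while for m₂ < m₁ every `m₁`-th power of a form of `G₂` vanishes.
  edges-≤ : ∀ {n₁ m₁ n₂ m₂} {G₁ : Graph n₁ m₁} {G₂ : Graph n₂ m₂} → Correspondence G₁ G₂ → m₁ ≤ m₂
  edges-≤ {m₁ = m₁} {m₂ = m₂} {G₁} {G₂} C = decidable-stable (m₁ ℕ.≤? m₂) λ m₁≰m₂ →
    let b , nz = everywhere G₁ in
    total b λ (b′ , r) →
    nowhere-zero G₁ b nz (R-zero⁻¹ (R-triple n (λ _ → r))
      (Ord-vanish {w = λ _ → 1} (Ord-* (Ord-^ (n c0) (ord b′)) (Ord-* (Ord-^ (n c1) (ord b′)) (Ord-^ (n c2) (ord b′))))
        (ℕ.≤-trans (s≤s (ℕ.≤-reflexive (sumFin-one m₂))) (ℕ.≤-trans (ℕ.≰⇒> m₁≰m₂)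
          (ℕ.≤-reflexive (trans (sym (sumFin-one m₁)) (sumFin-colour (λ _ → 1) (λ (_ : Fin m₁) → c0))))))))
    where
    open Correspondence C
    n = count {m₁} (λ _ → c0)
    ord : ∀ b′ → Ord (λ _ → 1) 1 (z G₂ b′)
    ord b′ = Ord-intro (z-constant G₂ b′) (λ { e (s≤s ()) }) (λ _ _ → s≤s z≤n)

  -- Adjacency of edges

  Shared : ∀ {n} → Edge n → Edge n → Set
  Shared e f = ∃[ u ] Incident u e × Incident u f

  shared? : ∀ {n} (e f : Edge n) → Dec (Shared e f)
  shared? e f = Fin.any? λ u → incident? u e ×-dec incident? u f

  module _ {n m} (G : Graph n m) where

    -- Used with exponents one short of full degree in each of `c1` and `c2`, which leaves room for
    -- exactly one mixed pair of edges in the cofactor.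
    block : (Colour → Fin (suc n) → 𝕂) → ℕ → ℕ → ℕ → Φ m
    block bs k p q = z G (bs c0) ^ k * (z G (bs c1) ^ p * z G (bs c2) ^ q)

    block-adapted : ∀ {g h} (bs : Colour → Fin (suc n) → 𝕂) → diff (G g) (bs c0) F.≈ F.0# → diff (G h) (bs c0) F.≈ F.0# →
      diff (G h) (bs c1) F.≈ F.0# → diff (G g) (bs c2) F.≈ F.0# →
      ∀ d → Adapted (colour₂ (G g) (G h) ∘ G) d (z G (bs d))
    block-adapted {g} {h} bs g0 h0 h1 g2 d = z-adapted G (bs d) (foreign d)
      where
      col = colour₂ (G g) (G h) ∘ G
      foreign : ∀ d e → col e ≢ d → col e ≢ c0 → diff (G e) (bs d) F.≈ F.0#
      foreign d e p q with col e in eq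
      foreign d  e p q | c0 = ⊥-elim (q refl)
      foreign c0 e p q | c1 = diff-parallel (bs c0) (colour₂-c1 {f = G h} eq) g0
      foreign c1 e p q | c1 = ⊥-elim (p refl)
      foreign c2 e p q | c1 = diff-parallel (bs c2) (colour₂-c1 {f = G h} eq) g2
      foreign c0 e p q | c2 = diff-parallel (bs c0) (colour₂-c2 {e = G g} eq) h0
      foreign c1 e p q | c2 = diff-parallel (bs c1) (colour₂-c2 {e = G g} eq) h1
      foreign c2 e p q | c2 = ⊥-elim (p refl)

    -- By `light` only the coefficients of `z G b` at pairs from the two classes matter, and these
    -- are sums over common vertices, of which there are none. The vector `b` is merely constant
    -- along edges, since this is all that will be known of the image of the constant vector 1.
    block-vanish : ∀ {g h} → ¬ Shared (G g) (G h) → ∀ bs b →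
      diff (G g) (bs c0) F.≈ F.0# → diff (G h) (bs c0) F.≈ F.0# →
      diff (G h) (bs c1) F.≈ F.0# → diff (G g) (bs c2) F.≈ F.0# → (∀ y → diff (G y) b F.≈ F.0#) →
      ∀ {k p q} → let col = colour₂ (G g) (G h) ∘ G in
      count col c0 ≡ k → count col c1 ≡ suc p → count col c2 ≡ suc q →
      block bs k p q * z G b ≋ zeroΦ
    block-vanish {g} {h} ns bs b g0 h0 h1 g2 all n₀ n₁ n₂ = ≋-trans
      (light (block-adapted bs g0 h0 h1 g2) n₀ n₁ n₂ (z G b) zeroΦ
        (F.trans (z-constant G b) (F.sym (coef-zero (∅ {m}))))
        (λ e → F.trans (lin-z G e b) (F.trans (all e) (F.sym (coef-zero (single e)))))
        (λ A x y pr cx cy → F.trans (coef-z-pair G A x y b pr)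
          (F.trans (∑-zero (λ i → b i F.* (coeff i (G x) F.* coeff i (G y))) λ i → F.trans (F.*-congˡ (apart i x y cx cy)) (F.zeroʳ _))
                   (F.sym (coef-zero A)))))
      (*-zeroʳ _)
      where
      col = colour₂ (G g) (G h) ∘ G
      apart : ∀ i x y → col x ≡ c1 → col y ≡ c2 → coeff i (G x) F.* coeff i (G y) F.≈ F.0#
      apart i x y cx cy with incident? i (G x)
      ... | no ¬p = F.trans (F.*-congʳ (coeff-apart {e = G x} ¬p)) (F.zeroˡ _)
      ... | yes p = F.trans (F.*-congˡ (coeff-apart {e = G y} λ q → ns (i ,
              Parallel-Incident (Parallel-sym (colour₂-c1 {f = G h} cx)) p ,
              Parallel-Incident (Parallel-sym (colour₂-c2 {e = G g} cy)) q))) (F.zeroʳ _)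

    module _ {e f u v w} (eu : Ends (G e) u v) (fu : Ends (G f) u w) (v≢w : v ≢ w)
             (no-third : ∀ x → ¬ Ends (G x) v w) where

      private
        corner? : ∀ i → Dec (i ≡ u ⊎ i ≡ v ⊎ i ≡ w)
        corner? i = (i ≟ u) ⊎-dec ((i ≟ v) ⊎-dec (i ≟ w))

      -- The `c0` vector is constant on the corner u, v, w and kills just the classes of `e` and
      -- `f`; this is where `no-third` is needed. The cuts around `v` and `w` kill the opposite one
      -- of the two edges but not their own.
      witnesses : Colour → Fin (suc n) → 𝕂
      witnesses c0 = sep corner?
      witnesses c1 = co (_≟ v)
      witnesses c2 = co (_≟ w)

      witness-e₀ : diff (G e) (witnesses c0) F.≈ F.0#
      witness-e₀ = diff-zero (witnesses c0) eu (F.trans (sep-inside corner? (inj₁ refl)) (F.sym (sep-inside corner? (inj₂ (inj₁ refl)))))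

      witness-f₀ : diff (G f) (witnesses c0) F.≈ F.0#
      witness-f₀ = diff-zero (witnesses c0) fu (F.trans (sep-inside corner? (inj₁ refl)) (F.sym (sep-inside corner? (inj₂ (inj₂ refl)))))

      witness-f₁ : diff (G f) (witnesses c1) F.≈ F.0#
      witness-f₁ = diff-zero (witnesses c1) fu (F.trans (co-outside (_≟ v) (Ends-≢ eu)) (F.sym (co-outside (_≟ v) (v≢w ∘ sym))))

      witness-e₂ : diff (G e) (witnesses c2) F.≈ F.0#
      witness-e₂ = diff-zero (witnesses c2) eu (F.trans (co-outside (_≟ w) (Ends-≢ fu)) (F.sym (co-outside (_≟ w) v≢w)))

      -- An edge parallel to `e` and one parallel to `f` share only `u`, so the mixed part of the
      -- form of the vector 1 factors as the signs at `u` on one class times those on the other. It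
      -- may thus be replaced by `E c1 * E c2`, and this in turn by the missing two witness factors,
      -- which completes a nonzero full-degree product.
      block-nonvanish : ∀ {k p q} → let col = colour₂ (G e) (G f) ∘ G in
        count col c0 ≡ k → count col c1 ≡ suc p → count col c2 ≡ suc q →
        ¬ (block witnesses k p q * z G (λ _ → F.1#) ≋ zeroΦ)
      block-nonvanish {k} {p} {q} n₀ n₁ n₂ eq = triple-nonzero char0 az nz (≋-trans shape
        (≋-trans (top-degree-cong az n₀ n₁ n₂ (az c1) (az c2) (aE c1) (aE c2) lin-z₁ lin-z₂)
        (≋-trans (≋-sym (light az n₀ n₁ n₂ (z G (λ _ → F.1#)) (E c1 * E c2) const₀ lin₀ mixed)) eq)))
        where
        col = colour₂ (G e) (G f) ∘ G
        zs : Colour → Φ m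
        zs d = z G (witnesses d)
        az : ∀ d → Adapted col d (zs d)
        az = block-adapted witnesses witness-e₀ witness-f₀ witness-f₁ witness-e₂
        side : ∀ x {a b} → Ends (G x) a b → a ≡ u ⊎ a ≡ v ⊎ a ≡ w → b ≡ u ⊎ b ≡ v ⊎ b ≡ w →
          Parallel (G x) (G e) ⊎ Parallel (G x) (G f)
        side x xe (inj₁ refl)        (inj₁ refl)        = ⊥-elim (Ends-≢ xe refl)
        side x xe (inj₁ refl)        (inj₂ (inj₁ refl)) = inj₁ (Ends-Parallel xe eu)
        side x xe (inj₁ refl)        (inj₂ (inj₂ refl)) = inj₂ (Ends-Parallel xe fu)
        side x xe (inj₂ (inj₁ refl)) (inj₁ refl)        = inj₁ (Ends-Parallel (Ends-sym xe) eu)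
        side x xe (inj₂ (inj₁ refl)) (inj₂ (inj₁ refl)) = ⊥-elim (Ends-≢ xe refl)
        side x xe (inj₂ (inj₁ refl)) (inj₂ (inj₂ refl)) = ⊥-elim (no-third x xe)
        side x xe (inj₂ (inj₂ refl)) (inj₁ refl)        = inj₂ (Ends-Parallel (Ends-sym xe) fu)
        side x xe (inj₂ (inj₂ refl)) (inj₂ (inj₁ refl)) = ⊥-elim (no-third x (Ends-sym xe))
        side x xe (inj₂ (inj₂ refl)) (inj₂ (inj₂ refl)) = ⊥-elim (Ends-≢ xe refl)
        ends₁ : ∀ x → col x ≡ c1 → Ends (G x) u v
        ends₁ x cx = Parallel-Ends (colour₂-c1 {f = G f} cx) eu
        ends₂ : ∀ x → col x ≡ c2 → Ends (G x) u w
        ends₂ x cx = Parallel-Ends (colour₂-c2 {e = G e} cx) fu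
        nz′ : ∀ x d → col x ≡ d → ¬ (diff (G x) (witnesses d) F.≈ F.0#)
        nz′ x c0 cx p = let ¬e , ¬f = colour₂-c0 cx in
          sep-apart corner? (lo≢hi (G x)) (λ (a , b) → [ ¬e , ¬f ]′ (side x (self (G x)) a b))
            (diff-zero⁻¹ (witnesses c0) (self (G x)) p)
        nz′ x c1 cx = co-separates (_≟ v) (Ends-sym (ends₁ x cx)) refl (Ends-≢ eu)
        nz′ x c2 cx = co-separates (_≟ w) (Ends-sym (ends₂ x cx)) refl (Ends-≢ fu)
        nz : ∀ x → ¬ (lin x (zs (col x)) F.≈ F.0#)
        nz x p = nz′ x (col x) refl (F.trans (F.sym (lin-z G x (witnesses (col x)))) p)
        λs : Colour → Fin m → 𝕂
        λs d = restrict col (λ x → coeff u (G x)) d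
        λs-own : ∀ {d x} → col x ≡ d → λs d x F.≈ coeff u (G x)
        λs-own cx = F.trans (F.*-congʳ (F.trans (F.reflexive (cong (natK K) (δ-≡ cx))) (F.+-identityʳ _))) (F.*-identityˡ _)
        λs-other : ∀ {d x} → col x ≢ d → λs d x F.≈ F.0#
        λs-other cx = F.trans (F.*-congʳ (F.reflexive (cong (natK K) (δ-≢ cx)))) (F.zeroˡ _)
        -- The part of `y G u` supported on one class. Exponentials are convenient because their
        -- product is again one, by `Exp-*`.
        E : Colour → Φ m
        E d = Exp (λs d) + neg oneΦ
        E-constant : ∀ d → coef ∅ (E d) F.≈ F.0#
        E-constant d = F.trans (coef-+ (∅ {m}) _ _) (x-y≈0′
          (F.trans (coef-Exp ∅ (λs d)) (prod-∅ (λs d)))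
          (F.trans (coef-· (∅ {m}) _ oneΦ) (F.*-congˡ (F.trans (coef-one (∅ {m})) (prod-∅ {m} (λ _ → F.0#))))))
          where
          x-y≈0′ : ∀ {x y} → x F.≈ F.1# → y F.≈ F.- F.1# F.* F.1# → x F.+ y F.≈ F.0#
          x-y≈0′ p q = F.trans (F.+-cong p q) (x-y≈0 F.refl)
        lin-E : ∀ d x → lin x (E d) F.≈ λs d x
        lin-E d x = F.trans (coef-+ (single x) _ _) (F.trans (F.+-cong
          (F.trans (coef-Exp (single x) (λs d)) (prod-single (λs d) x))
          (F.trans (coef-· (single x) _ oneΦ) (F.trans (F.*-congˡ (F.trans (coef-one (single x)) (prod-single (λ _ → F.0#) x))) (F.zeroʳ _))))
          (F.+-identityʳ _))
        aE : ∀ d → Adapted col d (E d)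
        aE d = adapted (E-constant d) λ x ne _ → F.trans (lin-E d x) (λs-other ne)
        lin-z₁ : ∀ x → col x ≡ c1 → lin x (zs c1) F.≈ lin x (E c1)
        lin-z₁ x cx = F.trans (lin-z G x (witnesses c1)) (F.trans
          (diff-coeff (witnesses c1) (ends₁ x cx) (co-outside (_≟ v) (Ends-≢ eu)) (co-inside (_≟ v) refl))
          (F.sym (F.trans (lin-E c1 x) (λs-own cx))))
        lin-z₂ : ∀ x → col x ≡ c2 → lin x (zs c2) F.≈ lin x (E c2)
        lin-z₂ x cx = F.trans (lin-z G x (witnesses c2)) (F.trans
          (diff-coeff (witnesses c2) (ends₂ x cx) (co-outside (_≟ w) (Ends-≢ fu)) (co-inside (_≟ w) refl))
          (F.sym (F.trans (lin-E c2 x) (λs-own cx))))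
        const₀ : coef ∅ (z G (λ _ → F.1#)) F.≈ coef ∅ (E c1 * E c2)
        const₀ = F.trans (z-constant G _) (F.sym (F.trans (coef-∅-* (E c1) (E c2)) (F.trans (F.*-congʳ (E-constant c1)) (F.zeroˡ _))))
        lin₀ : ∀ x → lin x (z G (λ _ → F.1#)) F.≈ lin x (E c1 * E c2)
        lin₀ x = F.trans (lin-z G x (λ _ → F.1#)) (F.trans (diff-zero (λ _ → F.1#) (self (G x)) F.refl)
          (F.sym (Ord-* {w = λ _ → 1} {1} {1} (ord c1) (ord c2) (single x) (s≤s (ℕ.≤-reflexive (wt-single (λ _ → 1) x))))))
          where
          ord : ∀ d → Ord (λ _ → 1) 1 (E d)
          ord d = Ord-intro (E-constant d) (λ { e (s≤s ()) }) (λ _ _ → s≤s z≤n)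
        -- Of these four terms only the first has a coefficient at a mixed pair.
        expand : E c1 * E c2 ≋ Exp (λ x → λs c1 x F.+ λs c2 x) + (neg (Exp (λs c1)) + (neg (Exp (λs c2)) + neg (neg oneΦ)))
        expand = ≋-trans (*-distribˡ _ _ _) (≋-trans (+-cong (*-distribʳ _ _ _) (*-distribʳ _ _ _))
          (≋-trans (+-cong (+-cong (Exp-* (λs c1) (λs c2)) (≋-trans (·-*ˡ _ oneΦ _) (·-congˡ (*-identityˡ _))))
                           (+-cong (≋-trans (·-*ʳ _ _ oneΦ) (·-congˡ (*-identityʳ _))) (≋-trans (·-*ʳ _ _ oneΦ) (·-congˡ (*-identityʳ _)))))
          (≋-trans (+-assoc _ _ _) (+-cong ≋-refl (x∙yz≈y∙xz _ _ _)))))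
        mixed : ∀ A x y → (∀ λs → prod λs A F.≈ λs x F.* λs y) → col x ≡ c1 → col y ≡ c2 →
          coef A (z G (λ _ → F.1#)) F.≈ coef A (E c1 * E c2)
        mixed A x y pr cx cy = F.trans lhs (F.sym rhs)
          where
          a = coeff u (G x) F.* coeff u (G y)
          lhs : coef A (z G (λ _ → F.1#)) F.≈ a
          lhs = F.trans (coef-z-pair G A x y (λ _ → F.1#) pr) (F.trans
            (∑-only (λ i → F.1# F.* (coeff i (G x) F.* coeff i (G y))) u only) (F.*-identityˡ _))
            where
            only : ∀ i → i ≢ u → F.1# F.* (coeff i (G x) F.* coeff i (G y)) F.≈ F.0#
            only i ne with incident? i (G x) | incident? i (G y)
            ... | no ¬p | _     = F.trans (F.*-congˡ (F.trans (F.*-congʳ (coeff-apart {e = G x} ¬p)) (F.zeroˡ _))) (F.zeroʳ _)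
            ... | yes _ | no ¬q = F.trans (F.*-congˡ (F.trans (F.*-congˡ (coeff-apart {e = G y} ¬q)) (F.zeroʳ _))) (F.zeroʳ _)
            ... | yes p | yes q with Ends-only (ends₁ x cx) p | Ends-only (ends₂ y cy) q
            ...   | inj₁ eq   | _         = ⊥-elim (ne eq)
            ...   | inj₂ _    | inj₁ eq   = ⊥-elim (ne eq)
            ...   | inj₂ refl | inj₂ refl = ⊥-elim (v≢w refl)
          x-c2 : col x ≢ c2
          x-c2 p with trans (sym cx) p
          ... | ()
          y-c1 : col y ≢ c1
          y-c1 p with trans (sym cy) p
          ... | ()
          pairs : ∀ μs → μs x F.* μs y F.≈ F.0# → coef A (neg (Exp μs)) F.≈ F.0#
          pairs μs p = F.trans (coef-· A _ _) (F.trans (F.*-congˡ (F.trans (coef-Exp A μs) (F.trans (pr μs) p))) (F.zeroʳ _))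
          rhs : coef A (E c1 * E c2) F.≈ a
          rhs = F.trans (coef-cong A expand) (F.trans (coef-+ A _ _) (F.trans (F.+-cong
            (F.trans (coef-Exp A (λ x → λs c1 x F.+ λs c2 x)) (F.trans (pr (λ x → λs c1 x F.+ λs c2 x)) (F.*-cong
              (F.trans (F.+-cong (λs-own cx) (λs-other x-c2)) (F.+-identityʳ _))
              (F.trans (F.+-cong (λs-other y-c1) (λs-own cy)) (F.+-identityˡ _)))))
            (F.trans (coef-+ A _ _) (F.trans (F.+-cong
              (pairs (λs c1) (F.trans (F.*-congˡ (λs-other y-c1)) (F.zeroʳ _)))
              (F.trans (coef-+ A _ _) (F.trans (F.+-cong
                (pairs (λs c2) (F.trans (F.*-congʳ (λs-other x-c2)) (F.zeroˡ _)))
                (F.trans (coef-· A _ (neg oneΦ)) (F.trans (F.*-congˡ (F.trans (coef-· A _ oneΦ) (F.trans (F.*-congˡ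
                  (F.trans (coef-one A) (F.trans (pr (λ _ → F.0#)) (F.zeroˡ _)))) (F.zeroʳ _)))) (F.zeroʳ _))))
                (F.+-identityˡ _)))) (F.+-identityˡ _))))
            (F.+-identityʳ _)))
        shape : triple zs (count col) ≋ block witnesses k p q * (zs c1 * zs c2)
        shape rewrite n₀ | n₁ | n₂ = ≋-trans (*-cong ≋-refl (≋-trans (interchange _ _ _ _) (*-comm _ _))) (≋-sym (*-assoc _ _ _))

-- Matching the edges of two graphs through a correspondence

Star : ∀ {n} → Edge n → Edge n → Edge n → Set
Star e f x = ∃[ u ] Incident u e × Incident u f × Incident u x

star? : ∀ {n} (e f x : Edge n) → Dec (Star e f x)
star? e f x = Fin.any? λ u → incident? u e ×-dec incident? u f ×-dec incident? u x

module Matching {c ℓ : Level} (K : Field c ℓ) (char0 : CharZero K) where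
  open Algebra K
  open ΦRing K
  open Coefficients K
  open GraphAlgebra K
  open Recovery K char0
  private module F = Field K
  open F using () renaming (Carrier to 𝕂)

  module _ {n m} {G : Graph n m} where

    -- Take an end `v` of `l` off `g`. If `v` is also off `h`, cut around `v`; otherwise cut around
    -- both ends of `h`, which spares `g` by disjointness and separates the ends of `l`.
    disjoint-independent : ∀ {g h l} → ¬ Shared (G g) (G h) → ¬ Parallel (G l) (G g) → ¬ Parallel (G l) (G h) →
      ∃[ b ] diff (G g) b F.≈ F.0# × diff (G h) b F.≈ F.0# × ¬ (diff (G l) b F.≈ F.0#)
    disjoint-independent {g} {h} {l} ns l∦g l∦h with outside {e = G g} l∦g
    ... | v , v∈l , v∉g with incident? v (G h) | other {e = G l} v∈l
    ...   | no v∉h | w , ends = co (_≟ v) , co-kills-outside (_≟ v) {G g} (λ { i q refl → v∉g q }) ,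
                co-kills-outside (_≟ v) {G h} (λ { i q refl → v∉h q }) , co-separates (_≟ v) ends refl (Ends-≢ ends ∘ sym)
    ...   | yes v∈h | w , ends = co H? ,
                co-kills-outside H? {G g} (λ i i∈g i∈h → ns (i , i∈g , i∈h)) ,
                co-kills-inside H? (self (G h)) (inj₁ refl) (inj₂ refl) ,
                co-separates H? ends v∈h (λ w∈h → l∦h (Ends-Parallel ends (Ends-intro {e = G h} (Ends-≢ ends) v∈h w∈h)))
      where
      H? : ∀ i → Dec (Incident i (G h))
      H? i = incident? i (G h)

    -- The far end of `x` lies on neither `e` nor `f`, so the cut around it works.
    star-independent : ∀ {e f x} → Star (G e) (G f) (G x) → ¬ Parallel (G x) (G e) → ¬ Parallel (G x) (G f) →
      ∃[ b ] diff (G e) b F.≈ F.0# × diff (G f) b F.≈ F.0# × ¬ (diff (G x) b F.≈ F.0#)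
    star-independent {e} {f} {x} (u , u∈e , u∈f , u∈x) x∦e x∦f with other {e = G x} u∈x
    ... | w , ends = co (_≟ w) , kills e u∈e x∦e , kills f u∈f x∦f , co-separates (_≟ w) (Ends-sym ends) refl (Ends-≢ ends)
      where
      kills : ∀ g → Incident u (G g) → ¬ Parallel (G x) (G g) → diff (G g) (co (_≟ w)) F.≈ F.0#
      kills g u∈g x∦g = co-kills-outside (_≟ w) {G g} λ { i w∈g refl →
        x∦g (Ends-Parallel ends (Ends-intro {e = G g} (Ends-≢ ends) u∈g w∈g)) }

    -- Pairwise meeting edges without a common vertex form a triangle, and equality along two sides
    -- gives equality along the third.
    triangle-dependent : ∀ {g h y} → Shared (G g) (G h) → Shared (G g) (G y) → Shared (G h) (G y) →
      ¬ Star (G g) (G h) (G y) → ∀ b → diff (G g) b F.≈ F.0# → diff (G h) b F.≈ F.0# → diff (G y) b F.≈ F.0#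
    triangle-dependent {g} {h} {y} (j , j∈g , j∈h) (a , a∈g , a∈y) (d , d∈h , d∈y) ¬star b gb hb =
      diff-zero b ya (F.trans (F.sym (diff-zero⁻¹ b ga gb)) (diff-zero⁻¹ b hd hb))
      where
      ga : Ends (G g) j a
      ga = Ends-intro {e = G g} (λ { refl → ¬star (j , j∈g , j∈h , a∈y) }) j∈g a∈g
      hd : Ends (G h) j d
      hd = Ends-intro {e = G h} (λ { refl → ¬star (j , j∈g , j∈h , d∈y) }) j∈h d∈h
      ya : Ends (G y) a d
      ya = Ends-intro {e = G y} (λ { refl → ¬star (a , a∈g , d∈h , a∈y) }) a∈y d∈y

  module _ {n₁ n₂ m} {G₁ : Graph n₁ m} {G₂ : Graph n₂ m} where

    -- The hyperplane of `e` is carried into that of `g`. The conclusion is doubly negated because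
    -- equality in `K` need not be stable.
    Kills : Correspondence G₁ G₂ → Fin m → Fin m → Set (c ⊔ ℓ)
    Kills C e g = ∀ {b b′} → Correspondence.R C (z G₁ b) (z G₂ b′) →
      diff (G₁ e) b F.≈ F.0# → ¬ ¬ (diff (G₂ g) b′ F.≈ F.0#)

  module _ {n₁ n₂ m} {G₁ : Graph n₁ m} {G₂ : Graph n₂ m} where

    record Matched (C : Correspondence G₁ G₂) (e g : Fin m) : Set (c ⊔ ℓ) where
      constructor matched
      field
        to   : Kills C e g
        from : Kills (converse C) g e

  module _ {n₁ n₂ m} {G₁ : Graph n₁ m} {G₂ : Graph n₂ m} (C : Correspondence G₁ G₂) where
    open Correspondence C
    open Matched

    -- Otherwise every `g` has a related pair with `b` on the hyperplane of `e` and `b′` off that of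
    -- `g`. A generic combination makes `b′` nonzero at all edges while `b` still kills `e`; then
    -- the `m`-th power of one form is nonzero and that of the other is zero by `class-vanish`.
    kills-exists : ∀ e → ¬ ¬ (∃[ g ] Kills C e g)
    kills-exists e stop = ¬¬-all {P = λ g → ∃[ p ] ¬ (f g p F.≈ F.0#)}
        (λ g fail → stop (g , λ r d nz → fail ((_ , _ , r , d) , nz))) λ witness →
      -- The zero vector with any image serves as the base point for `generic`.
      total (λ _ → F.0#) λ (b′ , r) →
      generic combine f (λ g p t q → diff-combine (G₂ g) (proj₁ (proj₂ p)) t (proj₁ (proj₂ q)))
        ((λ _ → F.0#) , b′ , r , diff-zero (λ _ → F.0#) (self (G₁ e)) F.refl) witness
        λ ((b , b′ , r , d) , nz) →
      nowhere-zero G₂ b′ nz (R-zero (R-triple n (λ _ → r))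
        (class-vanish G₁ e b b d (n c0) (n c1) (n c2) (ℕ.≤-trans (s≤s (ℕ.≤-reflexive total-degree))
          (ℕ.≤-trans (ℕ.≤-reflexive (ℕ.+-comm 1 _)) (ℕ.+-monoʳ-≤ (n c0 ℕ.+ n c0 ℕ.+ (n c1 ℕ.+ (n c2 ℕ.+ n c2))) (size-positive G₁ e))))))
      where
      M = Σ (Fin (suc n₁) → 𝕂) λ b → Σ (Fin (suc n₂) → 𝕂) λ b′ → R (z G₁ b) (z G₂ b′) × (diff (G₁ e) b F.≈ F.0#)
      f : Fin m → M → 𝕂
      f g (_ , b′ , _) = diff (G₂ g) b′
      combine : M → 𝕂 → M → M
      combine (b , b′ , r , d) t (a , a′ , s , d′) = _ , _ , R-z t r s , F.trans (diff-combine (G₁ e) b t a)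
        (F.trans (F.+-cong d (F.trans (F.*-congˡ d′) (F.zeroʳ t))) (F.+-identityˡ _))
      n = count {m} (λ _ → c0)
      total-degree : m ℕ.+ m ≡ n c0 ℕ.+ n c0 ℕ.+ (n c1 ℕ.+ (n c2 ℕ.+ n c2))
      total-degree = sym (trans (cong₂ ℕ._+_ (cong₂ ℕ._+_ (count-const-c0 m) (count-const-c0 m))
        (cong₂ ℕ._+_ (count-const m c1 (λ ())) (cong₂ ℕ._+_ (count-const m c2 (λ ())) (count-const m c2 (λ ())))))
        (ℕ.+-identityʳ _))

    kills-parallel : ∀ {e g e′} → Kills C e g → Kills (converse C) g e′ → Parallel (G₁ e′) (G₁ e)
    kills-parallel k k′ = parallel-from-kernel λ b d stop → total b λ (b′ , r) →
      k r d λ d′ → k′ r d′ stop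

  module _ {n₁ n₂ m} {G₁ : Graph n₁ m} {G₂ : Graph n₂ m} (C : Correspondence G₁ G₂) where
    open Correspondence C
    open Matched

    -- Going to `g` and back to `e′` includes the hyperplane of `e` in that of `e′`, so the two
    -- edges are parallel and `e′` can be replaced by `e`.
    match-exists : ∀ e → ¬ ¬ (∃[ g ] Matched C e g)
    match-exists e stop = kills-exists C e λ (g , k) → kills-exists (converse C) g λ (e′ , k′) →
      stop (g , matched k λ {_} {b} r d fail → k′ r d λ d′ →
        fail (diff-parallel b (Parallel-sym (kills-parallel C k k′)) d′))

    matched-sym : ∀ {e g} → Matched C e g → Matched (converse C) g e
    matched-sym (matched t f) = matched f t

    matched-parallel : ∀ {e f g h} → Matched C e g → Matched C f h → Parallel (G₁ e) (G₁ f) → Parallel (G₂ g) (G₂ h)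
    matched-parallel p q e∥f = Parallel-sym (parallel-from-kernel λ b′ d stop → total⁻¹ b′ λ (b , r) →
      from p r d λ d₁ → to q r (diff-parallel b (Parallel-sym e∥f) d₁) stop)

    -- Take `b₀` killing only the class of `e`, once for each edge outside this class, and a nowhere
    -- vanishing `b₁` once for each edge in it: the product is nonzero. Its image has order 2m -
    -- size of `e` in the weighting of `class-vanish` for `g`, and would vanish if the class of `g`
    -- were larger.
    matched-size-≥ : ∀ {e g} → Matched C e g → size G₂ g ≤ size G₁ e
    matched-size-≥ {e} {g} p = decidable-stable (size G₂ g ℕ.≤? size G₁ e) λ ≰ →
      let b₁ , nz₁ = everywhere G₁ in
      total b₀ λ (b₀′ , r₀) → total b₁ λ (b₁′ , r₁) → to p r₀ kill λ kill′ →
      triple-nonzero char0 {z = zs b₁} (λ d → adapted-zs b₁ d) (nonzero b₁ nz₁)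
        (R-zero⁻¹ (R-* (R-^ (n c0) r₀) (R-* (R-^ (n c1) r₁) (R-^ (n c2) r₀)))
          (class-vanish G₂ g b₀′ b₁′ kill′ (n c0) (n c1) (n c2) (degree (ℕ.≰⇒> ≰))))
      where
      col = colour₁ (G₁ e) ∘ G₁
      n = count col
      S? : ∀ i → Dec (Incident i (G₁ e))
      S? i = incident? i (G₁ e)
      b₀ = sep S?
      kill : diff (G₁ e) b₀ F.≈ F.0#
      kill = diff-zero b₀ (self (G₁ e)) (F.trans (sep-inside S? (inj₁ refl)) (F.sym (sep-inside S? (inj₂ refl))))
      zs : (Fin (suc n₁) → 𝕂) → Colour → Φ m
      zs b₁ c0 = z G₁ b₀
      zs b₁ c1 = z G₁ b₁
      -- No edge has colour `c2` here, so this value is only raised to the power 0.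
      zs b₁ c2 = z G₁ b₀
      foreign : ∀ x → col x ≢ c0 → diff (G₁ x) b₀ F.≈ F.0#
      foreign x ne with col x in eq
      ... | c0 = ⊥-elim (ne refl)
      ... | c1 = diff-parallel b₀ (colour₁-c1 eq) kill
      ... | c2 = ⊥-elim (colour₁-c2 {e = G₁ e} {G₁ x} eq)
      adapted-zs : ∀ b₁ d → Adapted col d (zs b₁ d)
      adapted-zs b₁ c0 = z-adapted G₁ b₀ λ x _ → foreign x
      adapted-zs b₁ c2 = z-adapted G₁ b₀ λ x _ → foreign x
      adapted-zs b₁ c1 = z-adapted G₁ b₁ λ x ne₁ ne₀ → ⊥-elim (third (col x) refl ne₁ ne₀)
        where
        third : ∀ {x} d → col x ≡ d → d ≢ c1 → d ≢ c0 → ⊥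
        third c0 eq ne₁ ne₀ = ne₀ refl
        third c1 eq ne₁ ne₀ = ne₁ refl
        third {x} c2 eq ne₁ ne₀ = colour₁-c2 {e = G₁ e} {G₁ x} eq
      nonzero′ : ∀ b₁ → (∀ x → ¬ (diff (G₁ x) b₁ F.≈ F.0#)) → ∀ x d → col x ≡ d → ¬ (lin x (zs b₁ d) F.≈ F.0#)
      nonzero′ b₁ nz₁ x c0 eq q = sep-apart S? (lo≢hi (G₁ x))
        (λ (p , p′) → colour₁-c0 eq (Ends-Parallel (self (G₁ x)) (Ends-intro {e = G₁ e} (lo≢hi (G₁ x)) p p′)))
        (diff-zero⁻¹ b₀ (self (G₁ x)) (F.trans (F.sym (lin-z G₁ x b₀)) q))
      nonzero′ b₁ nz₁ x c1 eq q = nz₁ x (F.trans (F.sym (lin-z G₁ x b₁)) q)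
      nonzero′ b₁ nz₁ x c2 eq q = colour₁-c2 {e = G₁ e} {G₁ x} eq
      nonzero : ∀ b₁ → (∀ x → ¬ (diff (G₁ x) b₁ F.≈ F.0#)) → ∀ x → ¬ (lin x (zs b₁ (col x)) F.≈ F.0#)
      nonzero b₁ nz₁ x = nonzero′ b₁ nz₁ x (col x) refl
      degree : size G₁ e < size G₂ g → m ℕ.+ m < (n c0 ℕ.+ n c0 ℕ.+ (n c1 ℕ.+ (n c2 ℕ.+ n c2))) ℕ.+ size G₂ g
      degree lt = ℕ.≤-<-trans (ℕ.≤-reflexive (trans (cong₂ ℕ._+_ (sym (count-total col)) (sym (count-total col)))
        (solve 3 (λ a b d → (a :+ (b :+ d)) :+ (a :+ (b :+ d)) := (a :+ a :+ (b :+ (d :+ d))) :+ b) refl (n c0) (n c1) (n c2))))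
        (ℕ.+-monoʳ-< (n c0 ℕ.+ n c0 ℕ.+ (n c1 ℕ.+ (n c2 ℕ.+ n c2))) (subst (_< size G₂ g) (sym (count₁-c1 G₁ e)) lt))
        where open +-*-Solver

  module _ {n₁ n₂ m} {G₁ : Graph n₁ m} {G₂ : Graph n₂ m} (C : Correspondence G₁ G₂) where
    open Correspondence C
    open Matched

    matched-size : ∀ {e g} → Matched C e g → size G₂ g ≡ size G₁ e
    matched-size p = ℕ.≤-antisym (matched-size-≥ C p) (matched-size-≥ (converse C) (matched-sym C p))

    matched-parallel⁻¹ : ∀ {e f g h} → Matched C e g → Matched C f h → Parallel (G₂ g) (G₂ h) → Parallel (G₁ e) (G₁ f)
    matched-parallel⁻¹ p q = matched-parallel (converse C) (matched-sym C p) (matched-sym C q)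

    -- The product of `block-nonvanish` is transported to `G₂`, where it would vanish by
    -- `block-vanish` if `g` and `h` were disjoint. Equal class sizes and equal numbers of edges
    -- make the exponents fit on both sides.
    corner-shared : ∀ {e f g h u v w} → Ends (G₁ e) u v → Ends (G₁ f) u w → v ≢ w → (∀ x → ¬ Ends (G₁ x) v w) →
      Matched C e g → Matched C f h → ¬ ¬ Shared (G₂ g) (G₂ h)
    corner-shared {e} {f} {g} {h} eu fu v≢w no-third p q ns =
      total (bs c0) λ (b₀ , r₀) → total (bs c1) λ (b₁ , r₁) → total (bs c2) λ (b₂ , r₂) →
      total (λ _ → F.1#) λ (b , r) →
      to p r₀ (witness-e₀ G₁ eu fu v≢w no-third) λ g₀ →
      to q r₀ (witness-f₀ G₁ eu fu v≢w no-third) λ h₀ →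
      to q r₁ (witness-f₁ G₁ eu fu v≢w no-third) λ h₁ →
      to p r₂ (witness-e₂ G₁ eu fu v≢w no-third) λ g₂ →
      -- The image of the constant vector has no linear part either: each edge `y` is matched with
      -- some `x`, and the constant kills `x`.
      ¬¬-all {P = λ y → diff (G₂ y) b F.≈ F.0#} (λ y fail → match-exists (converse C) y λ (x , yx) →
        from yx r (diff-zero (λ _ → F.1#) (self (G₁ x)) F.refl) fail) λ all →
      block-nonvanish G₁ eu fu v≢w no-third refl k₁ k₂
        (R-zero⁻¹ (R-* (R-* (R-^ k r₀) (R-* (R-^ (ℕ.pred (size G₁ e)) r₁) (R-^ (ℕ.pred (size G₁ f)) r₂))) r)
          (block-vanish G₂ ns (λ { c0 → b₀ ; c1 → b₁ ; c2 → b₂ }) b g₀ h₀ h₁ g₂ all l₀ (trans s₁ k₁) (trans s₂ k₂)))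
      where
      bs = witnesses G₁ eu fu v≢w no-third
      col = colour₂ (G₁ e) (G₁ f) ∘ G₁
      col′ = colour₂ (G₂ g) (G₂ h) ∘ G₂
      k = count col c0
      e∦f : ¬ Parallel (G₁ e) (G₁ f)
      e∦f e∥f with Ends-only (Parallel-Ends e∥f fu) (Ends-right eu)
      ... | inj₁ eq = Ends-≢ eu (sym eq)
      ... | inj₂ eq = v≢w eq
      g∦h : ¬ Parallel (G₂ g) (G₂ h)
      g∦h g∥h = e∦f (matched-parallel⁻¹ p q g∥h)
      positive : ∀ e → size G₁ e ≡ suc (ℕ.pred (size G₁ e))
      positive e with size G₁ e | size-positive G₁ e
      ... | suc _ | _ = refl
      k₁ = trans (count₂-c1 G₁ e f) (positive e)
      k₂ = trans (count₂-c2 G₁ e f e∦f) (positive f)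
      s₁ : count col′ c1 ≡ count col c1
      s₁ = trans (count₂-c1 G₂ g h) (trans (matched-size p) (sym (count₂-c1 G₁ e f)))
      s₂ : count col′ c2 ≡ count col c2
      s₂ = trans (count₂-c2 G₂ g h g∦h) (trans (matched-size q) (sym (count₂-c2 G₁ e f e∦f)))
      l₀ : count col′ c0 ≡ k
      l₀ = ℕ.+-cancelʳ-≡ (count col c1 ℕ.+ count col c2) _ _ (trans
        (cong (count col′ c0 ℕ.+_) (sym (cong₂ ℕ._+_ s₁ s₂))) (trans (count-total col′) (sym (count-total col))))

    -- If a third edge `x` closes a triangle, `corner-shared` does not apply. Were `g` and `h` then
    -- disjoint, some `b′` would kill them but not the partner of `x`; a vector related to it kills
    -- `e` and `f`, hence `x`, a contradiction.
    matched-shared : ∀ {e f g h} → Matched C e g → Matched C f h → Shared (G₁ e) (G₁ f) → Shared (G₂ g) (G₂ h)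
    matched-shared {e} {f} {g} {h} p q (u , u∈e , u∈f) with parallel? (G₁ e) (G₁ f)
    ... | yes e∥f = lo (G₂ h) , Parallel-Incident (matched-parallel C p q e∥f) (inj₁ refl) , inj₁ refl
    ... | no e∦f with other {e = G₁ e} u∈e | other {e = G₁ f} u∈f
    ...   | v , eu | w , fu with Fin.any? (λ x → ends? (G₁ x) v w)
    ...     | no ¬x = decidable-stable (shared? (G₂ g) (G₂ h))
                (corner-shared eu fu (λ { refl → e∦f (Ends-Parallel eu fu) }) (λ x x∈ → ¬x (x , x∈)) p q)
    ...     | yes (x , xvw) = decidable-stable (shared? (G₂ g) (G₂ h)) λ ns →
                match-exists C x λ (y , s) →
                let b′ , gb , hb , yb = disjoint-independent {G = G₂} {g} {h} {y} ns
                      (λ y∥g → x∦ (Ends-left eu) (Ends-≢ eu ∘ sym) (Ends-≢ fu ∘ sym) (Parallel-sym (matched-parallel⁻¹ s p y∥g)))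
                      (λ y∥h → x∦ (Ends-left fu) (Ends-≢ eu ∘ sym) (Ends-≢ fu ∘ sym) (Parallel-sym (matched-parallel⁻¹ s q y∥h)))
                in total⁻¹ b′ λ (b , r) → from p r gb λ eb → from q r hb λ fb →
                   to s r (diff-zero b xvw (F.trans (F.sym (diff-zero⁻¹ b eu eb)) (diff-zero⁻¹ b fu fb))) yb
      where
      x∦ : ∀ {e} → Incident u (G₁ e) → v ≢ u → w ≢ u → ¬ Parallel (G₁ e) (G₁ x)
      x∦ u∈ v≢u w≢u e∥x with Ends-only xvw (Parallel-Incident (Parallel-sym e∥x) u∈)
      ... | inj₁ eq = v≢u (sym eq)
      ... | inj₂ eq = w≢u (sym eq)

    -- The images meet pairwise, so without a common vertex they would form a triangle and be
    -- dependent, whereas pairwise nonparallel edges at one vertex are independent.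
    matched-star : ∀ {e f x g h y} → Matched C e g → Matched C f h → Matched C x y →
      Star (G₁ e) (G₁ f) (G₁ x) → Star (G₂ g) (G₂ h) (G₂ y)
    matched-star {e} {f} {x} {g} {h} {y} p q s st@(u , u∈e , u∈f , u∈x)
      with parallel? (G₁ x) (G₁ e) | parallel? (G₁ x) (G₁ f) | matched-shared p q (u , u∈e , u∈f)
    ... | yes x∥e | _       | v , v∈g , v∈h = v , v∈g , v∈h , Parallel-Incident (matched-parallel C s p x∥e) v∈g
    ... | no _    | yes x∥f | v , v∈g , v∈h = v , v∈g , v∈h , Parallel-Incident (matched-parallel C s q x∥f) v∈h
    ... | no x∦e  | no x∦f  | gh = decidable-stable (star? (G₂ g) (G₂ h) (G₂ y)) λ ¬star →
      let b , eb , fb , xb = star-independent {G = G₁} {e} {f} {x} st x∦e x∦f in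
      total b λ (b′ , r) → to p r eb λ gb → to q r fb λ hb →
      from s r (triangle-dependent {G = G₂} {g} {h} {y} gh (matched-shared p s (u , u∈e , u∈x)) (matched-shared q s (u , u∈f , u∈x)) ¬star b′ gb hb) xb

-- From edge maps to vertex maps

record EdgeMap {n₁ n₂ m} (G₁ : Graph n₁ m) (G₂ : Graph n₂ m) : Set where
  field
    π           : Fin m → Fin m
    parallel    : ∀ {e f} → Parallel (G₁ e) (G₁ f) → Parallel (G₂ (π e)) (G₂ (π f))
    parallel⁻¹  : ∀ {e f} → Parallel (G₂ (π e)) (G₂ (π f)) → Parallel (G₁ e) (G₁ f)
    star        : ∀ {e f x} → Star (G₁ e) (G₁ f) (G₁ x) → Star (G₂ (π e)) (G₂ (π f)) (G₂ (π x))
    star⁻¹      : ∀ {e f x} → Star (G₂ (π e)) (G₂ (π f)) (G₂ (π x)) → Star (G₁ e) (G₁ f) (G₁ x)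
    sizes       : ∀ e → size G₂ (π e) ≡ size G₁ e
    onto        : ∀ g → ∃[ e ] Parallel (G₂ (π e)) (G₂ g)

meet-unique : ∀ {n} {e f : Edge n} {u v} → ¬ Parallel e f →
  Incident u e → Incident u f → Incident v e → Incident v f → u ≡ v
meet-unique {e = e} {f} {u} {v} e∦f ue uf ve vf with u ≟ v
... | yes eq = eq
... | no ne  = ⊥-elim (e∦f (Ends-Parallel (Ends-intro {e = e} ne ue ve) (Ends-intro {e = f} ne uf vf)))

mult-Ends : ∀ {n m} (G : Graph n m) {e u v} → Ends (G e) u v → mult G u v ≡ size G e
mult-Ends G {e} {u} {v} euv = sumFin-cong λ x → same x
  where
  same : ∀ x → joins (G x) u v ≡ joins (G x) (lo (G e)) (hi (G e))
  same x with parallel? (G x) (G e)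
  ... | yes p = trans (joins-Ends (Parallel-Ends p euv)) (sym (joins-parallel (G x) (G e) p))
  ... | no ¬p = trans (joins-¬Ends (λ xuv → ¬p (Ends-Parallel xuv euv))) (sym (joins-¬parallel (G x) (G e) ¬p))

module VertexMap {n₁ n₂ m} {G₁ : Graph n₁ m} {G₂ : Graph n₂ m} (M : EdgeMap G₁ G₂)
                 (cover₁ : NoIsolatedVertex G₁) (cover₂ : NoIsolatedVertex G₂) where
  open EdgeMap M

  record Same (u : Fin (suc n₁)) (j : Fin (suc n₂)) : Set where
    constructor same
    field
      there : ∀ x → Incident u (G₁ x) → Incident j (G₂ (π x))
      back  : ∀ x → Incident j (G₂ (π x)) → Incident u (G₁ x)
  open Same

  Lone : Fin m → Set
  Lone e = ∀ {x v} → Incident v (G₁ x) → Incident v (G₁ e) → Parallel (G₁ x) (G₁ e)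

  -- The two ends of an edge forming a component of its own have the same
  -- incident edges; they are told apart by the order on the vertices.
  Oriented : Fin (suc n₁) → Fin (suc n₂) → Set
  Oriented u j = ∀ e → Lone e → (u ≡ lo (G₁ e) → j ≡ lo (G₂ (π e))) × (u ≡ hi (G₁ e) → j ≡ hi (G₂ (π e)))

  not-lone : ∀ {u j} → (∀ e → Incident u (G₁ e) → ¬ Lone e) → Oriented u j
  not-lone h e lone = (λ eq → ⊥-elim (h e (inj₁ eq) lone)) , (λ eq → ⊥-elim (h e (inj₂ eq) lone))

  -- Nonparallel edges meet in at most one vertex, so `u` and `j` are determined by `e`, `f` and by
  -- their images; a star through both then pins down every further edge. Repeating an edge turns
  -- `Star` into plain adjacency.
  branching : ∀ {e f u} → Incident u (G₁ e) → Incident u (G₁ f) → ¬ Parallel (G₁ e) (G₁ f) → ∃[ j ] Same u j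
  branching {e} {f} {u} ue uf e∦f with star {e} {f} {f} (u , ue , uf , uf)
  ... | j , je , jf , _ = j , same there′ back′
    where
    there′ : ∀ x → Incident u (G₁ x) → Incident j (G₂ (π x))
    there′ x ux with star {e} {f} {x} (u , ue , uf , ux)
    ... | j′ , je′ , jf′ , jx =
      subst (λ j → Incident j (G₂ (π x))) (meet-unique {e = G₂ (π e)} {G₂ (π f)} (e∦f ∘ parallel⁻¹) je′ jf′ je jf) jx
    back′ : ∀ x → Incident j (G₂ (π x)) → Incident u (G₁ x)
    back′ x jx with star⁻¹ {e} {f} {x} (j , je , jf , jx)
    ... | u′ , ue′ , uf′ , ux =
      subst (λ u → Incident u (G₁ x)) (meet-unique {e = G₁ e} {G₁ f} e∦f ue′ uf′ ue uf) ux

  -- If all edges at `u` are parallel to `e`, the other end `v` decides: when `v` branches, `u` goes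
  -- to the end of `π e` opposite to the image of `v`; when it does not, `e` spans a component and
  -- the order of the ends is used.
  image : ∀ u → ∃[ j ] Same u j × Oriented u j
  image u with cover₁ u
  ... | e , ue with Fin.any? (λ f → incident? u (G₁ f) ×-dec ¬? (parallel? (G₁ f) (G₁ e)))
  ...   | yes (f , uf , f∦e) with branching uf ue f∦e
  ...     | j , s = j , s , not-lone λ e′ ue′ lone →
              f∦e (Parallel-trans (lone uf ue′) (Parallel-sym (lone ue ue′)))
  image u | e , ue | no unique with other {e = G₁ e} ue
  ... | v , uv with Fin.any? (λ f → incident? v (G₁ f) ×-dec ¬? (parallel? (G₁ f) (G₁ e)))
  ...   | yes (f , vf , f∦e) = leaf
    where
    only : ∀ x → Incident u (G₁ x) → Parallel (G₁ x) (G₁ e)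
    only x ux = decidable-stable (parallel? (G₁ x) (G₁ e)) λ x∦e → unique (x , ux , x∦e)
    leaf : ∃[ j ] Same u j × Oriented u j
    leaf with branching vf (Ends-right uv) f∦e
    ... | k , s with other {e = G₂ (π e)} (there s e (Ends-right uv))
    ...   | j , kj = j ,
      same (λ x ux → Parallel-Incident (parallel (only x ux)) (Ends-right kj)) back′ ,
      not-lone λ e′ ue′ lone → f∦e (Parallel-trans (lone vf (Parallel-Incident (only e′ ue′) (Ends-right uv)))
                                                   (only e′ ue′))
      where
      back′ : ∀ x → Incident j (G₂ (π x)) → Incident u (G₁ x)
      -- `x` meets `e` at `u` or at `v`. In the latter case the image of `x` contains both ends `k`
      -- and `j` of `π e`, so `x` is parallel to `e`.
      back′ x jx with star⁻¹ {e} {x} {x} (j , Ends-right kj , jx , jx)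
      ... | t , te , tx , _ with Ends-only uv te
      ...   | inj₁ refl = tx
      ...   | inj₂ refl = Parallel-Incident (parallel⁻¹ (Ends-Parallel
                (Ends-intro {e = G₂ (π x)} (Ends-≢ kj) (there s x tx) jx) kj)) ue
  ...   | no unique′ = component ue
    where
    only : ∀ x → Incident u (G₁ x) → Parallel (G₁ x) (G₁ e)
    only x ux = decidable-stable (parallel? (G₁ x) (G₁ e)) λ x∦e → unique (x , ux , x∦e)
    only′ : ∀ x → Incident v (G₁ x) → Parallel (G₁ x) (G₁ e)
    only′ x vx = decidable-stable (parallel? (G₁ x) (G₁ e)) λ x∦e → unique′ (x , vx , x∦e)
    same′ : ∀ {j} → Incident j (G₂ (π e)) → Same u j
    same′ {j} je = same (λ x ux → Parallel-Incident (parallel (only x ux)) je) back′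
      where
      back′ : ∀ x → Incident j (G₂ (π x)) → Incident u (G₁ x)
      back′ x jx with star⁻¹ {e} {x} {x} (j , je , jx , jx)
      ... | t , te , tx , _ with Ends-only uv te
      ...   | inj₁ refl = tx
      ...   | inj₂ refl = Parallel-Incident (only′ x tx) ue
    component : Incident u (G₁ e) → ∃[ j ] Same u j × Oriented u j
    component (inj₁ refl) = lo (G₂ (π e)) , same′ (inj₁ refl) , λ e′ lone →
        (λ eq → let par p _ = parallel (only e′ (inj₁ eq)) in sym p) ,
        (λ eq → let par p _ = only e′ (inj₂ eq) in ⊥-elim (lo≢hi (G₁ e′) (trans p eq)))
    component (inj₂ refl) = hi (G₂ (π e)) , same′ (inj₂ refl) , λ e′ lone →
        (λ eq → let par _ p = only e′ (inj₁ eq) in ⊥-elim (lo≢hi (G₁ e′) (sym (trans p eq)))) ,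
        (λ eq → let par _ p = parallel (only e′ (inj₂ eq)) in sym p)

  vertex : Fin (suc n₁) → Fin (suc n₂)
  vertex u = proj₁ (image u)

  vertex-same : ∀ u → Same u (vertex u)
  vertex-same u = proj₁ (proj₂ (image u))

  vertex-oriented : ∀ u → Oriented u (vertex u)
  vertex-oriented u = proj₂ (proj₂ (image u))

  -- The orientation settles a lone edge. Otherwise a nonparallel `x` passes through one end of `e`;
  -- if the images coincided, it would pass through the other end too.
  ends-distinct : ∀ e → vertex (lo (G₁ e)) ≢ vertex (hi (G₁ e))
  ends-distinct e eq with Fin.any? (λ x → Fin.any? (λ v → incident? v (G₁ x) ×-dec incident? v (G₁ e)) ×-dec ¬? (parallel? (G₁ x) (G₁ e)))
  ... | no lone = lo≢hi (G₂ (π e)) (trans (sym (proj₁ (vertex-oriented _ e lone′) refl))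
                                   (trans eq (proj₂ (vertex-oriented _ e lone′) refl)))
    where
    lone′ : Lone e
    lone′ {x} {v} vx ve = decidable-stable (parallel? (G₁ x) (G₁ e)) λ x∦e → lone (x , (v , vx , ve) , x∦e)
  ... | yes (x , (v , vx , inj₁ refl) , x∦e) = x∦e (Ends-Parallel (Ends-intro {e = G₁ x} (lo≢hi (G₁ e)) vx
          (back (vertex-same _) x (subst (λ j → Incident j (G₂ (π x))) eq (there (vertex-same _) x vx)))) (self (G₁ e)))
  ... | yes (x , (v , vx , inj₂ refl) , x∦e) = x∦e (Ends-Parallel (Ends-intro {e = G₁ x} (lo≢hi (G₁ e))
          (back (vertex-same _) x (subst (λ j → Incident j (G₂ (π x))) (sym eq) (there (vertex-same _) x vx))) vx) (self (G₁ e)))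

  vertex-Ends : ∀ {e u v} → Ends (G₁ e) u v → Ends (G₂ (π e)) (vertex u) (vertex v)
  vertex-Ends {e} uv = Ends-intro {e = G₂ (π e)} (distinct uv) (there (vertex-same _) e (Ends-left uv)) (there (vertex-same _) e (Ends-right uv))
    where
    distinct : ∀ {u v} → Ends (G₁ e) u v → vertex u ≢ vertex v
    distinct (up refl refl)   = ends-distinct e
    distinct (down refl refl) = ends-distinct e ∘ sym

  vertex-injective : ∀ {u v} → vertex u ≡ vertex v → u ≡ v
  vertex-injective {u} {v} eq with u ≟ v
  ... | yes p = p
  ... | no ne = let e , ue = cover₁ u in ⊥-elim (Ends-≢ (vertex-Ends (Ends-intro {e = G₁ e} ne ue
            (back (vertex-same v) e (subst (λ j → Incident j (G₂ (π e))) eq (there (vertex-same u) e ue))))) eq)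

  vertex-surjective : ∀ j → ∃[ u ] vertex u ≡ j
  vertex-surjective j with cover₂ j
  ... | g , jg with onto g
  ...   | e , e∥g with Ends-only (vertex-Ends (self (G₁ e))) (Parallel-Incident e∥g jg)
  ...     | inj₁ eq = lo (G₁ e) , sym eq
  ...     | inj₂ eq = hi (G₁ e) , sym eq

  vertex-mult : ∀ u v → mult G₂ (vertex u) (vertex v) ≡ mult G₁ u v
  vertex-mult u v with Fin.any? (λ e → ends? (G₁ e) u v)
  ... | yes (e , uv) = trans (mult-Ends G₂ (vertex-Ends uv)) (trans (sizes e) (sym (mult-Ends G₁ uv)))
  ... | no ¬e = trans (sumFin-zero λ g → joins-¬Ends (absent g)) (sym (sumFin-zero λ e → joins-¬Ends λ uv → ¬e (e , uv)))
    where
    absent : ∀ g → ¬ Ends (G₂ g) (vertex u) (vertex v)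
    absent g guv with onto g
    ... | e , e∥g = ¬e (e , Ends-intro {e = G₁ e} (Ends-≢ guv ∘ cong vertex)
      (back (vertex-same u) e (Ends-left (Parallel-Ends e∥g guv))) (back (vertex-same v) e (Ends-right (Parallel-Ends e∥g guv))))

  graphIso : GraphIso G₁ G₂
  graphIso = record
    { σ = mk↔ₛ′ vertex (proj₁ ∘ vertex-surjective) (proj₂ ∘ vertex-surjective)
            (λ u → vertex-injective (proj₂ (vertex-surjective (vertex u))))
    ; preserve = vertex-mult }

-- Deciding graph isomorphism by enumerating vertex maps

any-Vec? : ∀ {n k} {P : Vec (Fin n) k → Set} → (∀ v → Dec (P v)) → Dec (∃ P)
any-Vec? {k = zero} P? with P? []
... | yes p = yes ([] , p)
... | no ¬p = no λ { ([] , p) → ¬p p }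
any-Vec? {k = suc k} P? with Fin.any? (λ i → any-Vec? (λ v → P? (i ∷ v)))
... | yes (i , v , p) = yes (i ∷ v , p)
... | no ¬p = no λ { (i ∷ v , p) → ¬p (i , v , p) }

graphIso? : ∀ {n₁ m₁ n₂ m₂} (G₁ : Graph n₁ m₁) (G₂ : Graph n₂ m₂) → Dec (GraphIso G₁ G₂)
graphIso? G₁ G₂ with any-Vec? (λ f → any-Vec? (λ g →
    Fin.all? (λ j → lookup f (lookup g j) ≟ j) ×-dec Fin.all? (λ u → lookup g (lookup f u) ≟ u)
    ×-dec Fin.all? (λ u → Fin.all? (λ v → mult G₂ (lookup f u) (lookup f v) ℕ.≟ mult G₁ u v))))
... | yes (f , g , fg , gf , h) = yes record { σ = mk↔ₛ′ (lookup f) (lookup g) fg gf ; preserve = h }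
... | no ¬p = no λ iso → let open GraphIso iso; open Inverse σ in ¬p
  ( tabulate to , tabulate from
  , (λ j → trans (Vec.lookup∘tabulate to _) (trans (cong to (Vec.lookup∘tabulate from j)) (strictlyInverseˡ j)))
  , (λ u → trans (Vec.lookup∘tabulate from _) (trans (cong from (Vec.lookup∘tabulate to u)) (strictlyInverseʳ u)))
  , (λ u v → trans (cong₂ (mult G₂) (Vec.lookup∘tabulate to u) (Vec.lookup∘tabulate to v)) (preserve u v)))

-- From filtered isomorphisms to graph isomorphisms

module Forward {c ℓ : Level} (K : Field c ℓ) (char0 : CharZero K) where
  open Algebra K
  open ΦRing K
  open Coefficients K
  open GraphAlgebra K
  open Recovery K char0
  open Matching K char0
  private module F = Field K
  open F using () renaming (Carrier to 𝕂)

  z-nilpotent : ∀ {n m} (G : Graph n m) b → z G b ^ suc m ≋ zeroΦ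
  z-nilpotent {m = m} G b = Ord-vanish {w = λ _ → 1} {suc m ℕ.* 1}
    (Ord-^ (suc m) (Ord-intro (z-constant G b) (λ { e (s≤s ()) }) (λ _ _ → s≤s z≤n)))
    (ℕ.≤-reflexive (trans (cong suc (sumFin-one m)) (sym (ℕ.*-identityʳ (suc m)))))

  -- The constant term is multiplicative, and powers of a nonzero scalar are nonzero.
  nilpotent-constant : ∀ {m} (x : Φ m) k → x ^ k ≋ zeroΦ → ¬ ¬ (coef ∅ x F.≈ F.0#)
  nilpotent-constant {m} x k p nz = power k (F.trans (coef-cong ∅ p) (coef-zero (∅ {m})))
    where
    power : ∀ k → ¬ (coef ∅ (x ^ k) F.≈ F.0#)
    power zero    q = F.1≉0 (F.trans (F.sym (F.trans (coef-one (∅ {m})) (prod-∅ {m} (λ _ → F.0#)))) q)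
    power (suc k) q = *-nonzero nz (power k) (F.trans (F.sym (coef-∅-* x (x ^ k))) q)

  -- Inside the first filtration piece nilpotency singles out the forms `z G b`, a condition that an
  -- isomorphism respects; this is how they are matched although the isomorphism need not send any
  -- `y G i` to a generator.
  decompose-nilpotent : ∀ {n m} (G : Graph n m) {x} → Span G 1 x → ∀ k → x ^ k ≋ zeroΦ → ¬ ¬ (∃[ b ] x ≋ z G b)
  decompose-nilpotent {m = m} G {x} s k p stop with Span-1-decompose G s
  ... | a , b , q = nilpotent-constant x k p λ x₀ → stop (b ,
    ≋-trans q (≋-trans (+-cong (≋-trans (·-cong (F.trans (F.sym constant-term) x₀) ≋-refl) (·-zeroˡ _)) ≋-refl) (+-identityˡ _)))
    where
    constant-term : coef ∅ x F.≈ a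
    constant-term = F.trans (coef-cong ∅ q) (F.trans (coef-+ (∅ {m}) _ _) (F.trans (F.+-cong
      (F.trans (coef-· (∅ {m}) a oneΦ) (F.trans (F.*-congˡ (F.trans (coef-one (∅ {m})) (prod-∅ {m} (λ _ → F.0#)))) (F.*-identityʳ _)))
      (z-constant G b)) (F.+-identityʳ _)))

  correspondence : ∀ {n₁ m₁ n₂ m₂} {G₁ : Graph n₁ m₁} {G₂ : Graph n₂ m₂} → FilteredIso G₁ G₂ → Correspondence G₁ G₂
  correspondence {m₁ = m₁} {m₂ = m₂} {G₁} {G₂} iso = record
    { R = R ; R-one = R-one ; R-* = R-* ; R-z = R-z ; R-zero = R-zero ; R-zero⁻¹ = R-zero⁻¹
    ; total = total ; total⁻¹ = total⁻¹ }
    where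
    open FilteredIso iso
    R : Φ m₁ → Φ m₂ → Set _
    R x y = Σ (In𝒦 G₁ x) λ p → ψ x p ≋ y
    Z : ∀ b → In𝒦 G₁ (z G₁ b)
    Z b = 1 , Span⇒Filt G₁ (Span-z G₁ b)
    In-· : ∀ a x → In𝒦 G₁ x → In𝒦 G₁ (a · x)
    In-· a x (k , s) = k , Span⇒Filt G₁ (Span-· G₁ {x = x} a (Filt⇒Span G₁ s))
    R-cong : ∀ {x x′ y} → x ≋ x′ → R x y → R x′ y
    R-cong {x} {x′} p (k@(j , s) , q) = k′ , ≋-trans ⟪ ψ-cong x′ x k′ k (unwrap (≋-sym p)) ⟫ q
      where k′ = j , Span⇒Filt G₁ (Span-cong G₁ p (Filt⇒Span G₁ s))
    R-one : R oneΦ oneΦ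
    R-one = (0 , Span⇒Filt G₁ (Span-1 G₁)) , ⟪ ψ-1 _ ⟫
    R-* : ∀ {x x′ y y′} → R x y → R x′ y′ → R (x * x′) (y * y′)
    R-* {x} {x′} ((j , s) , p) ((k , t) , q) =
      (j ℕ.+ k , Span⇒Filt G₁ (Span-* G₁ {x = x} {x′} (Filt⇒Span G₁ s) (Filt⇒Span G₁ t))) , ≋-trans ⟪ ψ-* x x′ (j , s) (k , t) _ ⟫ (*-cong p q)
    R-^ : ∀ {x y} k → R x y → R (x ^ k) (y ^ k)
    R-^ zero    r = R-one
    R-^ (suc k) r = R-* r (R-^ k r)
    R-z : ∀ {b b′ d d′} t → R (z G₁ b) (z G₂ b′) → R (z G₁ d) (z G₂ d′) →
      R (z G₁ (λ i → b i F.+ t F.* d i)) (z G₂ (λ i → b′ i F.+ t F.* d′ i))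
    R-z {b} {b′} {d} {d′} t (p , r) (q , s) = R-cong (≋-sym (z-combine G₁ b t d)) (sum-in ,
      ≋-trans ⟪ ψ-+ (z G₁ b) (t · z G₁ d) p (In-· t (z G₁ d) q) sum-in ⟫
      (≋-trans (+-cong r (≋-trans ⟪ ψ-· t (z G₁ d) q (In-· t (z G₁ d) q) ⟫ (·-congˡ s))) (≋-sym (z-combine G₂ b′ t d′))))
      where
      sum-in : In𝒦 G₁ (z G₁ b + t · z G₁ d)
      sum-in = 1 , Span⇒Filt G₁ (Span-cong G₁ (z-combine G₁ b t d) (Span-z G₁ (λ i → b i F.+ t F.* d i)))
    -- Writing zero as `F.0# · x` supplies a membership proof and lets `ψ-·` compute its image.
    zero-image : ∀ x p → ψ (F.0# · x) (In-· F.0# x p) ≋ zeroΦ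
    zero-image x p = ≋-trans ⟪ ψ-· F.0# x p (In-· F.0# x p) ⟫ (·-zeroˡ _)
    R-zero : ∀ {x y} → R x y → x ≋ zeroΦ → y ≋ zeroΦ
    R-zero {x} (p , q) x≋0 = ≋-trans (≋-sym q) (≋-trans
      ⟪ ψ-cong x (F.0# · x) p (In-· F.0# x p) (unwrap (≋-trans x≋0 (≋-sym (·-zeroˡ x)))) ⟫ (zero-image x p))
    R-zero⁻¹ : ∀ {x y} → R x y → y ≋ zeroΦ → x ≋ zeroΦ
    R-zero⁻¹ {x} (p , q) y≋0 = ≋-trans
      ⟪ ψ-inj x (F.0# · x) p (In-· F.0# x p) (unwrap (≋-trans q (≋-trans y≋0 (≋-sym (zero-image x p))))) ⟫ (·-zeroˡ x)
    total : ∀ b → ¬ ¬ (∃[ b′ ] R (z G₁ b) (z G₂ b′))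
    total b stop = decompose-nilpotent G₂ (Filt⇒Span G₂ (ψ-filt 1 (z G₁ b) (Z b) (proj₂ (Z b)))) (suc m₁)
      (R-zero (R-^ (suc m₁) (Z b , ≋-refl)) (z-nilpotent G₁ b)) λ (b′ , q) → stop (b′ , Z b , q)
    total⁻¹ : ∀ b′ → ¬ ¬ (∃[ b ] R (z G₁ b) (z G₂ b′))
    total⁻¹ b′ stop with ψ-filt⁻¹ 1 (z G₂ b′) (Span⇒Filt G₂ (Span-z G₂ b′))
    ... | x , p , s , q = decompose-nilpotent G₁ (Filt⇒Span G₁ s) (suc m₂)
      (R-zero⁻¹ (R-^ (suc m₂) (p , ⟪ q ⟫)) (z-nilpotent G₂ b′)) λ (b , eq) → stop (b , R-cong eq (p , ⟪ q ⟫))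

  edgeMap : ∀ {n₁ n₂ m} {G₁ : Graph n₁ m} {G₂ : Graph n₂ m} → Correspondence G₁ G₂ → ¬ ¬ EdgeMap G₁ G₂
  edgeMap {G₁ = G₁} {G₂} C stop = ¬¬-all (match-exists C) λ π → ¬¬-all (match-exists (converse C)) λ ρ →
    let fwd = λ e → proj₂ (π e)
        bwd = λ e → matched-sym C (proj₂ (π e))
    in stop record
      { π          = proj₁ ∘ π
      ; parallel   = matched-parallel C (fwd _) (fwd _)
      ; parallel⁻¹ = matched-parallel (converse C) (bwd _) (bwd _)
      ; star       = matched-star C (fwd _) (fwd _) (fwd _)
      ; star⁻¹     = matched-star (converse C) (bwd _) (bwd _) (bwd _)
      ; sizes      = λ e → matched-size C (fwd e)
      ; onto       = λ g → let e , p = ρ g in e ,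
          kills-parallel (converse C) (Matched.to p) (Matched.to (fwd e))
      }

  recover : ∀ {n₁ m₁ n₂ m₂} (G₁ : Graph n₁ m₁) (G₂ : Graph n₂ m₂) → NoIsolatedVertex G₁ → NoIsolatedVertex G₂ →
    FilteredIso G₁ G₂ → GraphIso G₁ G₂
  recover G₁ G₂ cover₁ cover₂ iso = go G₁ G₂ cover₁ cover₂ C
      (ℕ.≤-antisym (edges-≤ C) (edges-≤ (converse C)))
    where
    C = correspondence iso
    go : ∀ {n₁ m₁ n₂ m₂} (G₁ : Graph n₁ m₁) (G₂ : Graph n₂ m₂) → NoIsolatedVertex G₁ → NoIsolatedVertex G₂ →
      Correspondence G₁ G₂ → m₁ ≡ m₂ → GraphIso G₁ G₂
    go G₁ G₂ cover₁ cover₂ C refl = decidable-stable (graphIso? G₁ G₂) λ stop →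
      edgeMap C λ M → stop (VertexMap.graphIso M cover₁ cover₂)

-- A bijection of edges from equal multiplicities

sumFin-remove : ∀ {k} (f : Fin (suc k) → ℕ) i → sumFin f ≡ f i ℕ.+ sumFin (f ∘ punchIn i)
sumFin-remove f zero = refl
sumFin-remove {suc k} f (suc i) = trans (cong (f zero ℕ.+_) (sumFin-remove (f ∘ suc) i))
  (solve 3 (λ a b c → a :+ (b :+ c) := b :+ (a :+ c)) refl (f zero) (f (suc i)) (sumFin (f ∘ suc ∘ punchIn i)))
  where open +-*-Solver

module _ {n₁ n₂} (σ : Fin (suc n₁) ↔ Fin (suc n₂)) where
  open Inverse σ using (to; from; strictlyInverseˡ; strictlyInverseʳ)

  to-injective : ∀ {u v} → to u ≡ to v → u ≡ v
  to-injective {u} {v} eq = trans (sym (strictlyInverseʳ u)) (trans (cong from eq) (strictlyInverseʳ v))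

  Ends-back : ∀ {e : Edge n₁} {g : Edge n₂} {u v a b} → Ends e u v → Ends g (to u) (to v) →
    Ends g (to a) (to b) → Ends e a b
  Ends-back {e} {g} {u} {v} {a} {b} uv guv gab =
    Ends-intro {e = e} (Ends-≢ gab ∘ cong to) (pull (Ends-left gab)) (pull (Ends-right gab))
    where
    pull : ∀ {a} → Incident (to a) g → Incident a e
    pull {a} p with Ends-only guv p
    ... | inj₁ eq = subst (λ i → Incident i e) (sym (to-injective eq)) (Ends-left uv)
    ... | inj₂ eq = subst (λ i → Incident i e) (sym (to-injective eq)) (Ends-right uv)

  Ends-forth : ∀ {e : Edge n₁} {g : Edge n₂} {u v a b} → Ends e u v → Ends g (to u) (to v) →
    Ends e a b → Ends g (to a) (to b)
  Ends-forth {e} {g} uv guv ab = Ends-intro {e = g} (Ends-≢ ab ∘ to-injective) (push (Ends-left ab)) (push (Ends-right ab))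
    where
    push : ∀ {a} → Incident a e → Incident (to a) g
    push p with Ends-only uv p
    ... | inj₁ refl = Ends-left guv
    ... | inj₂ refl = Ends-right guv

  joins-image : ∀ {e : Edge n₁} {g : Edge n₂} {u v} → Ends e u v → Ends g (to u) (to v) →
    ∀ a b → joins g (to a) (to b) ≡ joins e a b
  joins-image {e} {g} uv guv a b with ends? e a b
  ... | yes ab = trans (joins-Ends (Ends-forth uv guv ab)) (sym (joins-Ends ab))
  ... | no ¬ab = trans (joins-¬Ends (¬ab ∘ Ends-back uv guv)) (sym (joins-¬Ends ¬ab))

  -- The first edge of `G₁` makes a multiplicity positive, so some edge `g` of `G₂` joins the images
  -- of its ends. Removing both lowers every multiplicity equally, by `joins-image`, and the
  -- induction continues.
  edge-bijection : ∀ {m₁ m₂} (G₁ : Graph n₁ m₁) (G₂ : Graph n₂ m₂) →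
    (∀ u v → mult G₂ (to u) (to v) ≡ mult G₁ u v) →
    Σ (Permutation m₁ m₂) λ π → ∀ e → Ends (G₂ (π ⟨$⟩ʳ e)) (to (lo (G₁ e))) (to (hi (G₁ e)))
  edge-bijection {zero} {zero} G₁ G₂ h = Perm.id , λ ()
  edge-bijection {zero} {suc m₂} G₁ G₂ h = ⊥-elim (ℕ.<⇒≢ (size-positive G₂ zero) (sym
    (trans (sym (cong₂ (mult G₂) (strictlyInverseˡ (lo (G₂ zero))) (strictlyInverseˡ (hi (G₂ zero))))) (h _ _))))
  edge-bijection {suc m₁} {zero} G₁ G₂ h = ⊥-elim (ℕ.<⇒≢ (size-positive G₁ zero) (h _ _))
  edge-bijection {suc m₁} {suc m₂} G₁ G₂ h
    with sumFin-positive (λ g → joins (G₂ g) (to (lo (G₁ zero))) (to (hi (G₁ zero))))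
           (λ eq → ℕ.<⇒≢ (size-positive G₁ zero) (trans (sym eq) (h _ _)))
  ... | g , ne with edge-bijection (G₁ ∘ suc) (G₂ ∘ punchIn g) rest
    where
    rest : ∀ u v → mult (G₂ ∘ punchIn g) (to u) (to v) ≡ mult (G₁ ∘ suc) u v
    rest u v = ℕ.+-cancelˡ-≡ (joins (G₁ zero) u v) _ _ (trans
      (cong (ℕ._+ mult (G₂ ∘ punchIn g) (to u) (to v)) (sym (joins-image (self (G₁ zero)) (joins-≢0 ne) u v)))
      (trans (sym (sumFin-remove (λ x → joins (G₂ x) (to u) (to v)) g)) (h u v)))
  ... | π , p = Perm.insert zero g π , λ { zero → joins-≢0 ne ; (suc e) → p e }

-- From graph isomorphisms to filtered isomorphisms

module Backward {c ℓ : Level} (K : Field c ℓ) where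
  open Algebra K
  open ΦRing K
  open GraphAlgebra K
  private
    module F = Field K
    module P {m} = Sum (CommutativeRing.*-commutativeMonoid (Φ-ring m))
    module ΦM {m} = CommutativeSemigroupProperties (CommutativeRing.+-commutativeSemigroup (Φ-ring m))
    module ΦT {m} = CommutativeSemigroupProperties (CommutativeRing.*-commutativeSemigroup (Φ-ring m))
  open F using () renaming (Carrier to 𝕂)

  record Hom (m p : ℕ) : Set (c ⊔ ℓ) where
    field
      fun   : Φ m → Φ p
      congr : ∀ {x y} → x ≋ y → fun x ≋ fun y
      plus  : ∀ x y → fun (x + y) ≋ fun x + fun y
      scale : ∀ a x → fun (a · x) ≋ a · fun x
      times : ∀ x y → fun (x * y) ≋ fun x * fun y
      unit  : fun oneΦ ≋ oneΦ

    zero-fun : fun zeroΦ ≋ zeroΦ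
    zero-fun = ≋-trans (congr (≋-sym (·-zeroˡ zeroΦ))) (≋-trans (scale F.0# zeroΦ) (·-zeroˡ _))
  open Hom

  id-hom : ∀ {m} → Hom m m
  id-hom = record
    { fun = λ x → x ; congr = λ p → p ; plus = λ _ _ → ≋-refl ; scale = λ _ _ → ≋-refl
    ; times = λ _ _ → ≋-refl ; unit = ≋-refl }

  _∘h_ : ∀ {m p q} → Hom p q → Hom m p → Hom m q
  h ∘h k = record
    { fun = fun h ∘ fun k ; congr = congr h ∘ congr k
    ; plus = λ x y → ≋-trans (congr h (plus k x y)) (plus h _ _)
    ; scale = λ a x → ≋-trans (congr h (scale k a x)) (scale h _ _)
    ; times = λ x y → ≋-trans (congr h (times k x y)) (times h _ _)
    ; unit = ≋-trans (congr h (unit k)) (unit h) }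

  eval : ∀ {m p} → (Fin m → Φ p) → Φ m → Φ p
  eval a (const t)   = t · oneΦ
  eval a [ x , y ]   = eval (a ∘ suc) x + a zero * eval (a ∘ suc) y

  module _ {p : ℕ} where

    eval-cong : ∀ {m} {a b : Fin m → Φ p} {x y} → (∀ e → a e ≋ b e) → x ≋ y → eval a x ≋ eval b y
    eval-cong {x = const _}   {const _}   h ⟪ q ⟫     = ·-cong q ≋-refl
    eval-cong {x = [ x , x′ ]} {[ y , y′ ]} h ⟪ q , r ⟫ =
      +-cong (eval-cong {x = x} {y} (h ∘ suc) ⟪ q ⟫) (*-cong (h zero) (eval-cong {x = x′} {y′} (h ∘ suc) ⟪ r ⟫))

    eval-+ : ∀ {m} (a : Fin m → Φ p) x y → eval a (x + y) ≋ eval a x + eval a y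
    eval-+ a (const _)   (const _)   = ·-distribʳ _ _ _
    eval-+ a [ x , x′ ] [ y , y′ ] = ≋-trans
      (+-cong (eval-+ (a ∘ suc) x y) (≋-trans (*-cong ≋-refl (eval-+ (a ∘ suc) x′ y′)) (*-distribˡ _ _ _)))
      (ΦM.interchange _ _ _ _)

    eval-· : ∀ {m} (a : Fin m → Φ p) t x → eval a (t · x) ≋ t · eval a x
    eval-· a t (const _)   = ·-assoc _ _ _
    eval-· a t [ x , x′ ] = ≋-trans
      (+-cong (eval-· (a ∘ suc) t x) (≋-trans (*-cong ≋-refl (eval-· (a ∘ suc) t x′)) (·-*ʳ _ _ _)))
      (≋-sym (·-distribˡ _ _ _))

    eval-zero : ∀ {m} (a : Fin m → Φ p) → eval a zeroΦ ≋ zeroΦ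
    eval-zero {zero}  a = ·-zeroˡ _
    eval-zero {suc m} a = ≋-trans (+-cong (eval-zero (a ∘ suc)) (≋-trans (*-cong ≋-refl (eval-zero (a ∘ suc))) (*-zeroʳ _))) (+-identityˡ _)

    eval-one : ∀ {m} (a : Fin m → Φ p) → eval a oneΦ ≋ oneΦ
    eval-one {zero}  a = ·-identity _
    eval-one {suc m} a = ≋-trans (+-cong (eval-one (a ∘ suc)) (≋-trans (*-cong ≋-refl (eval-zero (a ∘ suc))) (*-zeroʳ _))) (+-identityʳ _)

    -- The product formula in `Φ` drops one of the four terms, the one containing `φ zero` twice; on
    -- the other side it vanishes because `a zero` squares to zero.
    eval-* : ∀ {m} (a : Fin m → Φ p) → (∀ e → a e * a e ≋ zeroΦ) → ∀ x y → eval a (x * y) ≋ eval a x * eval a y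
    eval-* a h (const s) (const t) = ≋-sym (≋-trans (·-*ˡ _ _ _) (≋-trans (·-congˡ (*-identityˡ _)) (≋-sym (·-assoc _ _ _))))
    eval-* a h [ x , x′ ] [ y , y′ ] = ≋-sym (≋-trans (*-distribʳ _ _ _)
      (≋-trans (+-cong (*-distribˡ _ _ _) (*-distribˡ _ _ _))
      (≋-trans (+-assoc _ _ _)
      (+-cong (≋-sym (eval-* a′ h′ x y))
        (≋-trans (≋-sym (+-assoc _ _ _))
        (≋-trans (+-cong (+-cong (ΦT.x∙yz≈y∙xz _ _ _) (*-assoc _ _ _)) square)
        (≋-trans (+-identityʳ _)
        (≋-trans (≋-sym (*-distribˡ _ _ _))
          (*-cong ≋-refl (≋-trans (+-cong (≋-sym (eval-* a′ h′ x y′)) (≋-sym (eval-* a′ h′ x′ y))) (≋-sym (eval-+ a′ (x * y′) (x′ * y))))))))))))) 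
      where
      a′ = a ∘ suc
      h′ = h ∘ suc
      square : (a zero * eval a′ x′) * (a zero * eval a′ y′) ≋ zeroΦ
      square = ≋-trans (ΦT.interchange _ _ _ _) (≋-trans (*-cong (h zero) ≋-refl) (*-zeroˡ _))

    eval-φ : ∀ {m} (a : Fin m → Φ p) e → eval a (φ e) ≋ a e
    eval-φ a zero    = ≋-trans (+-cong (eval-zero (a ∘ suc)) (≋-trans (*-cong ≋-refl (eval-one (a ∘ suc))) (*-identityʳ _))) (+-identityˡ _)
    eval-φ a (suc e) = ≋-trans (+-cong (eval-φ (a ∘ suc) e) (≋-trans (*-cong ≋-refl (eval-zero (a ∘ suc))) (*-zeroʳ _))) (+-identityʳ _)

    eval-hom : ∀ {m} (a : Fin m → Φ p) → (∀ e → a e * a e ≋ zeroΦ) → Hom m p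
    eval-hom a h = record
      { fun = eval a ; congr = eval-cong (λ _ → ≋-refl) ; plus = eval-+ a ; scale = eval-· a
      ; times = eval-* a h ; unit = eval-one a }

    -- The uniqueness half of the universal property of `Φ`: homomorphisms are determined on
    -- generators, since restricting `h` to elements free of `φ zero` gives a homomorphism with one
    -- generator fewer.
    hom-eval : ∀ {m} (h : Hom m p) x → fun h x ≋ eval (λ e → fun h (φ e)) x
    hom-eval {zero} h (const t) = ≋-trans (congr h {y = t · oneΦ} ⟪ F.sym (F.*-identityʳ t) ⟫) (≋-trans (scale h t oneΦ) (·-congˡ (unit h)))
    hom-eval {suc m} h [ x , y ] = ≋-trans (congr h {y = [ x , zeroΦ ] + φ zero * [ y , zeroΦ ]} split)
      (≋-trans (plus h _ _) (+-cong (hom-eval h′ x) (≋-trans (times h _ _) (*-cong ≋-refl (hom-eval h′ y)))))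
      where
      split : [ x , y ] ≋ [ x , zeroΦ ] + φ zero * [ y , zeroΦ ]
      split = pair-cong (≋-sym (≋-trans (+-cong ≋-refl (*-zeroˡ _)) (+-identityʳ _)))
        (≋-sym (≋-trans (+-identityˡ _) (≋-trans (+-cong (*-zeroˡ _) (*-identityˡ _)) (+-identityˡ _))))
      h′ : Hom m p
      h′ = record
        { fun = λ x → fun h [ x , zeroΦ ]
        ; congr = λ q → congr h (pair-cong q ≋-refl)
        ; plus = λ x y → ≋-trans (congr h (pair-cong ≋-refl (≋-sym (+-identityˡ _)))) (plus h _ _)
        ; scale = λ t x → ≋-trans (congr h (pair-cong ≋-refl (≋-sym (·-zeroʳ t)))) (scale h t _)
        ; times = λ x y → ≋-trans (congr h (pair-cong ≋-refl (≋-sym (≋-trans (+-cong (*-zeroʳ x) (*-zeroˡ y)) (+-identityˡ _))))) (times h _ _)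
        ; unit = unit h }

  hom-unique : ∀ {m p} (h k : Hom m p) → (∀ e → fun h (φ e) ≋ fun k (φ e)) → ∀ x → fun h x ≋ fun k x
  hom-unique h k q x = ≋-trans (hom-eval h x) (≋-trans (eval-cong {x = x} q ≋-refl) (≋-sym (hom-eval k x)))

  φ-square : ∀ {m} (e : Fin m) → φ e * φ e ≋ zeroΦ
  φ-square zero    = pair-cong (*-zeroˡ _) (≋-trans (+-cong (*-zeroˡ _) (*-zeroʳ _)) (+-identityˡ _))
  φ-square (suc e) = pair-cong (φ-square e) (≋-trans (+-cong (*-zeroʳ _) (*-zeroˡ _)) (+-identityˡ _))

  factor : ∀ {n m} → Graph n m → Fin (suc n) → Fin m → Φ m
  factor G i e = oneΦ + coeff i (G e) · φ e

  -- `P.sum` is the sum of the multiplicative monoid, hence a product; in this form its factors can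
  -- be permuted.
  Y-product : ∀ {n m} (G : Graph n m) i → Y G i ≋ P.sum (factor G i)
  Y-product {m = m} G i = subst (λ l → prodΦ l ≋ P.sum (factor G i)) (sym (List.map-tabulate (λ e → e) (factor G i))) (go (factor G i))
    where
    go : ∀ {k} (f : Fin k → Φ m) → prodΦ (List.tabulate f) ≋ P.sum f
    go {zero}  f = ≋-refl
    go {suc k} f = *-cong ≋-refl (go (f ∘ suc))

  hom-product : ∀ {m p k} (h : Hom m p) (f : Fin k → Φ m) → fun h (P.sum f) ≋ P.sum (fun h ∘ f)
  hom-product {k = zero}  h f = unit h
  hom-product {k = suc k} h f = ≋-trans (times h _ _) (*-cong ≋-refl (hom-product h (f ∘ suc)))

  Span-image : ∀ {n₁ m₁ n₂ m₂} {G₁ : Graph n₁ m₁} {G₂ : Graph n₂ m₂} (h : Hom m₁ m₂) (τ : Fin (suc n₁) → Fin (suc n₂)) →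
    (∀ i → fun h (Y G₁ i) ≋ Y G₂ (τ i)) → ∀ {k x} → Span G₁ k x → Span G₂ k (fun h x)
  Span-image {n₁} {n₂ = n₂} {G₁ = G₁} {G₂} h τ hY (ts , le , q) = map rename ts , bound le , ≋-trans (congr h q) (go ts)
    where
    rename : 𝕂 × List (Fin (suc n₁)) → 𝕂 × List (Fin (suc n₂))
    rename (a , is) = a , map τ is
    bound : ∀ {k ts} → All (λ t → length (proj₂ t) ≤ k) ts → All (λ t → length (proj₂ t) ≤ k) (map rename ts)
    bound []                = []
    bound {ts = t ∷ _} (l ∷ ls) = subst (_≤ _) (sym (List.length-map τ (proj₂ t))) l ∷ bound ls
    monomial : ∀ is → fun h (prodΦ (map (Y G₁) is)) ≋ prodΦ (map (Y G₂) (map τ is))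
    monomial []       = unit h
    monomial (i ∷ is) = ≋-trans (times h _ _) (*-cong (hY i) (monomial is))
    go : ∀ ts → fun h (value G₁ ts) ≋ value G₂ (map rename ts)
    go []             = zero-fun h
    go ((a , is) ∷ ts) = ≋-trans (plus h _ _) (+-cong (≋-trans (scale h _ _) (·-congˡ (monomial is))) (go ts))

  module _ {n₁ n₂} (σ : Fin (suc n₁) ↔ Fin (suc n₂)) where
    open Inverse σ using (to; from; strictlyInverseˡ)

    -- The vertex bijection may reverse the order of the ends of an edge, which changes the signs at
    -- both ends; rescaling the generator compensates for this.
    sign : ∀ {e : Edge n₁} {g : Edge n₂} → Ends g (to (lo e)) (to (hi e)) → 𝕂
    sign (up _ _)   = F.1#
    sign (down _ _) = F.- F.1#

    -1*-1 : F.- F.1# F.* F.- F.1# F.≈ F.1#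
    -1*-1 = F.trans (RingProperties.-1*x≈-x F.ring _) (RingProperties.-‿involutive F.ring _)

    sign-square : ∀ {e : Edge n₁} {g : Edge n₂} (p : Ends g (to (lo e)) (to (hi e))) → sign {e} p F.* sign {e} p F.≈ F.1#
    sign-square (up _ _)   = F.*-identityˡ _
    sign-square (down _ _) = -1*-1

    coeff-sign : ∀ {e : Edge n₁} {g : Edge n₂} (p : Ends g (to (lo e)) (to (hi e))) i →
      coeff i e F.* sign {e} p F.≈ coeff (to i) g
    coeff-sign {e} {g} p i with incident? i e
    coeff-sign {e} {g} p i | no ¬i = F.trans (F.trans (F.*-congʳ (coeff-apart {e = e} ¬i)) (F.zeroˡ _)) (F.sym (coeff-apart {e = g} outside))
      where
      outside : ¬ Incident (to i) g
      outside q with Ends-only p q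
      ... | inj₁ eq = ¬i (inj₁ (to-injective σ eq))
      ... | inj₂ eq = ¬i (inj₂ (to-injective σ eq))
    coeff-sign {e} {g} (up q r) i | yes (inj₁ refl) = F.trans (F.*-identityʳ _) (F.trans (coeff-lo e)
      (F.sym (subst (λ j → coeff j g F.≈ F.1#) q (coeff-lo g))))
    coeff-sign {e} {g} (up q r) i | yes (inj₂ refl) = F.trans (F.*-identityʳ _) (F.trans (coeff-hi e)
      (F.sym (subst (λ j → coeff j g F.≈ F.- F.1#) r (coeff-hi g))))
    coeff-sign {e} {g} (down q r) i | yes (inj₁ refl) = F.trans (F.*-congʳ (coeff-lo e)) (F.trans (F.*-identityˡ _)
      (F.sym (subst (λ j → coeff j g F.≈ F.- F.1#) r (coeff-hi g))))
    coeff-sign {e} {g} (down q r) i | yes (inj₂ refl) = F.trans (F.*-congʳ (coeff-hi e)) (F.trans -1*-1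
      (F.sym (subst (λ j → coeff j g F.≈ F.1#) q (coeff-lo g))))

    module _ {m₁ m₂} (G₁ : Graph n₁ m₁) (G₂ : Graph n₂ m₂) (π : Permutation m₁ m₂)
             (ends : ∀ e → Ends (G₂ (π ⟨$⟩ʳ e)) (to (lo (G₁ e))) (to (hi (G₁ e)))) where

      s : Fin m₁ → 𝕂
      s e = sign {G₁ e} (ends e)

      scaled-square : ∀ {m} t (e : Fin m) → (t · φ e) * (t · φ e) ≋ zeroΦ
      scaled-square t e = ≋-trans (·-*ˡ _ _ _) (≋-trans (·-congˡ (≋-trans (·-*ʳ _ _ _) (≋-trans (·-congˡ (φ-square e)) (·-zeroʳ t)))) (·-zeroʳ t))

      opaque
        there : Hom m₁ m₂
        there = eval-hom (λ e → s e · φ (π ⟨$⟩ʳ e)) (λ e → scaled-square (s e) _)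

        back : Hom m₂ m₁
        back = eval-hom (λ g → s (π ⟨$⟩ˡ g) · φ (π ⟨$⟩ˡ g)) (λ g → scaled-square _ _)

        there-φ : ∀ e → fun there (φ e) ≋ s e · φ (π ⟨$⟩ʳ e)
        there-φ = eval-φ (λ e → s e · φ (π ⟨$⟩ʳ e))

        back-φ : ∀ g → fun back (φ g) ≋ s (π ⟨$⟩ˡ g) · φ (π ⟨$⟩ˡ g)
        back-φ = eval-φ (λ g → s (π ⟨$⟩ˡ g) · φ (π ⟨$⟩ˡ g))

      unsign : ∀ {m} e (x : Φ m) → s e · (s e · x) ≋ x
      unsign e x = ≋-trans (≋-sym (·-assoc _ _ _)) (≋-trans (·-cong (sign-square {G₁ e} (ends e)) ≋-refl) (·-identity x))

      back-there : ∀ x → fun back (fun there x) ≋ x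
      back-there = hom-unique (back ∘h there) id-hom λ e →
        ≋-trans (congr back (there-φ e)) (≋-trans (scale back _ _) (≋-trans (·-congˡ (back-φ (π ⟨$⟩ʳ e)))
          (subst (λ e′ → s e · (s e′ · φ e′) ≋ φ e) (sym (Perm.inverseˡ π)) (unsign e (φ e)))))

      there-back : ∀ x → fun there (fun back x) ≋ x
      there-back = hom-unique (there ∘h back) id-hom λ g →
        ≋-trans (congr there (back-φ g)) (≋-trans (scale there _ _) (≋-trans (·-congˡ (there-φ (π ⟨$⟩ˡ g)))
          (subst (λ g′ → s (π ⟨$⟩ˡ g) · (s (π ⟨$⟩ˡ g) · φ g′) ≋ φ g) (sym (Perm.inverseʳ π)) (unsign (π ⟨$⟩ˡ g) (φ g)))))

      there-Y : ∀ i → fun there (Y G₁ i) ≋ Y G₂ (to i)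
      there-Y i = ≋-trans (congr there (Y-product G₁ i)) (≋-trans (hom-product there (factor G₁ i))
        (≋-trans (P.sum-cong-≋ each) (≋-trans (≋-sym (P.sum-permute (factor G₂ (to i)) π)) (≋-sym (Y-product G₂ (to i))))))
        where
        each : ∀ e → fun there (factor G₁ i e) ≋ factor G₂ (to i) (π ⟨$⟩ʳ e)
        each e = ≋-trans (plus there _ _) (+-cong (unit there) (≋-trans (scale there _ _)
          (≋-trans (·-congˡ (there-φ e)) (≋-trans (≋-sym (·-assoc _ _ _)) (·-cong (coeff-sign {G₁ e} (ends e) i) ≋-refl)))))

      back-Y : ∀ j → fun back (Y G₂ j) ≋ Y G₁ (from j)
      back-Y j = subst (λ j′ → fun back (Y G₂ j′) ≋ Y G₁ (from j)) (strictlyInverseˡ j)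
        (≋-trans (congr back (≋-sym (there-Y (from j)))) (back-there _))

      filteredIso : FilteredIso G₁ G₂
      filteredIso = record
        { ψ        = λ x _ → fun there x
        ; ψ-cong   = λ x y _ _ p → unwrap (congr there {x} {y} ⟪ p ⟫)
        ; ψ-into   = λ x (k , f) → k , forth k x f
        ; ψ-+      = λ x y _ _ _ → unwrap (plus there x y)
        ; ψ-·      = λ a x _ _ → unwrap (scale there a x)
        ; ψ-*      = λ x y _ _ _ → unwrap (times there x y)
        ; ψ-1      = λ _ → unwrap (unit there)
        ; ψ-inj    = λ x y _ _ p → unwrap (≋-trans (≋-sym (back-there x)) (≋-trans (congr back ⟪ p ⟫) (back-there y)))
        ; ψ-surj   = λ z (k , f) → fun back z , (k , pull k z f) , unwrap (there-back z)
        ; ψ-filt   = λ k x _ f → forth k x f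
        ; ψ-filt⁻¹ = λ k z f → fun back z , (k , pull k z f) , pull k z f , unwrap (there-back z) }
        where
        forth : ∀ k x → Filt G₁ k x → Filt G₂ k (fun there x)
        forth k x f = Span⇒Filt G₂ (Span-image {G₁ = G₁} {G₂} there to there-Y {k} {x} (Filt⇒Span G₁ f))
        pull : ∀ k z → Filt G₂ k z → Filt G₁ k (fun back z)
        pull k z f = Span⇒Filt G₁ (Span-image {G₁ = G₂} {G₁} back from back-Y {k} {z} (Filt⇒Span G₂ f))

theorem5 : ∀ {c ℓ : Level} (K : Field c ℓ) → CharZero K →
    ∀ {n₁ m₁ n₂ m₂ : ℕ} (G₁ : Graph n₁ m₁) (G₂ : Graph n₂ m₂) →
    NoIsolatedVertex G₁ → NoIsolatedVertex G₂ →
    ((Algebra.FilteredIso K G₁ G₂ → GraphIso G₁ G₂)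
    × (GraphIso G₁ G₂ → Algebra.FilteredIso K G₁ G₂))
theorem5 K char0 G₁ G₂ cover₁ cover₂ =
  Forward.recover K char0 G₁ G₂ cover₁ cover₂ ,
  λ iso → let open GraphIso iso
              π , ends = edge-bijection σ G₁ G₂ preserve
          in Backward.filteredIso K σ G₁ G₂ π ends
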